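{- Given a process template $P$, for every edge $e$ of its reachability-unwinding $P^{\multimap}$ it is decidable which of the types blue, green, orange, red the edge $e$ has.
   Context: Fix an integer $k\ge 1$ and a finite set $\Sigma_{\mathrm{actn}}$ of rendezvous actions; let $\Sigma_{\mathrm{rdz}}=\bigcup_{a\in\Sigma_{\mathrm{actn}}}\{a_1,\dots,a_k\}$ and let $\mathfrak b$ be a fresh broadcast symbol. A process template is a finite labeled transition system $P=(S,I,R,\Sigma_{\mathrm{rdz}}\cup\{\mathfrak b\})$ with finite state set $S$, initial states $I\subseteq S$ and edges $R\subseteq S\times(\Sigma_{\mathrm{rdz}}\cup\{\mathfrak b\})\times S$, such that every $s\in S$ has an outgoing edge $(s,\mathfrak b,s')\in R$; for the given $P$ also every $\varsigma\in\Sigma_{\mathrm{rdz}}$ labels at most one edge of $R$. For a template and $N\in\mathbb N$, the RB-system has configurations $f:[N]\to S$, initial configurations those with $f(i)\in I$ for all $i$, and transitions: broadcast transitions $(f,\mathfrak b,g)$ with $(f(i),\mathfrak b,g(i))\in R$ for all $i$; and rendezvous transitions $(f,((i_1,a_1),\dots,(i_k,a_k)),g)$ where $a\in\Sigma_{\mathrm{actn}}$, $i_1,\dots,i_k\in[N]$ pairwise distinct, $(f(i_j),a_j,g(i_j))\in R$ for all $j$, and $g(i)=f(i)$ for other $i$. The infinite RB-system is the union over all $N$; runs are paths from initial configurations. For a path $\pi$, $\pi(1)$ is the sequence of edges taken by process $1$ (in a broadcast transition $(f(1),\mathfrak b,g(1))$, in a rendezvous transition with $1=i_j$ the edge $(f(1),a_j,g(1))$,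 other transitions skipped); the infinite executions are the infinite sequences $\pi(1)$ for runs $\pi$. Reachability-unwinding: define $I_0=I$, $I_i=\{s\mid (h,\mathfrak b,s)\in R,\ h\in S_{i-1}\}$ for $i>0$, and $(S_i,R_i)$ by saturation: start with $S_i=I_i$, $R_i=\emptyset$; repeatedly add an edge $(s,a_h,t)\in R\setminus R_i$ to $R_i$ and $t$ to $S_i$ whenever for every $l\in[k]$ some edge $(s',a_l,t')\in R$ has $s'\in S_i$, until a fixed point. Let $m$ be least with $(S_{m+1},I_{m+1},R_{m+1})=(S_n,I_n,R_n)$ for some $n\le m$. $P^{\multimap}$ has states $\bigcup_{i=0}^m S_i\times\{i\}$, initial states $I\times\{0\}$, rendezvous edges $((s,i),\varsigma,(t,i))$ for $(s,\varsigma,t)\in R_i$, and broadcast edges $((s,i),\mathfrak b,(t,i+1))$ ($i<m$, $s\in S_i$, $(s,\mathfrak b,t)\in R$) and $((s,m),\mathfrak b,(t,n))$ ($s\in S_m$, $(s,\mathfrak b,t)\in R$). $\mathcal P^{\multimap}$ is the infinite RB-system with template $P^{\multimap}$. Edge types of an edge $e$ of $P^{\multimap}$ (with respect to infinite executions of $\mathcal P^{\multimap}$): red if it occurs only finitely often on every infinite execution; blue if it occurs infinitely often on some infinite execution with finitely many broadcast edges, but only finitely often on every infinite execution with infinitely many broadcast edges; green if there is an infinite execution with infinitely many broadcast edges such that for every $N\in\mathbb N$ some contiguous broadcast-free segment of it contains at least $N$ occurrences of $e$; orange if it is neither red, blue, nor green. -}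

module Defs where

open import Data.Nat using (ℕ; zero; suc; _≤_; _<_)
open import Data.Fin using (Fin; zero; suc)
open import Data.Bool using (Bool; true)
open import Data.Product using (Σ; ∃; ∃-syntax; _×_; _,_)
open import Data.Sum using (_⊎_)
open import Relation.Nullary using (¬_)
open import Relation.Binary.PropositionalEquality using (_≡_; _≢_)
open import Function.Bundles using (_⇔_)

-- Labels: rendezvous symbols a_j (a ∈ Σ_actn = Fin A, j ∈ [k] = Fin k)
-- and the broadcast symbol 𝔟.

data Label (k A : ℕ) : Set where
  rdz : Fin A → Fin k → Label k A
  bc  : Label k A

record Template (k A : ℕ) : Set where
  field
    nSt       : ℕ
    init      : Fin nSt → Bool
    edge      : Fin nSt → Label k A → Fin nSt → Bool
    bcTotal   : ∀ s → ∃[ t ] edge s bc t ≡ true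
    rdzUnique : ∀ a j s t s' t' → edge s (rdz a j) t ≡ true →
                edge s' (rdz a j) t' ≡ true → (s ≡ s') × (t ≡ t')

record LTS (k A : ℕ) : Set₁ where
  field
    St   : Set
    Init : St → Set
    Edge : St → Label k A → St → Set

module RB {k A : ℕ} (L : LTS k A) where
  open LTS L

  Triple : Set
  Triple = St × Label k A × St

  label : Triple → Label k A
  label (_ , l , _) = l

  -- configurations of size N+1 (process 1 is `zero`)
  Config : ℕ → Set
  Config N = Fin (suc N) → St

  data Trans {N : ℕ} (f g : Config N) : Set where
    bcast : (∀ i → Edge (f i) bc (g i)) → Trans f g
    rdzv  : (a : Fin A) (ι : Fin k → Fin (suc N)) →
            (∀ j j' → ι j ≡ ι j' → j ≡ j') →
            (∀ j → Edge (f (ι j)) (rdz a j) (g (ι j))) →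
            (∀ i → (∀ j → ι j ≢ i) → g i ≡ f i) →
            Trans f g

  edge₁ : ∀ {N} {f g : Config N} → Trans f g → Triple → Set
  edge₁ {f = f} {g} (bcast _) e = e ≡ (f zero , bc , g zero)
  edge₁ {f = f} {g} (rdzv a ι _ _ _) e =
    ∃[ j ] (ι j ≡ zero × e ≡ (f zero , rdz a j , g zero))

  record Run : Set where
    field
      N    : ℕ
      conf : ℕ → Config N
      init : ∀ i → Init (conf 0 i)
      step : ∀ t → Trans (conf t) (conf (suc t))

  -- e = π(1) for some infinite run π: σ enumerates, in increasing order,
  -- exactly the steps of π in which process 1 participates.
  IsExecution : (ℕ → Triple) → Set
  IsExecution e =
    Σ Run λ r → Σ (ℕ → ℕ) λ σ →
      (∀ n → σ n < σ (suc n)) ×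
      (∀ n → edge₁ (Run.step r (σ n)) (e n)) ×
      (∀ t → (∃[ x ] edge₁ (Run.step r t) x) → ∃[ n ] σ n ≡ t)

  InfOften : (Triple → Set) → (ℕ → Triple) → Set
  InfOften P e = ∀ M → ∃[ n ] (M ≤ n × P (e n))

  InfBcast : (ℕ → Triple) → Set
  InfBcast = InfOften (λ x → label x ≡ bc)

  Red : Triple → Set
  Red ed = ∀ e → IsExecution e → ¬ InfOften (_≡ ed) e

  Blue : Triple → Set
  Blue ed =
    (∃[ e ] (IsExecution e × ¬ InfBcast e × InfOften (_≡ ed) e)) ×
    (∀ e → IsExecution e → InfBcast e → ¬ InfOften (_≡ ed) e)

  Green : Triple → Set
  Green ed =
    ∃[ e ] (IsExecution e × InfBcast e ×
      (∀ M → ∃[ i ] ∃[ j ]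
        ((∀ t → i ≤ t → t < j → label (e t) ≢ bc) ×
         Σ (Fin M → ℕ) λ p →
           (∀ x y → p x ≡ p y → x ≡ y) ×
           (∀ x → i ≤ p x × p x < j × e (p x) ≡ ed))))

  Orange : Triple → Set
  Orange ed = ¬ Red ed × ¬ Blue ed × ¬ Green ed

module Unwind {k A : ℕ} (P : Template k A) where
  open Template P

  mutual
    data InS : ℕ → Fin nSt → Set where
      init0 : ∀ {s} → init s ≡ true → InS 0 s
      bstep : ∀ {i h s} → InS i h → edge h bc s ≡ true → InS (suc i) s
      rtgt  : ∀ {i s a h t} → InR i s a h t → InS i t

    data InR : ℕ → Fin nSt → Fin A → Fin k → Fin nSt → Set where
      sat : ∀ {i s a h t} → edge s (rdz a h) t ≡ true →
            (∀ l → ∃[ s' ] ∃[ t' ] (edge s' (rdz a l) t' ≡ true × InS i s')) →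
            InR i s a h t

  InI : ℕ → Fin nSt → Set
  InI zero s    = init s ≡ true
  InI (suc i) s = ∃[ h ] (InS i h × edge h bc s ≡ true)

  SameLevel : ℕ → ℕ → Set
  SameLevel i j =
    (∀ s → InS i s ⇔ InS j s) ×
    (∀ s → InI i s ⇔ InI j s) ×
    (∀ s a h t → InR i s a h t ⇔ InR j s a h t)

  IsPeriod : ℕ → ℕ → Set
  IsPeriod m n =
    n ≤ m × SameLevel (suc m) n ×
    (∀ m' → m' < m → ∀ j → j ≤ m' → ¬ SameLevel (suc m') j)

  UInit : Fin nSt × ℕ → Set
  UInit (s , i) = init s ≡ true × i ≡ 0

  UEdge : ℕ → ℕ → Fin nSt × ℕ → Label k A → Fin nSt × ℕ → Set
  UEdge m n (s , i) (rdz a h) (t , j) = i ≡ j × i ≤ m × InR i s a h t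
  UEdge m n (s , i) bc (t , j) =
    i ≤ m × InS i s × edge s bc t ≡ true ×
    ((i < m × j ≡ suc i) ⊎ (i ≡ m × j ≡ n))

  unwind : ℕ → ℕ → LTS k A
  unwind m n = record
    { St   = Fin nSt × ℕ
    ; Init = UInit
    ; Edge = UEdge m n
    }

-- The four types are Boolean combinations of three properties of an edge: it recurs on an execution with
-- finitely many broadcasts; it recurs on one with infinitely many broadcasts; it occurs in unbounded
-- bursts between infinitely many broadcasts.  Each is equivalent to the existence of certain circulations
-- on the unwinding, in which all k edges of a rendezvous carry the same flow.
--
-- An execution repeats a configuration, and the edges taken in between by all processes form a
-- circulation.  If broadcasts occur in between, then moreover each rendezvous used is enabled, step by
-- step, from states entered by the broadcasts used and, backwards in time, from states left by them.
-- Conversely, arbitrarily many processes can be brought into the states of a level of the unwinding, and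
-- a multiple of a circulation with these enabledness properties can be executed, as in a continuous
-- Petri net.  Repeating it revisits a configuration, so some process takes the edge on a closed path.
--
-- Circulations through a given edge are solutions over ℕ of a homogeneous linear system, which is decided
-- by eliminating one equation at a time.  No excluded middle is needed: if an edge recurs on an execution
-- but lies on no broadcast-free circulation, then the next broadcast is found within a bounded number of
-- its occurrences.

module Submission where

open import Defs
open import Data.Nat as ℕ using (ℕ; zero; suc; _≤_; _<_; z≤n; s≤s)
import Data.Nat.Properties as ℕ
open import Data.Integer as ℤ using (ℤ; -[1+_]; 0ℤ; ∣_∣)
import Data.Integer.Properties as ℤ
open import Data.Fin using (Fin; zero; suc; toℕ; fromℕ<; punchIn; combine; join; splitAt; funToFin; finToFun)
import Data.Fin.Properties as Fin
open import Data.Bool using (Bool; true; false; _∨_; if_then_else_)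
import Data.Bool.Properties as Bool
open import Data.Maybe using (Maybe; just; nothing)
open import Data.Maybe.Properties using (just-injective)
open import Data.Unit using (⊤; tt)
open import Data.Empty using (⊥; ⊥-elim)
open import Data.Product using (Σ; ∃; ∃-syntax; _×_; _,_; proj₁; proj₂)
import Data.Product.Properties as Product
open import Data.Sum using (_⊎_; inj₁; inj₂)
import Data.Sum.Properties as Sum
open import Data.List using (List; []; _∷_; [_]; _++_; length; lookup; map; filter; replicate; reverse; tabulate; allFin; upTo; cartesianProduct; cartesianProductWith)
import Data.List.Properties as List
open import Data.List.Relation.Unary.All as All using (All; []; _∷_)
import Data.List.Relation.Unary.All.Properties as All
open import Data.List.Relation.Unary.Any as Any using (Any; here; there)
import Data.List.Relation.Unary.Any.Properties as Any
open import Data.List.Membership.Propositional using (_∈_; find; lose)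
open import Data.List.Membership.Propositional.Properties
import Data.List.Membership.DecPropositional as DecMembership
open import Data.List.Relation.Binary.Permutation.Propositional as Perm using (_↭_; ↭-trans; ↭-sym; ↭-refl; ↭-prep; ↭-reflexive)
import Data.List.Relation.Binary.Permutation.Propositional.Properties as Perm
open import Relation.Nullary using (Dec; yes; no; ¬_; does)
open import Relation.Nullary.Decidable using (map′; _×-dec_; _⊎-dec_; ¬?; dec-true)
open import Relation.Unary using (Decidable)
open import Relation.Binary.Definitions using (DecidableEquality; Tri; tri<; tri≈; tri>)
open import Relation.Binary.PropositionalEquality using (_≡_; _≢_; _≗_; refl; sym; trans; cong; cong₂; subst; subst₂; module ≡-Reasoning)
open import Function using (_∘_)
open import Function.Bundles using (Equivalence)

-- Homogeneous linear systems over ℕ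

-- A configuration lives on a single level, a circulation on all of them at once. The bridge is a
-- covering invariant: a vector over states and levels is compared with a configuration only on the
-- current level and only as a lower bound, so one firing sequence serves every level of a lap and
-- surplus processes do no harm. Lower bounds never show that a configuration recurs exactly; this
-- comes from pigeonhole, as for a fixed number of processes there are finitely many configurations.
--
-- What a lap with broadcasts needs depends only on the support of a circulation: circulations add
-- up, multiples are allowed, and enabledness is a closure property of the support. There are
-- finitely many supports, which are tried one by one; only the question of a circulation through
-- one edge inside a given support is left to linear algebra.
--
-- Enabledness is demanded in both time directions because a lap must bring the processes to the
-- states from which its broadcasts depart: rendezvous may be needed to collect them there, just as
-- others spread them after the previous broadcast.

copies : {Y : Set} → ℕ → List Y → List Y
copies zero    W = []
copies (suc n) W = W ++ copies n W

All-copies : {Y : Set} {Q : Y → Set} (n : ℕ) {W : List Y} → All Q W → All Q (copies n W)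
All-copies zero    a = []
All-copies (suc n) a = All.++⁺ a (All-copies n a)

module IntegerIdentities where
  open import Data.Integer using (_+_; _-_)
  open import Data.Integer.Tactic.RingSolver using (solve-∀)

  minus-+ : ∀ a b c d → (a - b) + (c - d) ≡ (a + c) - (b + d)
  minus-+ = solve-∀

module Elimination {R : Set} where

  open import Data.Integer using (+_; _+_; _*_)
  open import Data.Integer.Tactic.RingSolver using (solve-∀)


  -- The Boolean marks the columns that a solution has to use; a combined column inherits the marks
  -- of its parts.
  Col : Set
  Col = Bool × (R → ℤ)

  marked : Col → Set
  marked c = proj₁ c ≡ true

  total : List Col → R → ℤ
  total []      r = 0ℤ
  total (c ∷ W) r = proj₂ c r + total W r

  total-++ : ∀ V W r → total (V ++ W) r ≡ total V r + total W r
  total-++ []      W r = sym (ℤ.+-identityˡ _)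
  total-++ (c ∷ V) W r = trans (cong (ℤ._+_ (proj₂ c r)) (total-++ V W r)) (sym (ℤ.+-assoc (proj₂ c r) _ _))

  total-replicate : ∀ n c r → total (replicate n c) r ≡ + n * proj₂ c r
  total-replicate zero    c r = sym (ℤ.*-zeroˡ (proj₂ c r))
  total-replicate (suc n) c r = trans (cong (ℤ._+_ (proj₂ c r)) (total-replicate n c r))
    (sym (ℤ.suc-* (+ n) (proj₂ c r)))

  -- A vector over ℕ is represented by a list, the coefficient of a column being its multiplicity.
  -- The marked member excludes the zero solution.
  Solution : List R → List Col → Set
  Solution rows xs = ∃[ W ] (All (_∈ xs) W × Any marked W × (∀ {r} → r ∈ rows → total W r ≡ 0ℤ))

  module Step (r : R) where

    Zero Pos Neg : Col → Set
    Zero c = proj₂ c r ≡ 0ℤ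
    Pos  c = 0ℤ ℤ.< proj₂ c r
    Neg  c = proj₂ c r ℤ.< 0ℤ

    zero? : ∀ c → Dec (Zero c)
    zero? c = proj₂ c r ℤ.≟ 0ℤ
    pos? : ∀ c → Dec (Pos c)
    pos? c = 0ℤ ℤ.<? proj₂ c r
    neg? : ∀ c → Dec (Neg c)
    neg? c = proj₂ c r ℤ.<? 0ℤ

    weight : Col → ℕ
    weight c = ∣ proj₂ c r ∣

    merge : Col → Col → Col
    merge x y = proj₁ x ∨ proj₁ y , λ q → + weight y * proj₂ x q + + weight x * proj₂ y q

    -- A double description step: up to a positive multiple, the solutions of one homogeneous
    -- equation over ℕ are generated by the columns vanishing in row `r` and the cancelling
    -- combinations of one positive with one negative column. The multiple is harmless, since only
    -- existence matters.
    eliminate : List Col → List Col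
    eliminate xs = filter zero? xs ++ cartesianProductWith merge (filter pos? xs) (filter neg? xs)

    pos-weight : ∀ {c} → Pos c → proj₂ c r ≡ + weight c
    pos-weight p = sym (ℤ.0≤i⇒+∣i∣≡i (ℤ.<⇒≤ p))

    neg-weight : ∀ {c} → Neg c → proj₂ c r ≡ ℤ.- (+ weight c)
    neg-weight {c} p with proj₂ c r | p
    ... | -[1+ n ] | _ = refl
    ... | + n | ℤ.+<+ ()

    weight≢0 : ∀ {c} → Pos c ⊎ Neg c → weight c ≢ 0
    weight≢0 (inj₁ p) e = ℤ.<⇒≢ p (sym (ℤ.∣i∣≡0⇒i≡0 e))
    weight≢0 (inj₂ p) e = ℤ.<⇒≢ p (ℤ.∣i∣≡0⇒i≡0 e)

    Expansion : List Col → Col → Set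
    Expansion xs h = ∃[ V ] (All (_∈ xs) V × (marked h → Any marked V) ×
                             (∀ q → total V q ≡ proj₂ h q) × total V r ≡ 0ℤ)

    any-replicate : ∀ {n x} → n ≢ 0 → marked x → Any marked (replicate n x)
    any-replicate {zero}  n≢0 m = ⊥-elim (n≢0 refl)
    any-replicate {suc n} n≢0 m = here m

    expand : ∀ xs h → h ∈ eliminate xs → Expansion xs h
    expand xs h h∈ with ∈-++⁻ (filter zero? xs) h∈
    ... | inj₁ h∈Z with ∈-filter⁻ zero? {xs = xs} h∈Z
    ...   | h∈xs , z = h ∷ [] , h∈xs ∷ [] , here , (λ q → ℤ.+-identityʳ _) , trans (ℤ.+-identityʳ _) z
    expand xs h h∈ | inj₂ h∈C
      with ∈-cartesianProductWith⁻ merge (filter pos? xs) (filter neg? xs) h∈C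
    ... | x , y , x∈P , y∈N , refl with ∈-filter⁻ pos? {xs = xs} x∈P | ∈-filter⁻ neg? {xs = xs} y∈N
    ...   | x∈ , px | y∈ , ny = V , allV , anyV , tot , trans (tot r) balance
      where
      V = replicate (weight y) x ++ replicate (weight x) y
      allV : All (_∈ xs) V
      allV = All.++⁺ (All.replicate⁺ (weight y) x∈) (All.replicate⁺ (weight x) y∈)
      anyV : proj₁ x ∨ proj₁ y ≡ true → Any marked V
      anyV m with proj₁ x in ex
      ... | true  = Any.++⁺ˡ (any-replicate (weight≢0 {y} (inj₂ ny)) ex)
      ... | false = Any.++⁺ʳ (replicate (weight y) x) (any-replicate (weight≢0 {x} (inj₁ px)) m)
      tot : ∀ q → total V q ≡ proj₂ (merge x y) q
      tot q = trans (total-++ (replicate (weight y) x) _ q)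
                (cong₂ _+_ (total-replicate (weight y) x q) (total-replicate (weight x) y q))
      cross : ∀ a b → b * a + a * (ℤ.- b) ≡ 0ℤ
      cross = solve-∀
      balance : proj₂ (merge x y) r ≡ 0ℤ
      balance = trans (cong₂ (λ a b → + weight y * a + + weight x * b) (pos-weight {x} px) (neg-weight {y} ny))
                  (cross (+ weight x) (+ weight y))

    expandAll : ∀ xs W → All (_∈ eliminate xs) W →
      ∃[ V ] (All (_∈ xs) V × (Any marked W → Any marked V) ×
              (∀ q → total V q ≡ total W q) × total V r ≡ 0ℤ)
    expandAll xs [] [] = [] , [] , (λ ()) , (λ q → refl) , refl
    expandAll xs (h ∷ W) (h∈ ∷ W∈) with expand xs h h∈ | expandAll xs W W∈
    ... | V , V∈ , mV , tV , zV | U , U∈ , mU , tU , zU =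
      V ++ U , All.++⁺ V∈ U∈ ,
      (λ { (here m) → Any.++⁺ˡ (mV m) ; (there m) → Any.++⁺ʳ V (mU m) }) ,
      (λ q → trans (total-++ V U q) (cong₂ _+_ (tV q) (tU q))) ,
      trans (total-++ V U r) (cong₂ _+_ zV zU)

    sound : ∀ rows xs → Solution rows (eliminate xs) → Solution (r ∷ rows) xs
    sound rows xs (W , W∈ , m , z) with expandAll xs W W∈
    ... | V , V∈ , mV , tV , zV = V , V∈ , mV m ,
      λ { (here refl) → zV ; (there q∈) → trans (tV _) (z q∈) }

    Wt : List Col → ℕ
    Wt []      = 0
    Wt (c ∷ W) = weight c ℕ.+ Wt W

    total-split : ∀ W q → total W q ≡
      total (filter zero? W) q + (total (filter pos? W) q + total (filter neg? W) q)
    total-split [] q = refl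
    total-split (c ∷ W) q with ℤ.<-cmp (proj₂ c r) 0ℤ | zero? c | pos? c | neg? c | total-split W q
    ... | tri | yes z | yes p | n? | _ = ⊥-elim (ℤ.<⇒≢ p (sym z))
    ... | tri | yes z | no _ | yes n | _ = ⊥-elim (ℤ.<⇒≢ n z)
    ... | tri | yes z | no _ | no _ | ih = trans (cong (ℤ._+_ (proj₂ c q)) ih) (sym (ℤ.+-assoc (proj₂ c q) _ _))
    ... | tri | no _ | yes p | yes n | _ = ⊥-elim (ℤ.<-asym p n)
    ... | tri | no _ | yes p | no _ | ih = trans (cong (ℤ._+_ (proj₂ c q)) ih) (shuffle (proj₂ c q) (total (filter zero? W) q) (total (filter pos? W) q) (total (filter neg? W) q))
      where
      shuffle : ∀ a b c d → a + (b + (c + d)) ≡ b + (a + c + d)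
      shuffle = solve-∀
    ... | tri | no _ | no _ | yes n | ih = trans (cong (ℤ._+_ (proj₂ c q)) ih) (shuffle (proj₂ c q) (total (filter zero? W) q) (total (filter pos? W) q) (total (filter neg? W) q))
      where
      shuffle : ∀ a b c d → a + (b + (c + d)) ≡ b + (c + (a + d))
      shuffle = solve-∀
    ... | tri< a _ _ | no _ | no _ | no ¬n | _ = ⊥-elim (¬n a)
    ... | tri≈ _ b _ | no ¬z | no _ | no _ | _ = ⊥-elim (¬z b)
    ... | tri> _ _ c | no _ | no ¬p | no _ | _ = ⊥-elim (¬p c)

    total-zero : ∀ W → All Zero W → total W r ≡ 0ℤ
    total-zero []      []      = refl
    total-zero (c ∷ W) (z ∷ a) = cong₂ _+_ z (total-zero W a)

    total-pos : ∀ W → All Pos W → total W r ≡ + Wt W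
    total-pos []      []      = refl
    total-pos (c ∷ W) (p ∷ a) = cong₂ _+_ (pos-weight {c} p) (total-pos W a)

    total-neg : ∀ W → All Neg W → total W r ≡ ℤ.- (+ Wt W)
    total-neg []      []      = refl
    total-neg (c ∷ W) (p ∷ a) = trans (cong₂ _+_ (neg-weight {c} p) (total-neg W a))
      (sym (ℤ.neg-distrib-+ (+ weight c) (+ Wt W)))

    total-merge : ∀ x N q → total (map (merge x) N) q ≡
      + Wt N * proj₂ x q + + weight x * total N q
    total-merge x [] q = empty (proj₂ x q) (+ weight x)
      where
      empty : ∀ a b → 0ℤ ≡ 0ℤ * a + b * 0ℤ
      empty = solve-∀
    total-merge x (y ∷ N) q = trans (cong (ℤ._+_ (proj₂ (merge x y) q)) (total-merge x N q))
      (shuffle (+ weight y) (proj₂ x q) (+ weight x) (proj₂ y q) (+ Wt N) (total N q))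
      where
      shuffle : ∀ wy xq wx yq wN tN →
        wy * xq + wx * yq + (wN * xq + wx * tN) ≡ (wy + wN) * xq + wx * (yq + tN)
      shuffle = solve-∀

    total-product : ∀ P N q → total (cartesianProductWith merge P N) q ≡
      + Wt N * total P q + + Wt P * total N q
    total-product [] N q = empty (+ Wt N) (total N q)
      where
      empty : ∀ a b → 0ℤ ≡ a * 0ℤ + 0ℤ * b
      empty = solve-∀
    total-product (x ∷ P) N q =
      trans (total-++ (map (merge x) N) _ q)
        (trans (cong₂ _+_ (total-merge x N q) (total-product P N q))
          (shuffle (+ Wt N) (proj₂ x q) (+ weight x) (total N q) (total P q) (+ Wt P)))
      where
      shuffle : ∀ wN xq wx tN tP wP →
        wN * xq + wx * tN + (wN * tP + wP * tN) ≡ wN * (xq + tP) + (wx + wP) * tN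
      shuffle = solve-∀

    total-copies : ∀ n Z q → total (copies n Z) q ≡ + n * total Z q
    total-copies zero    Z q = sym (ℤ.*-zeroˡ (total Z q))
    total-copies (suc n) Z q = trans (total-++ Z _ q)
      (trans (cong (λ t → total Z q + t) (total-copies n Z q)) (sym (ℤ.suc-* (+ n) (total Z q))))

    weight≤Wt : ∀ {c W} → c ∈ W → weight c ℕ.≤ Wt W
    weight≤Wt (here refl) = ℕ.m≤m+n _ _
    weight≤Wt {W = d ∷ W} (there c∈) = ℕ.≤-trans (weight≤Wt c∈) (ℕ.m≤n+m _ (weight d))

    nonempty : ∀ W → Wt W ≢ 0 → ∃[ c ] c ∈ W
    nonempty []      w = ⊥-elim (w refl)
    nonempty (c ∷ W) w = c , here refl

    -- With p = Σ|x_r| over the positive and n = Σ|y_r| over the negative members of W, the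
    -- hypothesis Σ_W = 0 gives p = n, and Σ_{x,y} (|y_r| x + |x_r| y) = p · (Σ x + Σ y).
    complete : ∀ rows xs → Solution (r ∷ rows) xs → Solution rows (eliminate xs)
    complete rows xs (W , W∈ , m , z) = V , V∈ , mV (find m) , zV
      where
      Z = filter zero? W
      P = filter pos? W
      N = filter neg? W
      C = cartesianProductWith merge P N

      neutral : ∀ a b → a + ℤ.- b ≡ 0ℤ → a ≡ b
      neutral a b e = ℤ.i-j≡0⇒i≡j a b e

      balance : + Wt P ≡ + Wt N
      balance = neutral _ _ (trans (sym (ℤ.+-identityˡ _))
        (trans (sym (cong₂ _+_ (total-zero Z (All.all-filter zero? W))
                 (cong₂ _+_ (total-pos P (All.all-filter pos? W)) (total-neg N (All.all-filter neg? W)))))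
          (trans (sym (total-split W r)) (z (here refl)))))

      PN : Wt P ≡ Wt N
      PN = ℤ.+-injective balance

      -- The pairwise combinations account for the nonzero columns `Wt P` times, so `Z` has to be
      -- repeated as often. If `Wt P` is 0, then `P` and `N` are empty and `Z` alone remains.
      V : List Col
      V with Wt P
      ... | zero  = Z
      ... | suc t = copies (suc t) Z ++ C

      sub : ∀ {Q : Col → Set} (Q? : ∀ c → Dec (Q c)) {c} → c ∈ filter Q? W → c ∈ filter Q? xs
      sub Q? c∈ with ∈-filter⁻ Q? {xs = W} c∈
      ... | c∈W , q = ∈-filter⁺ Q? (All.lookup W∈ c∈W) q

      Z∈ : All (_∈ eliminate xs) Z
      Z∈ = All.tabulate (λ c∈ → ∈-++⁺ˡ (sub zero? c∈))

      C∈ : All (_∈ eliminate xs) C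
      C∈ = All.tabulate λ {h} h∈ → case h∈
        where
        case : ∀ {h} → h ∈ C → h ∈ eliminate xs
        case h∈ with ∈-cartesianProductWith⁻ merge P N h∈
        ... | x , y , x∈ , y∈ , refl =
          ∈-++⁺ʳ (filter zero? xs) (∈-cartesianProductWith⁺ merge (sub pos? x∈) (sub neg? y∈))

      V∈ : All (_∈ eliminate xs) V
      V∈ with Wt P
      ... | zero  = Z∈
      ... | suc t = All.++⁺ (All-copies (suc t) Z∈) C∈

      markC : ∀ {x y} → x ∈ P → y ∈ N → marked x ⊎ marked y → Any marked C
      markC {x} {y} x∈ y∈ mk = lose (∈-cartesianProductWith⁺ merge x∈ y∈) (or mk)
        where
        or : marked x ⊎ marked y → proj₁ x ∨ proj₁ y ≡ true
        or (inj₁ e) = cong (_∨ proj₁ y) e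
        or (inj₂ e) = trans (cong (proj₁ x ∨_) e) (Bool.∨-zeroʳ (proj₁ x))

      mV : (∃[ c ] (c ∈ W × marked c)) → Any marked V
      mV (c , c∈ , mc) with ℤ.<-cmp (proj₂ c r) 0ℤ
      mV (c , c∈ , mc) | tri≈ _ e _ with Wt P
      ... | zero  = lose (∈-filter⁺ zero? c∈ e) mc
      ... | suc t = Any.++⁺ˡ (Any.++⁺ˡ (lose (∈-filter⁺ zero? c∈ e) mc))
      mV (c , c∈ , mc) | tri> _ _ p with Wt P in eP
      ... | zero  = ⊥-elim (weight≢0 {c} (inj₁ p)
                      (ℕ.n≤0⇒n≡0 (subst (weight c ℕ.≤_) eP (weight≤Wt (∈-filter⁺ pos? c∈ p)))))
      ... | suc t with nonempty N (λ e → ℕ.1+n≢0 (trans (sym eP) (trans PN e)))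
      ...   | y , y∈ = Any.++⁺ʳ (copies (suc t) Z) (markC (∈-filter⁺ pos? c∈ p) y∈ (inj₁ mc))
      mV (c , c∈ , mc) | tri< n _ _ with Wt P in eP
      ... | zero  = ⊥-elim (weight≢0 {c} (inj₂ n)
                      (ℕ.n≤0⇒n≡0 (subst (weight c ℕ.≤_) (trans (sym PN) eP) (weight≤Wt (∈-filter⁺ neg? c∈ n)))))
      ... | suc t with nonempty P (λ e → ℕ.1+n≢0 (trans (sym eP) e))
      ...   | x , x∈ = Any.++⁺ʳ (copies (suc t) Z) (markC x∈ (∈-filter⁺ neg? c∈ n) (inj₂ mc))

      empty : ∀ U {Q : Col → Set} → (∀ {c} → Q c → Pos c ⊎ Neg c) → All Q U → Wt U ≡ 0 → ∀ q → total U q ≡ 0ℤ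
      empty []      f a       e q = refl
      empty (c ∷ U) f (x ∷ a) e q = ⊥-elim (weight≢0 {c} (f x) (ℕ.m+n≡0⇒m≡0 (weight c) e))

      zV : ∀ {q} → q ∈ rows → total V q ≡ 0ℤ
      zV {q} q∈ with Wt P in eP
      ... | zero = trans (sym (ℤ.+-identityʳ _)) (trans (cong (λ t → total Z q + t) (sym rest)) (trans (sym (total-split W q)) (z (there q∈))))
        where
        rest : total P q + total N q ≡ 0ℤ
        rest = cong₂ _+_ (empty P inj₁ (All.all-filter pos? W) eP q)
                         (empty N inj₂ (All.all-filter neg? W) (trans (sym PN) eP) q)
      ... | suc t =
        trans (total-++ (copies (suc t) Z) C q)
          (trans (cong₂ _+_ (total-copies (suc t) Z q)
                   (trans (total-product P N q)
                     (cong₂ (λ a b → + a * total P q + + b * total N q) (trans (sym PN) eP) eP)))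
            (trans (factor (+ suc t) (total Z q) (total P q) (total N q))
              (trans (cong (+ suc t *_) (trans (sym (total-split W q)) (z (there q∈)))) (ℤ.*-zeroʳ (+ suc t)))))
        where
        factor : ∀ s a b c → s * a + (s * b + s * c) ≡ s * (a + (b + c))
        factor = solve-∀

  solution? : ∀ rows xs → Dec (Solution rows xs)
  solution? [] xs with Any.any? (λ c → proj₁ c Bool.≟ true) xs
  ... | yes m = let c , c∈ , mc = find m in yes (c ∷ [] , c∈ ∷ [] , here mc , λ ())
  ... | no ¬m = no λ (W , W∈ , m , _) → let c , c∈ , mc = find m in ¬m (lose (All.lookup W∈ c∈) mc)
  solution? (r ∷ rows) xs = map′ (sound rows xs) (complete rows xs) (solution? rows (eliminate xs))
    where open Step r

open IntegerIdentities
open import Data.Nat using (_+_; _*_; _∸_; _^_)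
open import Data.Nat.Tactic.RingSolver using (solve-∀)
open import Algebra.Properties.CommutativeMonoid.Sum ℕ.+-0-commutativeMonoid using (sum; sum-remove; sum-cong-≗; ∑-distrib-+; ∑-comm; sum-replicate-zero)

-- Finite closures and counting

module Closure {X Y : Set} {k : ℕ} (_≟_ : DecidableEquality X) (src tgt : Y → Fin k → X)
               (Base : X → Set) (base? : ∀ x → Dec (Base x)) (rules : List Y) where

  data Derivable : X → Set where
    base : ∀ {x} → Base x → Derivable x
    rule : ∀ {y} → y ∈ rules → (∀ l → Derivable (src y l)) → ∀ l → Derivable (tgt y l)

  private
    Available : List Y → X → Set
    Available U x = Base x ⊎ Any (λ y → ∃[ l ] tgt y l ≡ x) U

    available? : ∀ U x → Dec (Available U x)
    available? U x = base? x ⊎-dec Any.any? (λ y → Fin.any? (λ l → tgt y l ≟ x)) U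

    Closed : List Y → Set
    Closed U = ∀ {y} → y ∈ rules → (∀ l → Available U (src y l)) → ∀ l → Available U (tgt y l)

    -- `n` bounds the length of `rest`, which shrinks with each rule fired. Every rule is in `U` or
    -- in `rest`, so once nothing in `rest` can fire, `U` is closed.
    saturate : ∀ n (U rest : List Y) → length rest ≤ n → (∀ {y} → y ∈ rest → y ∈ rules) →
      (∀ {y} → y ∈ rules → y ∈ U ⊎ y ∈ rest) → (∀ {x} → Available U x → Derivable x) →
      ∃[ V ] (Closed V × (∀ {x} → Available V x → Derivable x))
    saturate n U rest len≤ sub cover sound
      with Any.any? (λ y → Fin.all? (λ l → available? U (src y l))) rest
    ... | no stuck = U , closed , sound
      where
      closed : Closed U
      closed y∈ av l with cover y∈
      ... | inj₁ y∈U = inj₂ (lose y∈U (l , refl))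
      ... | inj₂ y∈rest = ⊥-elim (stuck (lose y∈rest av))
    ... | yes fire with find fire
    ...   | y , y∈ , av with ∈-∃++ y∈
    saturate zero U .(ys ++ y ∷ zs) len≤ sub cover sound | yes fire | y , y∈ , av | ys , zs , refl
      with trans (sym (List.length-++ ys {y ∷ zs})) (ℕ.n≤0⇒n≡0 len≤)
    ... | e = ⊥-elim (ℕ.1+n≢0 (ℕ.m+n≡0⇒n≡0 (length ys) e))
    saturate (suc n) U .(ys ++ y ∷ zs) len≤ sub cover sound | yes fire | y , y∈ , av | ys , zs , refl =
      saturate n (y ∷ U) (ys ++ zs) len≤′ sub′ cover′ sound′
      where
      len≤′ : length (ys ++ zs) ≤ n
      len≤′ = ℕ.≤-pred (subst (_≤ suc n)
        (trans (List.length-++ ys {y ∷ zs})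
          (trans (ℕ.+-suc (length ys) (length zs)) (cong suc (sym (List.length-++ ys {zs}))))) len≤)
      sub′ : ∀ {z} → z ∈ ys ++ zs → z ∈ rules
      sub′ z∈ with ∈-++⁻ ys z∈
      ... | inj₁ p = sub (∈-++⁺ˡ p)
      ... | inj₂ p = sub (∈-++⁺ʳ ys (there p))
      cover′ : ∀ {z} → z ∈ rules → z ∈ y ∷ U ⊎ z ∈ ys ++ zs
      cover′ z∈ with cover z∈
      ... | inj₁ p = inj₁ (there p)
      ... | inj₂ p with ∈-++⁻ ys p
      ...   | inj₁ q = inj₂ (∈-++⁺ˡ q)
      ...   | inj₂ (here refl) = inj₁ (here refl)
      ...   | inj₂ (there q) = inj₂ (∈-++⁺ʳ ys q)
      sound′ : ∀ {x} → Available (y ∷ U) x → Derivable x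
      sound′ (inj₁ b) = base b
      sound′ (inj₂ (here (l , refl))) = rule (sub y∈) (λ l′ → sound (av l′)) l
      sound′ (inj₂ (there p)) = sound (inj₂ p)

  derivable? : ∀ x → Dec (Derivable x)
  derivable? x
    with saturate (length rules) [] rules ℕ.≤-refl (λ y∈ → y∈) inj₂ (λ { (inj₁ b) → base b ; (inj₂ ()) })
  ... | V , closed , sound = map′ sound complete (available? V x)
    where
    complete : ∀ {x} → Derivable x → Available V x
    complete (base b) = inj₁ b
    complete (rule y∈ ds l) = closed y∈ (λ l′ → complete (ds l′)) l

sumL : {Y : Set} → (Y → ℕ) → List Y → ℕ
sumL f []      = 0
sumL f (y ∷ W) = f y + sumL f W

sumL-++ : {Y : Set} (f : Y → ℕ) (V W : List Y) → sumL f (V ++ W) ≡ sumL f V + sumL f W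
sumL-++ f []      W = refl
sumL-++ f (y ∷ V) W = trans (cong (f y +_) (sumL-++ f V W)) (sym (ℕ.+-assoc (f y) _ _))

sumL-↭ : {Y : Set} (f : Y → ℕ) {V W : List Y} → V ↭ W → sumL f V ≡ sumL f W
sumL-↭ f Perm.refl         = refl
sumL-↭ f (Perm.prep x p)   = cong (f x +_) (sumL-↭ f p)
sumL-↭ f (Perm.swap x y p) = trans (cong (λ s → f x + (f y + s)) (sumL-↭ f p)) (lemma (f x) (f y) _)
  where
  lemma : ∀ a b c → a + (b + c) ≡ b + (a + c)
  lemma = solve-∀
sumL-↭ f (Perm.trans p q)  = trans (sumL-↭ f p) (sumL-↭ f q)

sumL-map : {X Y : Set} (f : Y → ℕ) (g : X → Y) (W : List X) → sumL f (map g W) ≡ sumL (f ∘ g) W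
sumL-map f g []      = refl
sumL-map f g (x ∷ W) = cong (f (g x) +_) (sumL-map f g W)

sumL-cong : {Y : Set} {f g : Y → ℕ} (W : List Y) → (∀ {y} → y ∈ W → f y ≡ g y) → sumL f W ≡ sumL g W
sumL-cong []      e = refl
sumL-cong (y ∷ W) e = cong₂ _+_ (e (here refl)) (sumL-cong W (e ∘ there))

∈⇒≤sumL : {Y : Set} (f : Y → ℕ) {y : Y} {W : List Y} → y ∈ W → f y ≤ sumL f W
∈⇒≤sumL f (here refl) = ℕ.m≤m+n _ _
∈⇒≤sumL f {W = z ∷ W} (there p) = ℕ.≤-trans (∈⇒≤sumL f p) (ℕ.m≤n+m _ (f z))

sumL≡0 : {Y : Set} (f : Y → ℕ) (W : List Y) → (∀ {y} → y ∈ W → f y ≡ 0) → sumL f W ≡ 0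
sumL≡0 f []      e = refl
sumL≡0 f (y ∷ W) e = cong₂ _+_ (e (here refl)) (sumL≡0 f W (e ∘ there))

≤sum : ∀ {n} (f : Fin n → ℕ) i → f i ≤ sum f
≤sum f zero    = ℕ.m≤m+n _ _
≤sum f (suc i) = ℕ.≤-trans (≤sum (f ∘ suc) i) (ℕ.m≤n+m _ (f zero))

sum>0 : ∀ {n} (f : Fin n → ℕ) → 0 < sum f → ∃[ i ] 0 < f i
sum>0 {suc n} f p with f zero in e
... | suc _ = zero , subst (0 <_) (sym e) (s≤s z≤n)
... | zero with sum>0 (f ∘ suc) p
...   | i , q = suc i , q

sum≡0 : ∀ {n} (f : Fin n → ℕ) → (∀ i → f i ≡ 0) → sum f ≡ 0
sum≡0 {n} f e = trans (sum-cong-≗ e) (sum-replicate-zero n)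

Injective : {A B : Set} → (A → B) → Set
Injective f = ∀ x y → f x ≡ f y → x ≡ y

private
  ε : ∀ {n} → Fin n → Fin n → ℕ
  ε i j = if does (i Fin.≟ j) then 1 else 0

  ε-refl : ∀ {n} (i : Fin n) → ε i i ≡ 1
  ε-refl i with i Fin.≟ i
  ... | yes _ = refl
  ... | no ¬p = ⊥-elim (¬p refl)

  ε-≢ : ∀ {n} {i j : Fin n} → i ≢ j → ε i j ≡ 0
  ε-≢ {i = i} {j} ne with i Fin.≟ j
  ... | yes p = ⊥-elim (ne p)
  ... | no _ = refl

  ε-inj : ∀ {m n} {ι : Fin m → Fin n} → Injective ι → ∀ i j → ε (ι i) (ι j) ≡ ε i j
  ε-inj {ι = ι} inj i j with i Fin.≟ j
  ... | yes refl = ε-refl (ι i)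
  ... | no ne = ε-≢ (λ e → ne (inj i j e))

  pick : ∀ {n} (F : Fin n → ℕ) i → sum (λ j → ε j i * F j) ≡ F i
  pick F zero = trans (cong₂ _+_ (ℕ.*-identityˡ (F zero)) (sum≡0 (λ j → ε (suc j) zero * F (suc j)) (λ _ → refl))) (ℕ.+-identityʳ (F zero))
  pick F (suc i) = trans (sum-cong-≗ (λ j → cong (_* F (suc j)) (ε-inj (λ _ _ → Fin.suc-injective) j i))) (pick (F ∘ suc) i)

  ε-sym : ∀ {n} (i j : Fin n) → ε i j ≡ ε j i
  ε-sym i j with i Fin.≟ j
  ... | yes refl = sym (ε-refl i)
  ... | no ne = sym (ε-≢ (ne ∘ sym))

  hits : ∀ {m n} (ι : Fin m → Fin n) (F : Fin n → ℕ) → sum (λ i → sum (λ j → ε (ι j) i * F i)) ≡ sum (F ∘ ι)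
  hits ι F = trans (∑-comm (λ i j → ε (ι j) i * F i))
    (sum-cong-≗ (λ j → trans (sum-cong-≗ (λ i → cong (_* F i) (ε-sym (ι j) i))) (pick F (ι j))))

-- A position outside the image of `ι` contributes the same to `F` and `G`; one in the image is hit
-- exactly once and contributes both values to both sides. This is the balance, free of subtraction,
-- of a step in which only the processes in the image move.
sum-exchange : ∀ {m n} {ι : Fin m → Fin n} → Injective ι → (F G : Fin n → ℕ) →
  (∀ i → (∀ j → ι j ≢ i) → G i ≡ F i) → sum G + sum (F ∘ ι) ≡ sum F + sum (G ∘ ι)
sum-exchange {ι = ι} inj F G agree = begin
  sum G + sum (F ∘ ι)                              ≡⟨ cong (sum G +_) (hits ι F) ⟨
  sum G + sum (λ i → sum (λ j → ε (ι j) i * F i))  ≡⟨ ∑-distrib-+ G _ ⟨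
  sum (λ i → G i + sum (λ j → ε (ι j) i * F i))    ≡⟨ sum-cong-≗ pointwise ⟩
  sum (λ i → F i + sum (λ j → ε (ι j) i * G i))    ≡⟨ ∑-distrib-+ F _ ⟩
  sum F + sum (λ i → sum (λ j → ε (ι j) i * G i))  ≡⟨ cong (sum F +_) (hits ι G) ⟩
  sum F + sum (G ∘ ι)                              ∎
  where
  open ≡-Reasoning
  once : ∀ j₀ c → sum (λ j → ε (ι j) (ι j₀) * c) ≡ c
  once j₀ c = trans (sum-cong-≗ (λ j → cong (_* c) (ε-inj inj j j₀))) (pick (λ _ → c) j₀)
  pointwise : ∀ i → G i + sum (λ j → ε (ι j) i * F i) ≡ F i + sum (λ j → ε (ι j) i * G i)
  pointwise i with Fin.any? (λ j → ι j Fin.≟ i)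
  ... | yes (j₀ , refl) = trans (cong (G i +_) (once j₀ (F i)))
        (trans (ℕ.+-comm (G i) (F i)) (cong (F i +_) (sym (once j₀ (G i)))))
  ... | no none = cong₂ _+_ (agree i (λ j e → none (j , e)))
        (trans (sum≡0 _ (λ j → cong (_* F i) (ε-≢ (λ e → none (j , e)))))
          (sym (sum≡0 _ (λ j → cong (_* G i) (ε-≢ (λ e → none (j , e)))))))

sum-inj≤ : ∀ {m n} {ι : Fin m → Fin n} → Injective ι → (F : Fin n → ℕ) → sum (F ∘ ι) ≤ sum F
sum-inj≤ {m} {n} {ι} inj F = begin
  sum (F ∘ ι)          ≤⟨ ℕ.m≤n+m _ (sum G) ⟩
  sum G + sum (F ∘ ι)  ≡⟨ sum-exchange inj F G agree ⟩
  sum F + sum (G ∘ ι)  ≡⟨ cong (sum F +_) (sum≡0 (G ∘ ι) hit) ⟩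
  sum F + 0            ≡⟨ ℕ.+-identityʳ (sum F) ⟩
  sum F                ∎
  where
  open ℕ.≤-Reasoning
  -- With `F` erased on the image of `ι`, the exchange identity splits `sum F` into `sum (F ∘ ι)`
  -- and the rest.
  G : Fin n → ℕ
  G i = if does (Fin.any? (λ j → ι j Fin.≟ i)) then 0 else F i
  hit : ∀ j → G (ι j) ≡ 0
  hit j with Fin.any? (λ j′ → ι j′ Fin.≟ ι j)
  ... | yes _ = refl
  ... | no ne = ⊥-elim (ne (j , refl))
  agree : ∀ i → (∀ j → ι j ≢ i) → G i ≡ F i
  agree i ne with Fin.any? (λ j → ι j Fin.≟ i)
  ... | yes (j , e) = ⊥-elim (ne j e)
  ... | no _ = refl

module Counting {X : Set} (_≟_ : DecidableEquality X) where

  δ : X → X → ℕ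
  δ x y = if does (x ≟ y) then 1 else 0

  δ-refl : ∀ x → δ x x ≡ 1
  δ-refl x with x ≟ x
  ... | yes _ = refl
  ... | no ne = ⊥-elim (ne refl)

  δ-≢ : ∀ {x y} → x ≢ y → δ x y ≡ 0
  δ-≢ {x} {y} ne with x ≟ y
  ... | yes e = ⊥-elim (ne e)
  ... | no _ = refl

  δ>0 : ∀ {x y} → 0 < δ x y → x ≡ y
  δ>0 {x} {y} p with x ≟ y
  ... | yes e = e
  δ>0 () | no _

  δ≤ : ∀ {x} {c : X → ℕ} → 0 < c x → ∀ y → δ x y ≤ c y
  δ≤ {x} p y with x ≟ y
  ... | yes refl = p
  ... | no _ = z≤n

  # : ∀ {n} → (Fin n → X) → X → ℕ
  # f x = sum (λ i → δ (f i) x)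

  #-cong : ∀ {n} {f g : Fin n → X} → f ≗ g → # f ≗ # g
  #-cong e x = sum-cong-≗ (λ i → cong (λ y → δ y x) (e i))

  #>0 : ∀ {n} (f : Fin n → X) {x} → 0 < # f x → ∃[ i ] f i ≡ x
  #>0 f p with sum>0 _ p
  ... | i , q = i , δ>0 q

  0<# : ∀ {n} (f : Fin n → X) i → 0 < # f (f i)
  0<# f i = ℕ.≤-trans (ℕ.≤-reflexive (sym (δ-refl (f i)))) (≤sum (λ j → δ (f j) (f i)) i)

  #-exchange : ∀ {m n} {ι : Fin m → Fin n} → Injective ι → (f g : Fin n → X) →
    (∀ i → (∀ j → ι j ≢ i) → g i ≡ f i) → ∀ x → # g x + # (f ∘ ι) x ≡ # f x + # (g ∘ ι) x
  #-exchange inj f g agree x =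
    sum-exchange inj (λ i → δ (f i) x) (λ i → δ (g i) x) (λ i ne → cong (λ y → δ y x) (agree i ne))

  #-inj≤ : ∀ {m n} {ι : Fin m → Fin n} → Injective ι → (f : Fin n → X) → ∀ x → # (f ∘ ι) x ≤ # f x
  #-inj≤ inj f x = sum-inj≤ inj (λ i → δ (f i) x)

  -- A greedy matching: the first demand takes any position with its value, and deleting that
  -- position lowers supply and demand of the value by one each, so the inequality survives.
  #⇒injection : ∀ {m n} (d : Fin m → X) (f : Fin n → X) → (∀ x → # d x ≤ # f x) →
    ∃[ ι ] (Injective ι × (∀ j → f (ι j) ≡ d j))
  #⇒injection {zero} d f le = (λ ()) , (λ ()) , (λ ())
  #⇒injection {suc m} {n} d f le with #>0 f (ℕ.≤-trans (0<# d zero) (le (d zero)))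
  #⇒injection {suc m} {suc n} d f le | i₀ , e₀ = ι , inj , eq
    where
    f′ : Fin n → X
    f′ = f ∘ punchIn i₀
    le′ : ∀ x → # (d ∘ suc) x ≤ # f′ x
    le′ x = ℕ.+-cancelˡ-≤ (δ (d zero) x) _ _
      (ℕ.≤-trans (le x) (ℕ.≤-reflexive (trans (sum-remove {i = i₀} (λ i → δ (f i) x))
        (cong (λ y → δ y x + # f′ x) e₀))))
    rec = #⇒injection (d ∘ suc) f′ le′
    ι : Fin (suc m) → Fin (suc n)
    ι zero    = i₀
    ι (suc j) = punchIn i₀ (proj₁ rec j)
    inj : Injective ι
    inj zero    zero    e = refl
    inj zero    (suc j) e = ⊥-elim (Fin.punchInᵢ≢i i₀ _ (sym e))
    inj (suc i) zero    e = ⊥-elim (Fin.punchInᵢ≢i i₀ _ e)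
    inj (suc i) (suc j) e = cong suc (proj₁ (proj₂ rec) i j (Fin.punchIn-injective i₀ _ _ e))
    eq : ∀ j → f (ι j) ≡ d j
    eq zero    = e₀
    eq (suc j) = proj₂ (proj₂ rec) j

  count : List X → X → ℕ
  count d x = sumL (λ y → δ y x) d

  #-lookup : ∀ {Y : Set} (h : Y → X) (d : List Y) x → # (h ∘ lookup d) x ≡ sumL (λ y → δ (h y) x) d
  #-lookup h []      x = refl
  #-lookup h (y ∷ d) x = cong (δ (h y) x +_) (#-lookup h d x)

-- Rendezvous nets

sumL-copies : {Y : Set} (f : Y → ℕ) (n : ℕ) (W : List Y) → sumL f (copies n W) ≡ n * sumL f W
sumL-copies f zero    W = refl
sumL-copies f (suc n) W = trans (sumL-++ f W _) (cong (sumL f W +_) (sumL-copies f n W))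

-- Each entry of `κ` is taken from a copy of `W` of its own.
extract : {Y : Set} {W : List Y} (κ : List Y) → All (_∈ W) κ →
  ∃[ rest ] (copies (length κ) W ↭ κ ++ rest × All (_∈ W) rest)
extract [] [] = [] , ↭-refl , []
extract {W = W} (t ∷ κ) (t∈ ∷ κ∈) with ∈-∃++ t∈ | extract κ κ∈
... | ys , zs , e | rest , p , r∈ = (ys ++ zs) ++ rest , perm , All.++⁺ sub r∈
  where
  sub : All (_∈ W) (ys ++ zs)
  sub = All.tabulate λ {y} y∈ → subst (y ∈_) (sym e) (Perm.∈-resp-↭ (↭-sym (Perm.shift t ys zs)) (there y∈))
  perm : W ++ copies (length κ) W ↭ t ∷ κ ++ (ys ++ zs) ++ rest
  perm = ↭-trans (Perm.++⁺ (↭-trans (↭-reflexive e) (Perm.shift t ys zs)) p)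
    (↭-prep t (↭-trans (↭-sym (Perm.++-assoc (ys ++ zs) κ rest))
      (↭-trans (Perm.++⁺ʳ rest (Perm.++-comm (ys ++ zs) κ))
        (Perm.++-assoc κ (ys ++ zs) rest))))

module Net {Pl Tr : Set} (_≟_ : DecidableEquality Pl) {k : ℕ} (src tgt : Tr → Fin k → Pl) where

  open Counting _≟_ public

  Vector : Set
  Vector = Pl → ℕ

  infix 4 _≤̇_
  _≤̇_ : Vector → Vector → Set
  u ≤̇ v = ∀ p → u p ≤ v p

  infixl 6 _⊕_
  _⊕_ : Vector → Vector → Vector
  (u ⊕ v) p = u p + v p

  infixl 7 _∙_
  _∙_ : ℕ → Vector → Vector
  (n ∙ u) p = n * u p

  pre post : Tr → Vector
  pre t  = # (src t)
  post t = # (tgt t)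

  preL postL : List Tr → Vector
  preL κ p  = sumL (λ t → pre t p) κ
  postL κ p = sumL (λ t → post t p) κ

  data Fires : Vector → List Tr → Vector → Set where
    done : ∀ {u v} → u ≗ v → Fires u [] v
    fire : ∀ {t κ u u′ v} → pre t ≤̇ u → (∀ p → u′ p + pre t p ≡ u p + post t p) →
           Fires u′ κ v → Fires u (t ∷ κ) v

  Fires-respˡ : ∀ {u u′ κ v} → u ≗ u′ → Fires u κ v → Fires u′ κ v
  Fires-respˡ e (done f)       = done (λ p → trans (sym (e p)) (f p))
  Fires-respˡ e (fire le eq r) = fire (λ p → ℕ.≤-trans (le p) (ℕ.≤-reflexive (e p)))
                                (λ p → trans (eq p) (cong (_+ _) (e p))) r

  Fires-respʳ : ∀ {u κ v v′} → v ≗ v′ → Fires u κ v → Fires u κ v′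
  Fires-respʳ e (done f)       = done (λ p → trans (f p) (e p))
  Fires-respʳ e (fire le eq r) = fire le eq (Fires-respʳ e r)

  Fires-++ : ∀ {u κ v κ′ w} → Fires u κ v → Fires v κ′ w → Fires u (κ ++ κ′) w
  Fires-++ (done e)       s = Fires-respˡ (λ p → sym (e p)) s
  Fires-++ (fire le eq r) s = fire le eq (Fires-++ r s)

  private
    swapʳ : ∀ a b c → (a + b) + c ≡ (a + c) + b
    swapʳ = solve-∀

  frame : ∀ {u κ v} z → Fires u κ v → Fires (u ⊕ z) κ (v ⊕ z)
  frame z (done e) = done (λ p → cong (_+ z p) (e p))
  frame z (fire {t} {u = u} {u′} le eq r) = fire (λ p → ℕ.≤-trans (le p) (ℕ.m≤m+n _ (z p)))
    (λ p → trans (swapʳ (u′ p) (z p) (pre t p)) (trans (cong (_+ z p) (eq p)) (swapʳ (u p) (post t p) (z p))))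
    (frame z r)

  frameˡ : ∀ {u κ v} z → Fires u κ v → Fires (z ⊕ u) κ (z ⊕ v)
  frameˡ {u} {κ} {v} z r =
    Fires-respˡ (λ p → ℕ.+-comm (u p) (z p)) (Fires-respʳ (λ p → ℕ.+-comm (v p) (z p)) (frame z r))

  -- The state equation of Petri net theory, with the subtracted terms moved to the other side.
  state : ∀ {u κ v} → Fires u κ v → ∀ p → v p + preL κ p ≡ u p + postL κ p
  state (done e) p = cong (_+ 0) (sym (e p))
  state (fire {t} {κ} {u} {u′} {v} le eq r) p = ℕ.+-cancelˡ-≡ (u′ p) _ _
    (trans (lemma₁ (u′ p) (v p) (pre t p) (preL κ p))
      (trans (cong₂ _+_ (eq p) (state r p)) (lemma₂ (u p) (post t p) (u′ p) (postL κ p))))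
    where
    lemma₁ : ∀ u′ v a b → u′ + (v + (a + b)) ≡ (u′ + a) + (v + b)
    lemma₁ = solve-∀
    lemma₂ : ∀ u a u′ b → (u + a) + (u′ + b) ≡ u′ + (u + (a + b))
    lemma₂ = solve-∀

  -- Each firing consumes at most `D`, so a reserve of `D` per transition lasts to the end whatever
  -- the order; the result is then determined by the state equation.
  enabled : ∀ {D} κ u v → All (λ t → pre t ≤̇ D) κ → (∀ p → length κ * D p ≤ u p) →
    (∀ p → v p + preL κ p ≡ u p + postL κ p) → Fires u κ v
  enabled [] u v [] le eq = done (λ p → sym (ℕ.+-cancelʳ-≡ 0 _ _ (eq p)))
  enabled {D} (t ∷ κ) u v (d ∷ ds) le eq = fire pre≤u step (enabled κ u′ v ds le′ eq′)
    where
    u′ : Vector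
    u′ p = (u p ∸ pre t p) + post t p
    pre≤u : pre t ≤̇ u
    pre≤u p = ℕ.≤-trans (d p) (ℕ.≤-trans (ℕ.m≤m+n _ _) (le p))
    step : ∀ p → u′ p + pre t p ≡ u p + post t p
    step p = trans (swapʳ (u p ∸ pre t p) (post t p) (pre t p)) (cong (_+ post t p) (ℕ.m∸n+n≡m (pre≤u p)))
    le′ : ∀ p → length κ * D p ≤ u′ p
    le′ p = ℕ.≤-trans (ℕ.m+n≤o⇒m≤o∸n _ (ℕ.≤-trans (ℕ.≤-trans
      (ℕ.+-monoʳ-≤ (length κ * D p) (d p)) (ℕ.≤-reflexive (ℕ.+-comm _ (D p)))) (le p))) (ℕ.m≤m+n _ (post t p))
    eq′ : ∀ p → v p + preL κ p ≡ u′ p + postL κ p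
    eq′ p = ℕ.+-cancelʳ-≡ (pre t p) _ _ (trans (lemma₁ (v p) (preL κ p) (pre t p))
      (trans (eq p) (trans (sym (ℕ.+-assoc (u p) _ _)) (trans (cong (_+ postL κ p) (sym (step p)))
        (swapʳ (u′ p) (pre t p) (postL κ p))))))
      where
      lemma₁ : ∀ v b a → (v + b) + a ≡ v + (a + b)
      lemma₁ = solve-∀

  times : ∀ {u κ v} J → Fires u κ v → Fires (J ∙ u) (copies J κ) (J ∙ v)
  times zero    r = done (λ p → refl)
  times {u} {κ} {v} (suc J) r = Fires-++ (frame (J ∙ u) r) (frameˡ v (times J r))

  -- `a` copies of the vector are at `y` and `b` already at `y′`; one execution of `c` moves one of
  -- them over. As every copy contains `D`, there are always `a + b` times `D` available, enough to
  -- fire `c` in any order.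
  interpolate : ∀ {D y y′} c → All (λ t → pre t ≤̇ D) c → D ≤̇ y → D ≤̇ y′ →
    (∀ p → y′ p + preL c p ≡ y p + postL c p) →
    ∀ a b → length c ≤ a + b → Fires (a ∙ y ⊕ b ∙ y′) (copies a c) ((a + b) ∙ y′)
  interpolate c ds le le′ eq zero b len = done (λ p → refl)
  interpolate {D} {y} {y′} c ds le le′ eq (suc a) b len = Fires-++
    (enabled c _ (a ∙ y ⊕ suc b ∙ y′) ds enough balance)
    (Fires-respʳ (λ p → cong (_* y′ p) (ℕ.+-suc a b))
      (interpolate c ds le le′ eq a (suc b) (ℕ.≤-trans len (ℕ.≤-reflexive (sym (ℕ.+-suc a b))))))
    where
    enough : ∀ p → length c * D p ≤ suc a * y p + b * y′ p
    enough p = ℕ.≤-trans (ℕ.*-monoˡ-≤ (D p) len)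
      (ℕ.≤-trans (ℕ.≤-reflexive (ℕ.*-distribʳ-+ (D p) (suc a) b))
        (ℕ.+-mono-≤ (ℕ.*-monoʳ-≤ (suc a) (le p)) (ℕ.*-monoʳ-≤ b (le′ p))))
    balance : ∀ p → (a ∙ y ⊕ suc b ∙ y′) p + preL c p ≡ (suc a ∙ y ⊕ b ∙ y′) p + postL c p
    balance p = trans (lemma₁ (a * y p) (y′ p) (b * y′ p) (preL c p))
      (trans (cong (_+ (a * y p + b * y′ p)) (eq p)) (lemma₂ (a * y p) (y p) (b * y′ p) (postL c p)))
      where
      lemma₁ : ∀ a y′ b c → (a + (y′ + b)) + c ≡ (y′ + c) + (a + b)
      lemma₁ = solve-∀
      lemma₂ : ∀ a y b c → (y + c) + (a + b) ≡ ((y + a) + b) + c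
      lemma₂ = solve-∀

  module Kick (𝓤 : Vector → Set) (inhabited : ∃ 𝓤)
              (𝓤-⊕ : ∀ {u v} → 𝓤 u → 𝓤 v → 𝓤 (u ⊕ v)) (rules : List Tr) where

    -- As `𝓤` is closed under sums, demands can be met by separate runs side by side. This reduces
    -- covering a vector to covering single states, which then follows the rules of a closure.
    Coverable : Vector → Set
    Coverable d = ∃[ u ] ∃[ κ ] ∃[ v ] (𝓤 u × Fires u κ v × d ≤̇ v × All (_∈ rules) κ)

    coverable-≤ : ∀ {d d′} → d′ ≤̇ d → Coverable d → Coverable d′
    coverable-≤ le (u , κ , v , 𝓊 , r , d≤ , κ∈) = u , κ , v , 𝓊 , r , (λ p → ℕ.≤-trans (le p) (d≤ p)) , κ∈

    coverable-0 : Coverable (λ _ → 0)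
    coverable-0 = proj₁ inhabited , [] , proj₁ inhabited , proj₂ inhabited , done (λ _ → refl) , (λ _ → z≤n) , []

    coverable-⊕ : ∀ {d d′} → Coverable d → Coverable d′ → Coverable (d ⊕ d′)
    coverable-⊕ (u , κ , v , 𝓊 , r , d≤ , κ∈) (u′ , κ′ , v′ , 𝓊′ , r′ , d′≤ , κ′∈) =
      u ⊕ u′ , κ ++ κ′ , v ⊕ v′ , 𝓤-⊕ 𝓊 𝓊′ , Fires-++ (frame u′ r) (frameˡ v r′) ,
      (λ p → ℕ.+-mono-≤ (d≤ p) (d′≤ p)) , All.++⁺ κ∈ κ′∈

    coverable-fire : ∀ {t} → t ∈ rules → Coverable (pre t) → Coverable (post t)
    coverable-fire {t} t∈ (u , κ , v , 𝓊 , r , d≤ , κ∈) =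
      u , κ ++ [ t ] , (λ p → (v p ∸ pre t p) + post t p) , 𝓊 ,
      Fires-++ r (fire d≤ (λ p → trans (swapʳ (v p ∸ pre t p) (post t p) (pre t p))
                                   (cong (_+ post t p) (ℕ.m∸n+n≡m (d≤ p)))) (done (λ _ → refl))) ,
      (λ p → ℕ.m≤n+m _ (v p ∸ pre t p)) , All.++⁺ κ∈ (t∈ ∷ [])

    coverable-# : ∀ {n} (f : Fin n → Pl) → (∀ i → Coverable (δ (f i))) → Coverable (# f)
    coverable-# {zero}  f c = coverable-0
    coverable-# {suc n} f c = coverable-⊕ (c zero) (coverable-# (f ∘ suc) (c ∘ suc))

    coverable-sumL : ∀ {Y : Set} (F : Y → Vector) W → (∀ {y} → y ∈ W → Coverable (F y)) →
      Coverable (λ p → sumL (λ y → F y p) W)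
    coverable-sumL F []      c = coverable-0
    coverable-sumL F (y ∷ W) c = coverable-⊕ (c (here refl)) (coverable-sumL F W (c ∘ there))

    coverable-rule : ∀ {t} → t ∈ rules → (∀ l → Coverable (δ (src t l))) → ∀ l → Coverable (δ (tgt t l))
    coverable-rule {t} t∈ c l =
      coverable-≤ (δ≤ {c = post t} (0<# (tgt t) l)) (coverable-fire t∈ (coverable-# (src t) c))

    module _ (Base : Pl → Set) (base? : ∀ x → Dec (Base x))
             (cover-base : ∀ {p} → Base p → Coverable (δ p)) where
      open Closure _≟_ src tgt Base base? rules

      coverable-derivable : ∀ {p} → Derivable p → Coverable (δ p)
      coverable-derivable (base b)        = cover-base b
      coverable-derivable (rule t∈ ds l) = coverable-rule t∈ (λ l′ → coverable-derivable (ds l′)) l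

module _ {Pl Tr : Set} (_≟_ : DecidableEquality Pl) {k : ℕ} (src tgt : Tr → Fin k → Pl) where
  private
    module N = Net _≟_ src tgt
    module Nʳ = Net _≟_ tgt src

  -- A run that must end in prescribed states is found by covering in the net with reversed arrows
  -- and reading the run from its end.
  Fires-reverse : ∀ {u κ v} → Nʳ.Fires u κ v → N.Fires v (reverse κ) u
  Fires-reverse (Nʳ.done e) = N.done (λ p → sym (e p))
  Fires-reverse (Nʳ.fire {t} {κ} {u} {u′} {v} le eq r) =
    subst (λ ρ → N.Fires v ρ u) (sym (List.unfold-reverse t κ))
      (N.Fires-++ (Fires-reverse r) (N.fire le′ (λ p → sym (eq p)) (N.done (λ _ → refl))))
    where
    le′ : ∀ p → N.pre t p ≤ u′ p
    le′ p = ℕ.+-cancelʳ-≤ (N.post t p) _ _ (ℕ.≤-trans (ℕ.≤-reflexive (ℕ.+-comm (N.pre t p) _))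
      (ℕ.≤-trans (ℕ.+-monoˡ-≤ (N.pre t p) (le p)) (ℕ.≤-reflexive (sym (eq p)))))

module Continuous {Pl Tr : Set} (_≟_ : DecidableEquality Pl) {k : ℕ} (src tgt : Tr → Fin k → Pl) where
  open Net _≟_ src tgt

  -- A multiple of X fires to a multiple of Y as soon as the state equation is solvable by a W all of
  -- whose transitions can be enabled forwards from X and backwards from Y (as for continuous Petri
  -- nets): after the two kick-offs everything is populated, and the remainder c of a multiple of W is
  -- fired along the segment from y₀ to y₀′, on so many copies that its internal order is irrelevant.
  realise : ∀ {X Y} W → (∀ p → X p + postL W p ≡ Y p + preL W p) →
    (∃[ K ] ∃[ κ ] ∃[ y ] (Fires (K ∙ X) κ y × preL W ≤̇ y × All (_∈ W) κ)) →
    (∃[ K ] ∃[ κ ] ∃[ y ] (Fires y κ (K ∙ Y) × preL W ≤̇ y × All (_∈ W) κ)) →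
    ∀ j → ∃[ G ] ∃[ κ ] ∃[ Z ] ∃[ κ′ ] (0 < G × Fires (G ∙ X) κ Z × Fires Z κ′ (G ∙ Y) ×
      j ∙ preL W ≤̇ Z × All (_∈ W) κ × All (_∈ W) κ′ × (∀ {t} → t ∈ W → t ∈ κ′))
  realise {X} {Y} W eq (K₁ , κ₁ , y₁ , r₁ , D≤₁ , κ₁∈) (K₂ , κ₂ , y₂ , r₂ , D≤₂ , κ₂∈) j
    with extract (κ₁ ++ κ₂) (All.++⁺ κ₁∈ κ₂∈)
  ... | rest , perm , rest∈ =
    J * K , copies J κ₁ , J ∙ y₀ , copies J c ++ copies J κ₂ , 0<JK ,
    Fires-respˡ (λ p → sym (ℕ.*-assoc J K (X p))) (times J (Fires-respˡ (split X K₁ R₁) (frame (R₁ ∙ X) r₁))) ,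
    Fires-++
      (Fires-respˡ (λ p → ℕ.+-identityʳ _) (Fires-respʳ (λ p → cong (_* (y₂ ⊕ R₂ ∙ Y) p) (ℕ.+-identityʳ J))
        (interpolate c ds D≤y₀ D≤y₁ balance J 0 len)))
      (Fires-respʳ (λ p → sym (ℕ.*-assoc J K (Y p)))
        (times J (Fires-respʳ (λ p → trans (split Y K₂ R₂ p) (cong (_* Y p) K≡)) (frame (R₂ ∙ Y) r₂)))) ,
    (λ p → ℕ.*-mono-≤ (ℕ.m≤n+m j (suc (length c))) (D≤y₀ p)) ,
    All-copies J κ₁∈ , All.++⁺ (All-copies J c∈) (All-copies J κ₂∈) ,
    λ t∈ → ∈-++⁺ˡ (∈-++⁺ˡ (∈-++⁺ʳ rest (∈-++⁺ˡ t∈)))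
    where
    -- Both ends must be the same multiple `K`, and `κ₁`, `κ₂`, `c` together must make up `K` copies
    -- of `W`. Extracting `κ₁ ++ κ₂` uses `L` copies, `K₁ + K₂` more pad to a common multiple, and
    -- one more makes each member of `W` occur in `c`.
    L = length (κ₁ ++ κ₂)
    R₁ = K₂ + suc L
    R₂ = K₁ + suc L
    K = K₁ + R₁
    K≡ : K₂ + R₂ ≡ K
    K≡ = lemma K₁ K₂ (suc L)
      where
      lemma : ∀ a b c → b + (a + c) ≡ a + (b + c)
      lemma = solve-∀
    c = rest ++ W ++ copies (K₁ + K₂) W
    -- `length c` copies make the interpolation possible, `j` more provide the reserve at the
    -- midpoint, and the successor keeps the multiple positive.
    J = suc (length c) + j
    y₀ = y₁ ⊕ R₁ ∙ X
    y₀′ = y₂ ⊕ R₂ ∙ Y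
    split : ∀ (V : Vector) a b p → a * V p + b * V p ≡ (a + b) * V p
    split V a b p = sym (ℕ.*-distribʳ-+ (V p) a b)
    0<JK : 0 < J * K
    0<JK = ℕ.*-mono-≤ {1} {J} {1} {K} (s≤s z≤n) (ℕ.≤-trans (ℕ.≤-trans (s≤s z≤n) (ℕ.m≤n+m (suc L) K₂)) (ℕ.m≤n+m R₁ K₁))
    D≤y₀ : preL W ≤̇ y₀
    D≤y₀ p = ℕ.≤-trans (D≤₁ p) (ℕ.m≤m+n _ _)
    D≤y₁ : preL W ≤̇ y₀′
    D≤y₁ p = ℕ.≤-trans (D≤₂ p) (ℕ.m≤m+n _ _)
    len : length c ≤ J + 0
    len = ℕ.≤-trans (ℕ.≤-trans (ℕ.n≤1+n _) (ℕ.m≤m+n _ j)) (ℕ.m≤m+n J 0)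
    c∈ : All (_∈ W) c
    c∈ = All.++⁺ rest∈ (All.++⁺ (All.tabulate (λ t∈ → t∈)) (All-copies (K₁ + K₂) (All.tabulate (λ t∈ → t∈))))
    ds : All (λ t → pre t ≤̇ preL W) c
    ds = All.map (λ t∈ p → ∈⇒≤sumL (λ t → pre t p) t∈) c∈
    total : ∀ (f : Tr → ℕ) → sumL f κ₁ + sumL f κ₂ + sumL f c ≡ K * sumL f W
    total f = begin
      sumL f κ₁ + sumL f κ₂ + sumL f c
        ≡⟨ cong₂ _+_ (sym (sumL-++ f κ₁ κ₂)) (sumL-++ f rest _) ⟩
      sumL f (κ₁ ++ κ₂) + (sumL f rest + sumL f (copies (suc (K₁ + K₂)) W))
        ≡⟨ ℕ.+-assoc (sumL f (κ₁ ++ κ₂)) _ _ ⟨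
      sumL f (κ₁ ++ κ₂) + sumL f rest + sumL f (copies (suc (K₁ + K₂)) W)
        ≡⟨ cong (_+ sumL f (copies (suc (K₁ + K₂)) W)) (trans (sym (sumL-++ f (κ₁ ++ κ₂) rest)) (sym (sumL-↭ f perm))) ⟩
      sumL f (copies L W) + sumL f (copies (suc (K₁ + K₂)) W)
        ≡⟨ cong₂ _+_ (sumL-copies f L W) (sumL-copies f (suc (K₁ + K₂)) W) ⟩
      L * sumL f W + suc (K₁ + K₂) * sumL f W
        ≡⟨ lemma L K₁ K₂ (sumL f W) ⟩
      K * sumL f W ∎
      where
      open ≡-Reasoning
      lemma : ∀ l a b w → l * w + (1 + (a + b)) * w ≡ (a + (b + (1 + l))) * w
      lemma = solve-∀
    balance : ∀ p → y₀′ p + preL c p ≡ y₀ p + postL c p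
    balance p = ℕ.+-cancelʳ-≡ (preL κ₁ p + postL κ₂ p) _ _ (begin
      (y₂ p + R₂ * Y p + preL c p) + (preL κ₁ p + postL κ₂ p)
        ≡⟨ lemma₁ (y₂ p) (R₂ * Y p) (preL c p) (preL κ₁ p) (postL κ₂ p) ⟩
      (y₂ p + postL κ₂ p) + R₂ * Y p + (preL κ₁ p + preL c p)
        ≡⟨ cong (λ z → z + R₂ * Y p + (preL κ₁ p + preL c p)) (sym (state r₂ p)) ⟩
      (K₂ * Y p + preL κ₂ p) + R₂ * Y p + (preL κ₁ p + preL c p)
        ≡⟨ lemma₂ (K₂ * Y p) (R₂ * Y p) (preL κ₂ p) (preL κ₁ p) (preL c p) ⟩
      (K₂ * Y p + R₂ * Y p) + (preL κ₁ p + preL κ₂ p + preL c p)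
        ≡⟨ cong₂ _+_ (trans (split Y K₂ R₂ p) (cong (_* Y p) K≡)) (total (λ t → pre t p)) ⟩
      K * Y p + K * preL W p
        ≡⟨ ℕ.*-distribˡ-+ K (Y p) (preL W p) ⟨
      K * (Y p + preL W p)
        ≡⟨ cong (K *_) (sym (eq p)) ⟩
      K * (X p + postL W p)
        ≡⟨ ℕ.*-distribˡ-+ K (X p) (postL W p) ⟩
      K * X p + K * postL W p
        ≡⟨ cong₂ _+_ (sym (split X K₁ R₁ p)) (sym (total (λ t → post t p))) ⟩
      (K₁ * X p + R₁ * X p) + (postL κ₁ p + postL κ₂ p + postL c p)
        ≡⟨ lemma₃ (K₁ * X p) (R₁ * X p) (postL κ₁ p) (postL κ₂ p) (postL c p) ⟩
      (K₁ * X p + postL κ₁ p) + R₁ * X p + (postL κ₂ p + postL c p)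
        ≡⟨ cong (λ z → z + R₁ * X p + (postL κ₂ p + postL c p)) (sym (state r₁ p)) ⟩
      (y₁ p + preL κ₁ p) + R₁ * X p + (postL κ₂ p + postL c p)
        ≡⟨ lemma₄ (y₁ p) (preL κ₁ p) (R₁ * X p) (postL κ₂ p) (postL c p) ⟩
      (y₁ p + R₁ * X p + postL c p) + (preL κ₁ p + postL κ₂ p) ∎)
      where
      open ≡-Reasoning
      lemma₁ : ∀ a b c d e → (a + b + c) + (d + e) ≡ (a + e) + b + (d + c)
      lemma₁ = solve-∀
      lemma₂ : ∀ a b c d e → (a + c) + b + (d + e) ≡ (a + b) + (d + c + e)
      lemma₂ = solve-∀
      lemma₃ : ∀ a b c d e → (a + b) + (c + d + e) ≡ (a + c) + b + (d + e)
      lemma₃ = solve-∀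
      lemma₄ : ∀ a b c d e → (a + b) + c + (d + e) ≡ (a + c + e) + (b + d)
      lemma₄ = solve-∀

-- Sequences and recurrences

sumL-filter : {Y : Set} {Q : Y → Set} (Q? : ∀ y → Dec (Q y)) (f : Y → ℕ) (W : List Y) →
  (∀ {y} → y ∈ W → ¬ Q y → f y ≡ 0) → sumL f W ≡ sumL f (filter Q? W)
sumL-filter Q? f []      z = refl
sumL-filter Q? f (y ∷ W) z with Q? y
... | yes q = cong (f y +_) (sumL-filter Q? f W (z ∘ there))
... | no ¬q = cong₂ _+_ (z (here refl) ¬q) (sumL-filter Q? f W (z ∘ there))

module Pigeonhole {C : Set} {size : ℕ} (index : C → Fin size) (index-inj : ∀ {c d} → index c ≡ index d → c ≡ d)
  (Q : C → Set) (Hom Lap : C → C → Set) (idle : ∀ {c} → Hom c c) (_⨾_ : ∀ {a b c} → Hom a b → Hom b c → Hom a c)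
  (forget : ∀ {a b} → Lap a b → Hom a b) (extend : ∀ {a b c} → Lap a b → Hom b c → Lap a c)
  (advance : ∀ c → Q c → ∃[ d ] (Q d × Lap c d)) where

  -- Two of `size + 1` iterates of `advance` have the same index. The lap that leaves the earlier
  -- one is extended by the moves up to the later one, so the event carried by a lap survives on the
  -- closed move.
  recur : ∀ c → Q c → ∃[ d ] (Q d × Hom c d × Lap d d)
  recur c q = closing (Fin.pigeonhole (ℕ.n<1+n size) (λ t → index (proj₁ (at (toℕ t)))))
    where
    at : ℕ → ∃ Q
    at zero    = c , q
    at (suc t) = proj₁ (advance _ (proj₂ (at t))) , proj₁ (proj₂ (advance _ (proj₂ (at t))))
    lap : ∀ t → Lap (proj₁ (at t)) (proj₁ (at (suc t)))
    lap t = proj₂ (proj₂ (advance _ (proj₂ (at t))))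
    hom : ∀ t d → Hom (proj₁ (at t)) (proj₁ (at (d + t)))
    hom t zero    = idle
    hom t (suc d) = hom t d ⨾ forget (lap (d + t))
    closing : (∃[ i ] ∃[ j ] (toℕ {suc size} i < toℕ {suc size} j ×
      index (proj₁ (at (toℕ i))) ≡ index (proj₁ (at (toℕ j))))) → ∃[ d ] (Q d × Hom c d × Lap d d)
    closing (i , j , i<j , e) = proj₁ (at (toℕ i)) , proj₂ (at (toℕ i)) ,
      subst (λ t → Hom c (proj₁ (at t))) (ℕ.+-identityʳ (toℕ i)) (hom 0 (toℕ i)) ,
      subst (Lap _) (sym (index-inj e)) (extend (lap (toℕ i)) (between (toℕ i) (toℕ j) i<j))
      where
      between : ∀ s t → s < t → Hom (proj₁ (at (suc s))) (proj₁ (at t))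
      between s t s<t = subst (λ r → Hom (proj₁ (at (suc s))) (proj₁ (at r))) (ℕ.m∸n+n≡m s<t) (hom (suc s) (t ∸ suc s))

module Transposition {n : ℕ} (ρ : Fin (suc n)) where

  -- Executions are those of process 1, while a closed path yields the edge for some process `ρ`;
  -- exchanging the two turns `ρ` into process 1.
  swap₀ : Fin (suc n) → Fin (suc n)
  swap₀ i with i Fin.≟ zero | i Fin.≟ ρ
  ... | yes _ | _     = ρ
  ... | no _  | yes _ = zero
  ... | no _  | no _  = i

  swap₀-zero : swap₀ zero ≡ ρ
  swap₀-zero = refl

  swap₀-ρ : swap₀ ρ ≡ zero
  swap₀-ρ with ρ Fin.≟ zero | ρ Fin.≟ ρ
  ... | yes e | _     = e
  ... | no _  | yes _ = refl
  ... | no _  | no ne = ⊥-elim (ne refl)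

  swap₀-other : ∀ {i} → i ≢ zero → i ≢ ρ → swap₀ i ≡ i
  swap₀-other {i} n₁ n₂ with i Fin.≟ zero | i Fin.≟ ρ
  ... | yes e | _     = ⊥-elim (n₁ e)
  ... | no _  | yes e = ⊥-elim (n₂ e)
  ... | no _  | no _  = refl

  swap₀-involutive : ∀ i → swap₀ (swap₀ i) ≡ i
  swap₀-involutive i = cases (i Fin.≟ zero) (i Fin.≟ ρ)
    where
    cases : Dec (i ≡ zero) → Dec (i ≡ ρ) → swap₀ (swap₀ i) ≡ i
    cases (yes refl) _          = swap₀-ρ
    cases (no _)     (yes refl) = trans (cong swap₀ swap₀-ρ) swap₀-zero
    cases (no n₁)    (no n₂)    = trans (cong swap₀ (swap₀-other n₁ n₂)) (swap₀-other n₁ n₂)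

record Enumeration {X : Set} (O : ℕ → Maybe X) : Set where
  field
    σ     : ℕ → ℕ
    value : ℕ → X
    σ-suc : ∀ i → σ i < σ (suc i)
    at    : ∀ i → O (σ i) ≡ just (value i)
    onto  : ∀ {t x} → O t ≡ just x → ∃[ i ] σ i ≡ t

module _ {X : Set} (O : ℕ → Maybe X) where

  First : ℕ → ℕ → Set
  First T t = T ≤ t × (∃[ x ] O t ≡ just x) × (∀ t′ → T ≤ t′ → t′ < t → O t′ ≡ nothing)

  -- The known time `t`, at distance `d`, bounds the search for the first time at which `O` is
  -- defined.
  search : ∀ d T t → d + T ≡ t → (∃[ x ] O t ≡ just x) → ∃ (First T)
  search zero    T t refl o = T , ℕ.≤-refl , o , λ t′ le lt → ⊥-elim (ℕ.<⇒≱ lt le)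
  search (suc d) T t e o with O T in eq
  ... | just x  = T , ℕ.≤-refl , (x , eq) , λ t′ le lt → ⊥-elim (ℕ.<⇒≱ lt le)
  ... | nothing = later (search d (suc T) t (trans (ℕ.+-suc d T) e) o)
    where
    later : ∃ (First (suc T)) → ∃ (First T)
    later (t , le , o , none) = t , ℕ.<⇒≤ le , o , none′
      where
      none′ : ∀ t′ → T ≤ t′ → t′ < t → O t′ ≡ nothing
      none′ t′ T≤t′ lt with ℕ.m≤n⇒m<n∨m≡n T≤t′
      ... | inj₁ T<t′ = none t′ T<t′ lt
      ... | inj₂ refl = eq

  module _ (first : ∀ T → ∃ (First T)) where
    private
      τ : ℕ → ℕ
      bound : ℕ → ℕ
      bound zero    = 0
      bound (suc i) = suc (τ i)
      τ i = proj₁ (first (bound i))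

      τ-suc : ∀ i → τ i < τ (suc i)
      τ-suc i = proj₁ (proj₂ (first (suc (τ i))))

      i≤τ : ∀ i → i ≤ τ i
      i≤τ zero    = z≤n
      i≤τ (suc i) = ℕ.≤-trans (s≤s (i≤τ i)) (τ-suc i)

      skipped : ∀ {T t t′ x} → First T t → T ≤ t′ → t′ < t → O t′ ≢ just x
      skipped (_ , _ , none) le lt o with trans (sym o) (none _ le lt)
      ... | ()

      τ-onto : ∀ i {t x} → O t ≡ just x → t < τ i → ∃[ j ] τ j ≡ t
      τ-onto zero    o lt = ⊥-elim (skipped (proj₂ (first 0)) z≤n lt o)
      τ-onto (suc i) {t} o lt = compare (ℕ.<-cmp t (τ i))
        where
        compare : Tri (t < τ i) (t ≡ τ i) (τ i < t) → ∃[ j ] τ j ≡ t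
        compare (tri< lt′ _ _) = τ-onto i o lt′
        compare (tri≈ _ e _)   = i , sym e
        compare (tri> _ _ gt)  = ⊥-elim (skipped (proj₂ (first (suc (τ i)))) gt lt o)

    firsts⇒enumeration : Enumeration O
    firsts⇒enumeration = record
      { σ     = τ
      ; value = λ i → proj₁ (proj₁ (proj₂ (proj₂ (first (bound i)))))
      ; σ-suc = τ-suc
      ; at    = λ i → proj₂ (proj₁ (proj₂ (proj₂ (first (bound i)))))
      ; onto  = λ {t} o → τ-onto (suc t) o (i≤τ (suc t))
      }

  enumerate : (∀ T → ∃[ t ] (T ≤ t × ∃[ x ] O t ≡ just x)) → Enumeration O
  enumerate active = firsts⇒enumeration λ T →
    let t , le , o = active T in search (t ∸ T) T t (ℕ.m∸n+n≡m le) o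

-- The pigeonhole for a sequence that is given instead of built: `advance` selects times satisfying
-- `Q`, and `R`, which holds from a selected time to the next, is stretched to the later time with
-- the same key.
recurrence : ∀ {size} (key : ℕ → Fin size) (Q : ℕ → Set) (R : ℕ → ℕ → Set) →
  (∀ {a b c} → R a b → b ≤ c → R a c) →
  (∀ t → Q t → ∃[ t′ ] (t < t′ × Q t′ × R t t′)) → ∀ t → Q t →
  ∃[ p ] ∃[ q ] (t ≤ p × p < q × Q p × R p q × key p ≡ key q)
recurrence {size} key Q R weaken advance t₀ q₀ =
  closing (Fin.pigeonhole (ℕ.n<1+n size) (λ i → key (time (toℕ i))))
  where
  at : ℕ → ∃ Q
  at zero    = t₀ , q₀
  at (suc i) = let t′ , _ , q′ , _ = advance (proj₁ (at i)) (proj₂ (at i)) in t′ , q′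
  time : ℕ → ℕ
  time i = proj₁ (at i)
  next< : ∀ i → time i < time (suc i)
  next< i = proj₁ (proj₂ (advance (proj₁ (at i)) (proj₂ (at i))))
  mono : ∀ d i → time i ≤ time (d + i)
  mono zero    i = ℕ.≤-refl
  mono (suc d) i = ℕ.≤-trans (mono d i) (ℕ.<⇒≤ (next< (d + i)))
  mono≤ : ∀ {i j} → i ≤ j → time i ≤ time j
  mono≤ {i} {j} le = subst (λ x → time i ≤ time x) (ℕ.m∸n+n≡m le) (mono (j ∸ i) i)
  closing : (∃[ i ] ∃[ j ] (toℕ {suc size} i < toℕ {suc size} j × key (time (toℕ i)) ≡ key (time (toℕ j)))) →
    ∃[ p ] ∃[ q ] (t₀ ≤ p × p < q × Q p × R p q × key p ≡ key q)
  closing (i , j , i<j , e) = time (toℕ i) , time (toℕ j) , mono≤ {0} {toℕ i} z≤n , ℕ.≤-trans (next< (toℕ i)) (mono≤ {suc (toℕ i)} {toℕ j} i<j) ,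
    proj₂ (at (toℕ i)) , weaken (proj₂ (proj₂ (proj₂ (advance (proj₁ (at (toℕ i))) (proj₂ (at (toℕ i))))))) (mono≤ {suc (toℕ i)} {toℕ j} i<j) , e

sublists : {Y : Set} → List Y → List (List Y)
sublists []       = [] ∷ []
sublists (y ∷ ys) = sublists ys ++ map (y ∷_) (sublists ys)

filter∈sublists : {Y : Set} {Q : Y → Set} (Q? : Decidable Q) (ys : List Y) → filter Q? ys ∈ sublists ys
filter∈sublists Q? [] = here refl
filter∈sublists Q? (y ∷ ys) with Q? y
... | yes _ = ∈-++⁺ʳ (sublists ys) (∈-map⁺ (y ∷_) (filter∈sublists Q? ys))
... | no _  = ∈-++⁺ˡ (filter∈sublists Q? ys)

-- `wrap` keeps the level sets invariant: states entered by a broadcast from level `m` belong to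
-- level `n`. `s₀` serves as a default value and as a spare process.
module Unwinding {k A : ℕ} (1≤k : 1 ≤ k) (P : Template k A) (m n : ℕ) (n≤m : n ≤ m)
                 (wrap : ∀ {s} → Unwind.InS P (suc m) s → Unwind.InS P n s)
                 (s₀ : Fin (Template.nSt P)) (init₀ : Template.init P s₀ ≡ true) where

  -- The unwinding as a net, and single steps on coded configurations

  open Template P
  open Unwind P
  open RB (unwind m n)

  Pl : Set
  Pl = Fin nSt × ℕ

  -- A rendezvous symbol labels at most one edge, so level and action determine all `k` edges of a
  -- rendezvous. One variable therefore stands for `k` edges with equal flow.
  Act : Set
  Act = ℕ × Fin A

  Bc : Set
  Bc = ℕ × Fin nSt × Fin nSt

  Var : Set
  Var = Act ⊎ Bc

  _≟ᴾ_ : DecidableEquality Pl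
  _≟ᴾ_ = Product.≡-dec Fin._≟_ ℕ._≟_

  _≟ⱽ_ : DecidableEquality Var
  _≟ⱽ_ = Sum.≡-dec (Product.≡-dec ℕ._≟_ Fin._≟_) (Product.≡-dec ℕ._≟_ (Product.≡-dec Fin._≟_ Fin._≟_))

  leg? : ∀ a j → Dec (∃[ s ] ∃[ t ] edge s (rdz a j) t ≡ true)
  leg? a j = Fin.any? λ s → Fin.any? λ t → edge s (rdz a j) t Bool.≟ true

  -- For a symbol that labels no edge the result is the junk value s₀.
  leg : Fin A → Fin k → Fin nSt × Fin nSt
  leg a j with leg? a j
  ... | yes (s , t , _) = s , t
  ... | no _ = s₀ , s₀

  legSrc legTgt : Fin A → Fin k → Fin nSt
  legSrc a j = proj₁ (leg a j)
  legTgt a j = proj₂ (leg a j)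

  leg-unique : ∀ {a j s t} → edge s (rdz a j) t ≡ true → s ≡ legSrc a j × t ≡ legTgt a j
  leg-unique {a} {j} e with leg? a j
  ... | yes (s′ , t′ , e′) = rdzUnique a j _ _ _ _ e e′
  ... | no none = ⊥-elim (none (_ , _ , e))

  Valid : Fin A → Set
  Valid a = ∀ j → edge (legSrc a j) (rdz a j) (legTgt a j) ≡ true

  valid? : ∀ a → Dec (Valid a)
  valid? a = Fin.all? λ j → edge (legSrc a j) (rdz a j) (legTgt a j) Bool.≟ true

  legs⇒valid : ∀ {a} → (∀ j → ∃[ s ] ∃[ t ] edge s (rdz a j) t ≡ true) → Valid a
  legs⇒valid f j with f j
  ... | s , t , e with leg-unique e
  ...   | refl , refl = e

  module _ (i : ℕ) (InI? : ∀ s → Dec (InI i s)) where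
    private
      rules = filter valid? (allFin A)
      open Closure Fin._≟_ legSrc legTgt (InI i) InI? rules

      InI⇒InS : ∀ {j s} → InI j s → InS j s
      InI⇒InS {zero}  e = init0 e
      InI⇒InS {suc j} (h , h∈ , e) = bstep h∈ e

      sound : ∀ {s} → Derivable s → InS i s
      sound (base b) = InI⇒InS b
      sound (rule {a} a∈ ds l) = rtgt (sat (va l) (λ l′ → legSrc a l′ , legTgt a l′ , va l′ , sound (ds l′)))
        where va = proj₂ (∈-filter⁻ valid? {xs = allFin A} a∈)

      complete : ∀ {s} → InS i s → Derivable s
      complete (init0 e) = base e
      complete (bstep h∈ e) = base (_ , h∈ , e)
      complete (rtgt (sat {a = a} {h = h} e ps)) = subst Derivable (sym (proj₂ (leg-unique e)))
        (rule (∈-filter⁺ valid? (∈-allFin a) (legs⇒valid (λ l → _ , _ , proj₁ (proj₂ (proj₂ (ps l))))))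
          (λ l → subst Derivable (proj₁ (leg-unique (proj₁ (proj₂ (proj₂ (ps l)))))) (complete (proj₂ (proj₂ (proj₂ (ps l)))))) h)

    -- Saturation is the closure of the entry states under the actions all of whose symbols label an
    -- edge. Taking the decision of `InI` as an argument lets the recursion over levels alternate
    -- between the two predicates.
    InS-dec : ∀ s → Dec (InS i s)
    InS-dec s = map′ sound complete (derivable? s)

  InI? : ∀ i s → Dec (InI i s)
  InS? : ∀ i s → Dec (InS i s)
  InI? zero    s = init s Bool.≟ true
  InI? (suc i) s = Fin.any? λ h → InS? i h ×-dec (edge h bc s Bool.≟ true)
  InS? i = InS-dec i (InI? i)

  Enabled : Act → Set
  Enabled (i , a) = i ≤ m × Valid a × (∀ l → InS i (legSrc a l))

  InR⇒enabled : ∀ {i s a h t} → i ≤ m → InR i s a h t → Enabled (i , a) × s ≡ legSrc a h × t ≡ legTgt a h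
  InR⇒enabled {i} i≤m (sat e ps) =
    (i≤m , legs⇒valid (λ l → _ , _ , proj₁ (proj₂ (proj₂ (ps l)))) ,
     λ l → subst (InS i) (proj₁ (leg-unique (proj₁ (proj₂ (proj₂ (ps l)))))) (proj₂ (proj₂ (proj₂ (ps l))))) ,
    leg-unique e

  enabled⇒InR : ∀ {i a} → Enabled (i , a) → ∀ h → InR i (legSrc a h) a h (legTgt a h)
  enabled⇒InR {i} {a} (_ , va , src∈) h = sat (va h) (λ l → legSrc a l , legTgt a l , va l , src∈ l)

  Moves : Bc → Set
  Moves (i , s , t) = i ≤ m × InS i s × edge s bc t ≡ true

  next : ℕ → ℕ
  next i with i ℕ.<? m
  ... | yes _ = suc i
  ... | no _ = n

  next-spec : ∀ {i} → i ≤ m → (i < m × next i ≡ suc i) ⊎ (i ≡ m × next i ≡ n)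
  next-spec {i} i≤m with i ℕ.<? m
  ... | yes i<m = inj₁ (i<m , refl)
  ... | no i≮m = inj₂ (ℕ.≤-antisym i≤m (ℕ.≮⇒≥ i≮m) , refl)

  next-unique : ∀ {i j} → (i < m × j ≡ suc i) ⊎ (i ≡ m × j ≡ n) → j ≡ next i
  next-unique {i} p with i ℕ.<? m | p
  ... | yes _ | inj₁ (_ , e) = e
  ... | yes i<m | inj₂ (refl , _) = ⊥-elim (ℕ.<-irrefl refl i<m)
  ... | no i≮m | inj₁ (i<m , _) = ⊥-elim (i≮m i<m)
  ... | no _ | inj₂ (_ , e) = e

  next≤m : ∀ i → next i ≤ m
  next≤m i with i ℕ.<? m
  ... | yes i<m = i<m
  ... | no _ = n≤m

  next-InS : ∀ {i s t} → Moves (i , s , t) → InS (next i) t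
  next-InS {i} (i≤m , s∈ , e) with next-spec i≤m
  ... | inj₁ (_ , eq) = subst (λ j → InS j _) (sym eq) (bstep s∈ e)
  ... | inj₂ (refl , eq) = subst (λ j → InS j _) (sym eq) (wrap (bstep s∈ e))

  src tgt : Act → Fin k → Pl
  src (i , a) l = legSrc a l , i
  tgt (i , a) l = legTgt a l , i

  bcSrc bcTgt : Bc → Pl
  bcSrc (i , s , t) = s , i
  bcTgt (i , s , t) = t , next i

  open Net _≟ᴾ_ src tgt

  #-other : ∀ {N} (f : Fin N → Pl) {s i} → (∀ j → proj₂ (f j) ≢ i) → # f (s , i) ≡ 0
  #-other f {s} {i} ne = sum≡0 _ (λ j → δ-≢ {f j} {s , i} (λ e → ne j (cong proj₂ e)))

  -- Configurations with all processes at one level, coded by numbers: by pigeonhole, recurring codes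
  -- are equal, not just pointwise equal.
  record Code (N : ℕ) : Set where
    constructor coded
    field
      index : Fin (nSt ^ suc N)
  open Code

  record Node (N : ℕ) : Set where
    constructor _▸_
    field
      level : ℕ
      code  : Code N
  open Node

  encode : ∀ {N} → (Fin (suc N) → Fin nSt) → Code N
  encode st = coded (funToFin st)

  states : ∀ {N} → Node N → Fin (suc N) → Fin nSt
  states {N} (ℓ ▸ c) = finToFun {nSt} {suc N} (index c)

  conf : ∀ {N} → Node N → Config N
  conf ν i = states ν i , level ν

  node : ∀ {N} → ℕ → (Fin (suc N) → Fin nSt) → Node N
  node ℓ st = ℓ ▸ encode st

  states-node : ∀ {N} ℓ (st : Fin (suc N) → Fin nSt) → states (node ℓ st) ≗ st
  states-node ℓ st = Fin.finToFun-funToFin st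

  Reached : ∀ {N} → Node N → Set
  Reached ν = level ν ≤ m × (∀ i → InS (level ν) (states ν i))

  -- The vector may also make demands on levels that are visited at other times, and processes
  -- without a task are allowed.
  Covers : ∀ {N} → Node N → Vector → Set
  Covers ν u = ∀ s → u (s , level ν) ≤ # (conf ν) (s , level ν)

  Step : ∀ {N} → Node N → Node N → Set
  Step ν μ = Trans (conf ν) (conf μ)

  isBc : ∀ {N} {f g : Config N} → Trans f g → Bool
  isBc (bcast _) = true
  isBc (rdzv _ _ _ _ _) = false

  -- A computable form of `edge₁` for an arbitrary process; `nothing` stands for a rendezvous
  -- without it.
  obs : ∀ {N} {f g : Config N} → Fin (suc N) → Trans f g → Maybe Triple
  obs {f = f} {g} ρ (bcast _) = just (f ρ , bc , g ρ)
  obs {f = f} {g} ρ (rdzv a ι _ _ _) with Fin.any? (λ j → ι j Fin.≟ ρ)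
  ... | yes (j , _) = just (f ρ , rdz a j , g ρ)
  ... | no _ = nothing

  obs-rdzv : ∀ {N} {f g : Config N} {a ι} {inj : Injective ι} {es os} j →
    obs {f = f} {g} (ι j) (rdzv a ι inj es os) ≡ just (f (ι j) , rdz a j , g (ι j))
  obs-rdzv {ι = ι} {inj} j with Fin.any? (λ j′ → ι j′ Fin.≟ ι j)
  ... | yes (j′ , e) = cong (λ x → just (_ , rdz _ x , _)) (inj j′ j e)
  ... | no none = ⊥-elim (none (j , refl))

  -- Covering the sources with multiplicity yields pairwise distinct processes for the `k` roles.
  rendezvous : ∀ {N ℓ a} (c : Code N) → let ν = ℓ ▸ c in
    Reached ν → Enabled (ℓ , a) → Covers ν (pre (ℓ , a)) →
    ∃[ c′ ] Σ (Step ν (ℓ ▸ c′)) λ step → Reached (ℓ ▸ c′) × isBc step ≡ false ×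
      (∀ x → # (conf (ℓ ▸ c′)) x + pre (ℓ , a) x ≡ # (conf ν) x + post (ℓ , a) x) ×
      (∀ h → ∃[ ρ ] obs ρ step ≡ just ((legSrc a h , ℓ) , rdz a h , (legTgt a h , ℓ)))
  rendezvous {N} {ℓ} {a} c (ℓ≤m , in∈) en cov = c′ , step , (ℓ≤m , in∈′) , refl , counts , observed
    where
    ν : Node N
    ν = ℓ ▸ c
    f = conf ν
    cov′ : ∀ x → # (src (ℓ , a)) x ≤ # f x
    cov′ (s , i) with ℓ ℕ.≟ i
    ... | yes refl = cov s
    ... | no ne = subst (_≤ _) (sym (#-other (src (ℓ , a)) (λ _ → ne))) z≤n
    match = #⇒injection (src (ℓ , a)) f cov′
    ι = proj₁ match
    inj = proj₁ (proj₂ match)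
    fι : ∀ j → f (ι j) ≡ src (ℓ , a) j
    fι = proj₂ (proj₂ match)
    st′ : Fin (suc N) → Fin nSt
    st′ i with Fin.any? (λ j → ι j Fin.≟ i)
    ... | yes (j , _) = legTgt a j
    ... | no _ = states ν i
    st′-hit : ∀ j → st′ (ι j) ≡ legTgt a j
    st′-hit j with Fin.any? (λ j′ → ι j′ Fin.≟ ι j)
    ... | yes (j′ , e) = cong (legTgt a) (inj j′ j e)
    ... | no none = ⊥-elim (none (j , refl))
    st′-miss : ∀ i → (∀ j → ι j ≢ i) → st′ i ≡ states ν i
    st′-miss i ne with Fin.any? (λ j → ι j Fin.≟ i)
    ... | yes (j , e) = ⊥-elim (ne j e)
    ... | no _ = refl
    c′ = encode st′
    ν′ : Node N
    ν′ = ℓ ▸ c′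
    hit : ∀ j → states ν′ (ι j) ≡ legTgt a j
    hit j = trans (states-node ℓ st′ (ι j)) (st′-hit j)
    miss : ∀ i → (∀ j → ι j ≢ i) → states ν′ i ≡ states ν i
    miss i ne = trans (states-node ℓ st′ i) (st′-miss i ne)
    edges : ∀ j → UEdge m n (f (ι j)) (rdz a j) (conf ν′ (ι j))
    edges j = refl , ℓ≤m , subst₂ (λ s t → InR ℓ s a j t) (sym (cong proj₁ (fι j))) (sym (hit j)) (enabled⇒InR en j)
    others : ∀ i → (∀ j → ι j ≢ i) → conf ν′ i ≡ f i
    others i ne = cong (_, ℓ) (miss i ne)
    step : Step ν ν′
    step = rdzv a ι inj edges others
    in∈′ : ∀ i → InS ℓ (states ν′ i)
    in∈′ i with Fin.any? (λ j → ι j Fin.≟ i)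
    ... | yes (j , refl) = subst (InS ℓ) (sym (hit j)) (rtgt (enabled⇒InR en j))
    ... | no none = subst (InS ℓ) (sym (miss i (λ j e → none (j , e)))) (in∈ i)
    counts : ∀ x → # (conf ν′) x + pre (ℓ , a) x ≡ # f x + post (ℓ , a) x
    counts x = trans (cong (# (conf ν′) x +_) (sym (#-cong fι x)))
      (trans (#-exchange inj f (conf ν′) others x)
        (cong (# f x +_) (#-cong (λ j → cong (_, ℓ) (hit j)) x)))
    observed : ∀ h → ∃[ ρ ] obs ρ step ≡ just ((legSrc a h , ℓ) , rdz a h , (legTgt a h , ℓ))
    observed h = ι h , trans (obs-rdzv {inj = inj} {es = edges} {os = others} h)
      (cong₂ (λ x y → just (x , rdz a h , y)) (fι h) (cong (_, ℓ) (hit h)))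

  broadcast : ∀ {N ℓ} (c : Code N) (tasks : List (Fin nSt × Fin nSt)) → let ν = ℓ ▸ c in
    Reached ν → All (λ (s , t) → edge s bc t ≡ true) tasks →
    Covers ν (λ x → sumL (λ (s , t) → δ (s , ℓ) x) tasks) →
    ∃[ c′ ] Σ (Step ν (next ℓ ▸ c′)) λ step → Reached (next ℓ ▸ c′) × isBc step ≡ true ×
      Covers (next ℓ ▸ c′) (λ x → sumL (λ (s , t) → δ (t , next ℓ) x) tasks) ×
      (∀ {s t} → (s , t) ∈ tasks → ∃[ ρ ] obs ρ step ≡ just ((s , ℓ) , bc , (t , next ℓ)))
  broadcast {N} {ℓ} c tasks (ℓ≤m , in∈) tasks-ok cov =
    c′ , bcast edges , (next≤m ℓ , (λ i → next-InS (ℓ≤m , in∈ i , ok i))) , refl , cov″ , observed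
    where
    ν : Node N
    ν = ℓ ▸ c
    f = conf ν
    d : Fin (length tasks) → Pl
    d j = proj₁ (lookup tasks j) , ℓ
    cov′ : ∀ x → # d x ≤ # f x
    cov′ (s , i) with ℓ ℕ.≟ i
    ... | yes refl = ℕ.≤-trans (ℕ.≤-reflexive (#-lookup (λ (s , t) → s , ℓ) tasks (s , i))) (cov s)
    ... | no ne = subst (_≤ _) (sym (#-other d (λ _ → ne))) z≤n
    match = #⇒injection d f cov′
    ι = proj₁ match
    inj = proj₁ (proj₂ match)
    fι : ∀ j → f (ι j) ≡ d j
    fι = proj₂ (proj₂ match)
    st′ : Fin (suc N) → Fin nSt
    st′ i with Fin.any? (λ j → ι j Fin.≟ i)
    ... | yes (j , _) = proj₂ (lookup tasks j)
    -- A process without a task follows an arbitrary broadcast edge.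
    ... | no _ = proj₁ (bcTotal (states ν i))
    st′-hit : ∀ j → st′ (ι j) ≡ proj₂ (lookup tasks j)
    st′-hit j with Fin.any? (λ j′ → ι j′ Fin.≟ ι j)
    ... | yes (j′ , e) = cong (λ x → proj₂ (lookup tasks x)) (inj j′ j e)
    ... | no none = ⊥-elim (none (j , refl))
    st′-ok : ∀ i → edge (states ν i) bc (st′ i) ≡ true
    st′-ok i with Fin.any? (λ j → ι j Fin.≟ i)
    ... | yes (j , refl) = subst (λ s → edge s bc (proj₂ (lookup tasks j)) ≡ true)
            (sym (cong proj₁ (fι j))) (All.lookup tasks-ok (∈-lookup {xs = tasks} j))
    ... | no _ = proj₂ (bcTotal (states ν i))
    c′ = encode st′
    ν′ : Node N
    ν′ = next ℓ ▸ c′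
    ok : ∀ i → edge (states ν i) bc (states ν′ i) ≡ true
    ok i = subst (λ t → edge (states ν i) bc t ≡ true) (sym (states-node (next ℓ) st′ i)) (st′-ok i)
    hit : ∀ j → conf ν′ (ι j) ≡ (proj₂ (lookup tasks j) , next ℓ)
    hit j = cong (_, next ℓ) (trans (states-node (next ℓ) st′ (ι j)) (st′-hit j))
    edges : ∀ i → UEdge m n (f i) bc (conf ν′ i)
    edges i = ℓ≤m , in∈ i , ok i , next-spec ℓ≤m
    cov″ : Covers ν′ (λ x → sumL (λ (s , t) → δ (t , next ℓ) x) tasks)
    cov″ s = ℕ.≤-trans (ℕ.≤-reflexive (trans (sym (#-lookup (λ (s , t) → t , next ℓ) tasks x))
      (sym (#-cong hit x)))) (#-inj≤ inj (conf ν′) x)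
      where x = s , next ℓ
    observed : ∀ {s t} → (s , t) ∈ tasks →
      ∃[ ρ ] obs ρ (bcast {f = f} {g = conf ν′} edges) ≡ just ((s , ℓ) , bc , (t , next ℓ))
    observed {s} {t} st∈ = ι j , cong₂ (λ x y → just (x , bc , y))
        (trans (fι j) (cong (λ z → proj₁ z , ℓ) (sym e))) (trans (hit j) (cong (λ z → proj₂ z , next ℓ) (sym e)))
      where
      j = Any.index st∈
      e : (s , t) ≡ lookup tasks j
      e = Any.lookup-index st∈

  -- Paths and flooding

  infixr 5 _∷_ _++ᴾ_

  data Path {N : ℕ} : Node N → Node N → Set where
    []  : ∀ {ν} → Path ν ν
    _∷_ : ∀ {ν μ ξ} → Step ν μ → Path μ ξ → Path ν ξ

  data Occurs {N : ℕ} (ρ : Fin (suc N)) (ed : Triple) : ∀ {ν μ : Node N} → Path ν μ → Set where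
    here  : ∀ {ν μ ξ} {s : Step ν μ} {p : Path μ ξ} → obs ρ s ≡ just ed → Occurs ρ ed (s ∷ p)
    there : ∀ {ν μ ξ} {s : Step ν μ} {p : Path μ ξ} → Occurs ρ ed p → Occurs ρ ed (s ∷ p)

  data HasBc {N : ℕ} : ∀ {ν μ : Node N} → Path ν μ → Set where
    here  : ∀ {ν μ ξ} {s : Step ν μ} {p : Path μ ξ} → isBc s ≡ true → HasBc (s ∷ p)
    there : ∀ {ν μ ξ} {s : Step ν μ} {p : Path μ ξ} → HasBc p → HasBc (s ∷ p)

  data NoBc {N : ℕ} : ∀ {ν μ : Node N} → Path ν μ → Set where
    []  : ∀ {ν} → NoBc ([] {ν = ν})
    _∷_ : ∀ {ν μ ξ} {s : Step ν μ} {p : Path μ ξ} → isBc s ≡ false → NoBc p → NoBc (s ∷ p)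

  _++ᴾ_ : ∀ {N} {ν μ ξ : Node N} → Path ν μ → Path μ ξ → Path ν ξ
  []      ++ᴾ q = q
  (s ∷ p) ++ᴾ q = s ∷ (p ++ᴾ q)

  module _ {N : ℕ} {ρ : Fin (suc N)} {ed : Triple} {ξ : Node N} where
    occurs-++ˡ : ∀ {ν μ} {p : Path ν μ} {q : Path μ ξ} → Occurs ρ ed p → Occurs ρ ed (p ++ᴾ q)
    occurs-++ˡ (here e)  = here e
    occurs-++ˡ (there o) = there (occurs-++ˡ o)

    occurs-++ʳ : ∀ {ν μ} (p : Path ν μ) {q : Path μ ξ} → Occurs ρ ed q → Occurs ρ ed (p ++ᴾ q)
    occurs-++ʳ []      o = o
    occurs-++ʳ (s ∷ p) o = there (occurs-++ʳ p o)

  module _ {N : ℕ} {ξ : Node N} where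
    hasBc-++ˡ : ∀ {ν μ} {p : Path ν μ} {q : Path μ ξ} → HasBc p → HasBc (p ++ᴾ q)
    hasBc-++ˡ (here e)  = here e
    hasBc-++ˡ (there o) = there (hasBc-++ˡ o)

    hasBc-++ʳ : ∀ {ν μ} (p : Path ν μ) {q : Path μ ξ} → HasBc q → HasBc (p ++ᴾ q)
    hasBc-++ʳ []      o = o
    hasBc-++ʳ (s ∷ p) o = there (hasBc-++ʳ p o)

    noBc-++ : ∀ {ν μ} {p : Path ν μ} {q : Path μ ξ} → NoBc p → NoBc q → NoBc (p ++ᴾ q)
    noBc-++ []      b = b
    noBc-++ (e ∷ a) b = e ∷ noBc-++ a b

  rdzTriple : ℕ → Fin A → Fin k → Triple
  rdzTriple ℓ a h = (legSrc a h , ℓ) , rdz a h , (legTgt a h , ℓ)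

  bcTriple : Bc → Triple
  bcTriple b = bcSrc b , bc , bcTgt b

  Lifted : ∀ {N} → ℕ → Code N → List Act → Vector → Set
  Lifted ℓ c κ v = ∃[ c′ ] Σ (Path (ℓ ▸ c) (ℓ ▸ c′)) λ p → NoBc p × Reached (ℓ ▸ c′) × Covers (ℓ ▸ c′) v ×
    (∀ {a} h → (ℓ , a) ∈ κ → ∃[ ρ ] Occurs ρ (rdzTriple ℓ a h) p)

  -- Actions of other levels do not change the counts on `ℓ` and are skipped; those of `ℓ` become
  -- rendezvous steps. Thus one sequence is executed piecewise, level after level.
  lift : ∀ {N} ℓ (c : Code N) {u κ v} → Reached (ℓ ▸ c) → Covers (ℓ ▸ c) u → Fires u κ v → All Enabled κ →
    Lifted ℓ c κ v
  lift-fire : ∀ {N} ℓ (c : Code N) {u u′ κ v i a} → Dec (i ≡ ℓ) → Reached (ℓ ▸ c) → Covers (ℓ ▸ c) u →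
    pre (i , a) ≤̇ u → (∀ p → u′ p + pre (i , a) p ≡ u p + post (i , a) p) → Fires u′ κ v →
    Enabled (i , a) → All Enabled κ → Lifted ℓ c ((i , a) ∷ κ) v

  lift ℓ c r cov (done e) [] = c , [] , [] , r , (λ s → subst (_≤ _) (e _) (cov s)) , λ h ()
  lift ℓ c r cov (fire {i , a} le eq fs) (en ∷ ens) = lift-fire ℓ c (i ℕ.≟ ℓ) r cov le eq fs en ens

  lift-fire ℓ c {u} {u′} {a = a} (yes refl) r cov le eq fs en ens =
    let c₁ , step , r₁ , nb , counts , observed = rendezvous c r en (λ s → ℕ.≤-trans (le (s , ℓ)) (cov s))
        cov₁ : Covers (ℓ ▸ c₁) u′
        cov₁ s = ℕ.+-cancelʳ-≤ (pre (ℓ , a) (s , ℓ)) _ _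
          (ℕ.≤-trans (ℕ.≤-reflexive (eq (s , ℓ)))
            (ℕ.≤-trans (ℕ.+-monoˡ-≤ (post (ℓ , a) (s , ℓ)) (cov s)) (ℕ.≤-reflexive (sym (counts (s , ℓ))))))
        c₂ , p , np , r₂ , cov₂ , occ = lift ℓ c₁ r₁ cov₁ fs ens
    in c₂ , step ∷ p , nb ∷ np , r₂ , cov₂ ,
       λ { h (here refl) → proj₁ (observed h) , here (proj₂ (observed h))
         ; h (there t∈) → proj₁ (occ h t∈) , there (proj₂ (occ h t∈)) }
  lift-fire ℓ c {u} {u′} {i = i} {a} (no i≢ℓ) r cov le eq fs en ens =
    let same : ∀ s → u′ (s , ℓ) ≡ u (s , ℓ)
        same s = trans (sym (ℕ.+-identityʳ (u′ (s , ℓ))))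
          (trans (cong (u′ (s , ℓ) +_) (sym (#-other (src (i , a)) (λ _ → i≢ℓ))))
            (trans (eq (s , ℓ)) (trans (cong (u (s , ℓ) +_) (#-other (tgt (i , a)) (λ _ → i≢ℓ))) (ℕ.+-identityʳ (u (s , ℓ))))))
        c₂ , p , np , r₂ , cov₂ , occ = lift ℓ c r (λ s → ℕ.≤-trans (ℕ.≤-reflexive (same s)) (cov s)) fs ens
    in c₂ , p , np , r₂ , cov₂ , λ { h (here refl) → ⊥-elim (i≢ℓ refl) ; h (there t∈) → occ h t∈ }

  Reachable : ∀ {N} → Node N → Set
  Reachable {N} ν = Σ (Node N) λ ν₀ → level ν₀ ≡ 0 × (∀ i → init (states ν₀ i) ≡ true) × Path ν₀ ν

  Flooded : ℕ → List Pl → Set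
  Flooded ℓ d = ∃[ N ] Σ (Code N) λ c → Reachable (ℓ ▸ c) × Reached (ℓ ▸ c) × Covers (ℓ ▸ c) (count d)

  enabled? : ∀ t → Dec (Enabled t)
  enabled? (i , a) = (i ℕ.≤? m) ×-dec (valid? a ×-dec Fin.all? (λ l → InS? i (legSrc a l)))

  InS-induction : ∀ {i} (Q : Fin nSt → Set) → (∀ {s} → InI i s → Q s) →
    (∀ {a} → Valid a → (∀ l → InS i (legSrc a l)) → (∀ l → Q (legSrc a l)) → ∀ h → Q (legTgt a h)) →
    ∀ {s} → InS i s → Q s
  InS-induction Q base step (init0 e) = base e
  InS-induction Q base step (bstep h∈ e) = base (_ , h∈ , e)
  InS-induction {i} Q base step (rtgt (sat {a = a} {h = h} e ps)) = subst Q (sym (proj₂ (leg-unique e)))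
    (step (legs⇒valid (λ l → _ , _ , proj₁ (proj₂ (proj₂ (ps l)))))
      (λ l → subst (InS i) (proj₁ (leg-unique (proj₁ (proj₂ (proj₂ (ps l)))))) (proj₂ (proj₂ (proj₂ (ps l)))))
      (λ l → subst Q (proj₁ (leg-unique (proj₁ (proj₂ (proj₂ (ps l))))))
               (InS-induction Q base step (proj₂ (proj₂ (proj₂ (ps l)))))) h)

  module _ (ℓ : ℕ) (ℓ≤m : ℓ ≤ m) (entry : ∀ d → All (InI ℓ) d → Flooded ℓ (map (_, ℓ) d)) where
    private
      rules : List Act
      rules = filter enabled? (map (ℓ ,_) (allFin A))

      𝓤 : Vector → Set
      𝓤 u = ∃[ d ] (All (InI ℓ) d × u ≗ count (map (_, ℓ) d))

      𝓤-⊕ : ∀ {u v} → 𝓤 u → 𝓤 v → 𝓤 (u ⊕ v)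
      𝓤-⊕ (d , d∈ , e) (d′ , d′∈ , e′) = d ++ d′ , All.++⁺ d∈ d′∈ , λ p →
        trans (cong₂ _+_ (trans (e p) (sumL-map _ (_, ℓ) d)) (trans (e′ p) (sumL-map _ (_, ℓ) d′)))
          (trans (sym (sumL-++ (λ s → δ (s , ℓ) p) d d′)) (sym (sumL-map _ (_, ℓ) (d ++ d′))))

      open Kick 𝓤 ((λ _ → 0) , [] , [] , λ _ → refl) 𝓤-⊕ rules

      cover : ∀ {s} → InS ℓ s → Coverable (δ (s , ℓ))
      cover = InS-induction (λ s → Coverable (δ (s , ℓ)))
        (λ {s} s∈ → δ (s , ℓ) , [] , δ (s , ℓ) ,
           (s ∷ [] , s∈ ∷ [] , λ p → sym (ℕ.+-identityʳ _)) , done (λ _ → refl) , (λ _ → ℕ.≤-refl) , [])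
        (λ {a} va src∈ cov h →
           coverable-rule (∈-filter⁺ enabled? (∈-map⁺ (ℓ ,_) (∈-allFin a)) (ℓ≤m , va , src∈)) cov h)

    -- Entry states are available in any number, so by additivity of coverability all demanded
    -- states that arise from them by saturation can be covered at once.
    flood-level : ∀ d → All (λ p → InS (proj₂ p) (proj₁ p)) d → Flooded ℓ d
    flood-level d d∈ = result
      where
      d′ = filter (λ p → proj₂ p ℕ.≟ ℓ) d
      cov′ : Coverable (count d′)
      cov′ = coverable-sumL δ d′ λ {p} p∈ → at p (∈-filter⁻ (λ p → proj₂ p ℕ.≟ ℓ) {xs = d} p∈)
        where
        at : ∀ p → p ∈ d × proj₂ p ≡ ℓ → Coverable (δ p)
        at (s , i) (p∈ , refl) = cover (All.lookup d∈ p∈)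
      cov≤ : ∀ s → count d (s , ℓ) ≡ count d′ (s , ℓ)
      cov≤ s = sumL-filter (λ p → proj₂ p ℕ.≟ ℓ) (λ q → δ q (s , ℓ)) d
        (λ {q} _ ne → δ-≢ {q} {s , ℓ} (λ e → ne (cong proj₂ e)))
      result : Flooded ℓ d
      result =
        let u , κ , v , (e , e∈ , u≗) , fs , d≤v , κ∈ = cov′
            N , c , (ν₀ , l₀ , i₀ , q) , r , cov = entry e e∈
            c′ , p , _ , r′ , cov″ , _ = lift ℓ c r (λ s → subst (_≤ # (conf (ℓ ▸ c)) (s , ℓ)) (sym (u≗ (s , ℓ))) (cov s)) fs
              (All.map (λ t∈ → proj₂ (∈-filter⁻ enabled? {xs = map (ℓ ,_) (allFin A)} t∈)) κ∈)
        in N , c′ , (ν₀ , l₀ , i₀ , q ++ᴾ p) , r′ ,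
           λ s → ℕ.≤-trans (ℕ.≤-reflexive (cov≤ s)) (ℕ.≤-trans (d≤v (s , ℓ)) (cov″ s))

  flood-initial : ∀ d → All (InI 0) d → Flooded 0 (map (_, 0) d)
  flood-initial d d∈ = length d , code ν , (ν , refl , initial , []) , (z≤n , (λ i → init0 (initial i))) , cov
    where
    st : Fin (suc (length d)) → Fin nSt
    -- A configuration has at least one process, so `s₀` is added in case `d` is empty.
    st = lookup (s₀ ∷ d)
    ν : Node (length d)
    ν = node 0 st
    initial : ∀ i → init (states ν i) ≡ true
    initial i = subst (λ s → init s ≡ true) (sym (states-node 0 st i)) (All.lookup (init₀ ∷ d∈) (∈-lookup i))
    cov : Covers ν (count (map (_, 0) d))
    cov s = ℕ.≤-trans (ℕ.m≤n+m _ (δ (s₀ , 0) (s , 0))) (ℕ.≤-reflexive (trans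
      (cong (δ (s₀ , 0) (s , 0) +_) (sumL-map _ (_, 0) d))
      (trans (sym (#-lookup (_, 0) (s₀ ∷ d) (s , 0))) (#-cong (λ i → cong (_, 0) (sym (states-node 0 st i))) (s , 0)))))

  -- Every entry state of the next level has a predecessor on level `i`; the predecessors are
  -- flooded and each takes its edge in one common broadcast.
  flood-broadcast : ∀ i → i < m → (∀ d → All (λ p → InS (proj₂ p) (proj₁ p)) d → Flooded i d) →
    ∀ d → All (InI (suc i)) d → Flooded (suc i) (map (_, suc i) d)
  flood-broadcast i i<m flooded d d∈ =
    let τ , τ≡ , es , hs = tasks d d∈
        N , c , (ν₀ , l₀ , i₀ , p) , r , cov = flooded (map (λ (h , t) → h , i) τ) (All.map⁺ hs)
        c′ , step , r′ , _ , cov′ , _ = broadcast c τ r es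
          (λ s → subst (_≤ # (conf (i ▸ c)) (s , i)) (sumL-map (λ q → δ q (s , i)) (λ (h , t) → h , i) τ) (cov s))
        target : ∀ s → count (map (_, next i) (map proj₂ τ)) (s , next i) ≡ sumL (λ (h , t) → δ (t , next i) (s , next i)) τ
        target s = trans (sumL-map (λ q → δ q (s , next i)) (_, next i) (map proj₂ τ))
                         (sumL-map (λ t → δ (t , next i) (s , next i)) proj₂ τ)
    in subst (λ d → Flooded (suc i) (map (_, suc i) d)) τ≡
         (subst (λ ℓ → Flooded ℓ (map (_, ℓ) (map proj₂ τ))) (sym (next-unique (inj₁ (i<m , refl))))
           (N , c′ , (ν₀ , l₀ , i₀ , p ++ᴾ step ∷ []) , r′ ,
             λ s → ℕ.≤-trans (ℕ.≤-reflexive (target s)) (cov′ s)))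
    where
    tasks : ∀ d → All (InI (suc i)) d → Σ (List (Fin nSt × Fin nSt)) λ τ → map proj₂ τ ≡ d ×
      All (λ (h , t) → edge h bc t ≡ true) τ × All (λ (h , t) → InS i h) τ
    tasks [] [] = [] , refl , [] , []
    tasks (t ∷ d) ((h , h∈ , e) ∷ d∈) =
      let τ , τ≡ , es , hs = tasks d d∈ in (h , t) ∷ τ , cong (t ∷_) τ≡ , e ∷ es , h∈ ∷ hs

  flood : ∀ ℓ → ℓ ≤ m → ∀ d → All (λ p → InS (proj₂ p) (proj₁ p)) d → Flooded ℓ d
  flood zero    ℓ≤m = flood-level zero ℓ≤m flood-initial
  flood (suc i) i<m = flood-level (suc i) i<m (flood-broadcast i i<m (flood i (ℕ.<⇒≤ i<m)))

  -- Combinatorial cycles and their realisation by closed paths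

  inflow outflow : Var → Vector
  inflow (inj₁ t)  = post t
  inflow (inj₂ b)  = δ (bcTgt b)
  outflow (inj₁ t) = pre t
  outflow (inj₂ b) = δ (bcSrc b)

  Circulation : List Var → Set
  Circulation W = ∀ p → sumL (λ v → inflow v p) W ≡ sumL (λ v → outflow v p) W

  IsVar : Var → Set
  IsVar (inj₁ t) = Enabled t
  IsVar (inj₂ b) = Moves b

  levelOf : Var → ℕ
  levelOf (inj₁ (i , _)) = i
  levelOf (inj₂ (i , _)) = i

  acts : List Var → List Act
  acts []           = []
  acts (inj₁ t ∷ W) = t ∷ acts W
  acts (inj₂ b ∷ W) = acts W

  bcs : List Var → List Bc
  bcs []           = []
  bcs (inj₁ t ∷ W) = bcs W
  bcs (inj₂ b ∷ W) = b ∷ bcs W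

  ∈-acts⁺ : ∀ {t W} → inj₁ t ∈ W → t ∈ acts W
  ∈-acts⁺ {W = inj₁ _ ∷ W} (here refl) = here refl
  ∈-acts⁺ {W = inj₁ _ ∷ W} (there t∈)  = there (∈-acts⁺ t∈)
  ∈-acts⁺ {W = inj₂ _ ∷ W} (there t∈)  = ∈-acts⁺ t∈

  ∈-acts⁻ : ∀ {t} W → t ∈ acts W → inj₁ t ∈ W
  ∈-acts⁻ (inj₁ _ ∷ W) (here refl) = here refl
  ∈-acts⁻ (inj₁ _ ∷ W) (there t∈)  = there (∈-acts⁻ W t∈)
  ∈-acts⁻ (inj₂ _ ∷ W) t∈          = there (∈-acts⁻ W t∈)

  ∈-bcs⁺ : ∀ {b W} → inj₂ b ∈ W → b ∈ bcs W
  ∈-bcs⁺ {W = inj₂ _ ∷ W} (here refl) = here refl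
  ∈-bcs⁺ {W = inj₂ _ ∷ W} (there b∈)  = there (∈-bcs⁺ b∈)
  ∈-bcs⁺ {W = inj₁ _ ∷ W} (there b∈)  = ∈-bcs⁺ b∈

  ∈-bcs⁻ : ∀ {b} W → b ∈ bcs W → inj₂ b ∈ W
  ∈-bcs⁻ (inj₂ _ ∷ W) (here refl) = here refl
  ∈-bcs⁻ (inj₂ _ ∷ W) (there b∈)  = there (∈-bcs⁻ W b∈)
  ∈-bcs⁻ (inj₁ _ ∷ W) b∈          = there (∈-bcs⁻ W b∈)

  sumL-split : ∀ (f : Var → ℕ) W → sumL f W ≡ sumL (f ∘ inj₁) (acts W) + sumL (f ∘ inj₂) (bcs W)
  sumL-split f []           = refl
  sumL-split f (inj₁ t ∷ W) = trans (cong (f (inj₁ t) +_) (sumL-split f W)) (sym (ℕ.+-assoc (f (inj₁ t)) _ _))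
  sumL-split f (inj₂ b ∷ W) = trans (cong (f (inj₂ b) +_) (sumL-split f W))
    (trans (sym (ℕ.+-assoc (f (inj₂ b)) _ _)) (trans (cong (_+ sumL (f ∘ inj₂) (bcs W)) (ℕ.+-comm (f (inj₂ b)) _))
      (ℕ.+-assoc (sumL (f ∘ inj₁) (acts W)) _ _)))

  Circuit : List Var → Var → Set
  Circuit T v = ∃[ W ] (All (_∈ T) W × v ∈ W × Circulation W)

  open DecMembership _≟ᴾ_ using (_∈?_)

  module Forward (T : List Var) =
    Closure _≟ᴾ_ src tgt (_∈ map bcTgt (bcs T)) (_∈? map bcTgt (bcs T)) (acts T)
  module Backward (T : List Var) =
    Closure _≟ᴾ_ tgt src (_∈ map bcSrc (bcs T)) (_∈? map bcSrc (bcs T)) (acts T)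

  -- T is the support of a circulation on which laps with broadcasts can be based: every rendezvous in T
  -- can eventually be enabled starting from the states entered by broadcasts in T, and, backwards in
  -- time, from the states left by broadcasts in T.  Levels below n are excluded because they do not
  -- recur; on the others `next` is injective.
  record Good (T : List Var) : Set where
    field
      vars     : All IsVar T
      high     : All (λ v → n ≤ levelOf v) T
      circuits : All (Circuit T) T
      forward  : All (λ t → ∀ l → Forward.Derivable T (src t l)) (acts T)
      backward : All (λ t → ∀ l → Backward.Derivable T (tgt t l)) (acts T)

  -- Circulations add up, so circuits through the single members combine into one circulation that
  -- uses them all.
  join-circuits : ∀ {T} T′ → All (Circuit T) T′ →
    ∃[ W ] (All (_∈ T) W × All (_∈ W) T′ × Circulation W)
  join-circuits [] [] = [] , [] , [] , λ p → refl
  join-circuits (v ∷ T′) ((V , V∈ , v∈ , circ) ∷ cs) =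
    let W , W∈ , T′∈ , circ′ = join-circuits T′ cs
    in V ++ W , All.++⁺ V∈ W∈ , ∈-++⁺ˡ v∈ ∷ All.map (∈-++⁺ʳ V) T′∈ ,
       λ p → trans (sumL-++ (λ v → inflow v p) V W)
               (trans (cong₂ _+_ (circ p) (circ′ p)) (sym (sumL-++ (λ v → outflow v p) V W)))

  -- The successor of a level from `n` on exceeds `n`, so the wrap from `m` to `n` collides with no
  -- other step. Hence all arrivals at a level come from one level, and a lap can be executed level
  -- by level.
  next-injective : ∀ {i j} → n ≤ i → i ≤ m → n ≤ j → j ≤ m → next i ≡ next j → i ≡ j
  next-injective n≤i i≤m n≤j j≤m e with next-spec i≤m | next-spec j≤m
  ... | inj₁ (_ , e₁) | inj₁ (_ , e₂) = ℕ.suc-injective (trans (sym e₁) (trans e e₂))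
  ... | inj₁ (_ , e₁) | inj₂ (_ , e₂) = ⊥-elim (ℕ.1+n≰n (subst (_≤ _) (sym (trans (sym e₁) (trans e e₂))) n≤i))
  ... | inj₂ (_ , e₁) | inj₁ (_ , e₂) = ⊥-elim (ℕ.1+n≰n (subst (_≤ _) (sym (trans (sym e₂) (trans (sym e) e₁))) n≤j))
  ... | inj₂ (e₁ , _) | inj₂ (e₂ , _) = trans e₁ (sym e₂)

  -- Witnesses that an edge recurs with finitely many broadcasts (F), with infinitely many (B), or in
  -- unbounded bursts between infinitely many (G).
  LassoF LassoB LassoG : Triple → Set
  LassoF ed = ∃[ N ] Σ (Fin (suc N)) λ ρ → Σ (Node N) λ ν → Reachable ν ×
    Σ (Path ν ν) λ p → NoBc p × Occurs ρ ed p
  LassoB ed = ∃[ N ] Σ (Fin (suc N)) λ ρ → Σ (Node N) λ ν → Reachable ν ×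
    Σ (Path ν ν) λ p → HasBc p × Occurs ρ ed p
  LassoG ed = ∃[ N ] Σ (Fin (suc N)) λ ρ → Σ (Node N) λ ν → Reachable ν × Σ (Node N) λ μ →
    Path ν μ × (Σ (Path μ μ) λ p → NoBc p × Occurs ρ ed p) × Σ (Path μ ν) HasBc

  index-injective : ∀ {N} {c d : Code N} → index c ≡ index d → c ≡ d
  index-injective refl = refl

  Quiet : ∀ {N} → ℕ → Code N → Code N → Set
  Quiet ℓ c d = Σ (Path (ℓ ▸ c) (ℓ ▸ d)) NoBc

  QuietLoop : ∀ {N} → Triple → ℕ → Code N → Code N → Set
  QuietLoop {N} ed ℓ c d = Σ (Fin (suc N)) λ ρ → Σ (Path (ℓ ▸ c) (ℓ ▸ d)) λ p → NoBc p × Occurs ρ ed p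

  -- `κ` is balanced and `Z` holds its full reserve, so `κ` fires from `Z` to `Z` and can be
  -- repeated for ever; by pigeonhole a configuration recurs. `κ` may mix levels, as only its part
  -- on `ℓ` is executed.
  quiet-loop : ∀ {N ℓ a h} (κ : List Act) (Z : Vector) → All Enabled κ → (∀ p → postL κ p ≡ preL κ p) →
    (∀ p → length κ * preL κ p ≤ Z p) → (ℓ , a) ∈ κ →
    ∀ (c : Code N) → Reached (ℓ ▸ c) → Covers (ℓ ▸ c) Z →
    ∃[ d ] ((Reached (ℓ ▸ d) × Covers (ℓ ▸ d) Z) × Quiet ℓ c d × QuietLoop (rdzTriple ℓ a h) ℓ d d)
  quiet-loop {N} {ℓ} {a} {h} κ Z en bal le a∈ c r cov =
    Pigeonhole.recur index index-injective (λ c → Reached (ℓ ▸ c) × Covers (ℓ ▸ c) Z) (Quiet ℓ)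
      (QuietLoop (rdzTriple ℓ a h) ℓ) ([] , []) (λ (p , a) (q , b) → p ++ᴾ q , noBc-++ a b)
      (λ (ρ , p , np , _) → p , np)
      (λ (ρ , p , np , o) (q , nq) → ρ , p ++ᴾ q , noBc-++ np nq , occurs-++ˡ o)
      advance c (r , cov)
    where
    fires : Fires Z κ Z
    fires = enabled {D = preL κ} κ Z Z (All.tabulate (λ t∈ p → ∈⇒≤sumL (λ t → pre t p) t∈)) le
      (λ p → cong (Z p +_) (sym (bal p)))
    advance : ∀ c → Reached (ℓ ▸ c) × Covers (ℓ ▸ c) Z →
      ∃[ d ] ((Reached (ℓ ▸ d) × Covers (ℓ ▸ d) Z) × QuietLoop (rdzTriple ℓ a h) ℓ c d)
    advance c (r , cov) =
      let d , p , np , r′ , cov′ , occ = lift ℓ c r cov fires en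
          ρ , o = occ h a∈
      in d , (r′ , cov′) , ρ , p , np , o

  srcs : List Act → List Pl
  srcs []      = []
  srcs (t ∷ κ) = tabulate (src t) ++ srcs κ

  count-tabulate : ∀ {N} (f : Fin N → Pl) p → count (tabulate f) p ≡ # f p
  count-tabulate {zero}  f p = refl
  count-tabulate {suc N} f p = cong (δ (f zero) p +_) (count-tabulate (f ∘ suc) p)

  count-srcs : ∀ κ p → count (srcs κ) p ≡ preL κ p
  count-srcs []      p = refl
  count-srcs (t ∷ κ) p = trans (sumL-++ (λ q → δ q p) (tabulate (src t)) (srcs κ))
    (cong₂ _+_ (count-tabulate (src t) p) (count-srcs κ p))

  InS-srcs : ∀ κ → All Enabled κ → All (λ p → InS (proj₂ p) (proj₁ p)) (srcs κ)
  InS-srcs []      []                  = []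
  InS-srcs (t ∷ κ) ((_ , _ , s∈) ∷ en) = All.++⁺ (All.tabulate⁺ s∈) (InS-srcs κ en)

  lassoF : ∀ {ℓ a h} κ → All Enabled κ → (∀ p → postL κ p ≡ preL κ p) → (ℓ , a) ∈ κ → LassoF (rdzTriple ℓ a h)
  lassoF {ℓ} {a} {h} κ en bal a∈ =
    -- `length κ` copies of all sources are exactly the reserve for firing `κ` in any order.
    let N , c , (ν₀ , l₀ , i₀ , q) , r , cov = flood ℓ (proj₁ (All.lookup en a∈)) (copies (length κ) (srcs κ))
                                        (All-copies (length κ) (InS-srcs κ en))
        d , _ , (q′ , _) , ρ , p , np , o = quiet-loop {h = h} κ (count (copies (length κ) (srcs κ))) en bal
          (λ p → ℕ.≤-reflexive (sym (trans (sumL-copies (λ q → δ q p) (length κ) (srcs κ)) (cong (length κ *_) (count-srcs κ p)))))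
          a∈ c r cov
    in N , ρ , ℓ ▸ d , (ν₀ , l₀ , i₀ , q ++ᴾ q′) , p , np , o

  arrivals departures : List Var → Vector
  arrivals W p   = sumL (λ b → δ (bcTgt b) p) (bcs W)
  departures W p = sumL (λ b → δ (bcSrc b) p) (bcs W)

  -- A lap multiplies the circulation W by G.  Half-way, at Z, every state W uses at a level holds enough
  -- processes to fire any j of its rendezvous there in any order, which makes room for quiet loops.
  record Plan (T : List Var) (j : ℕ) : Set where
    field
      W       : List Var
      W⊆T     : ∀ {v} → v ∈ W → v ∈ T
      T⊆W     : ∀ {v} → v ∈ T → v ∈ W
      isVar   : ∀ {v} → v ∈ T → IsVar v
      isHigh  : ∀ {v} → v ∈ T → n ≤ levelOf v
      G       : ℕ
      κ₁ κ₂   : List Act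
      Z       : Vector
      0<G     : 0 < G
      fires₁  : Fires (G ∙ arrivals W) κ₁ Z
      fires₂  : Fires Z κ₂ (G ∙ departures W)
      rich    : ∀ p → j * preL (acts W) p ≤ Z p
      κ₁⊆     : ∀ {t} → t ∈ κ₁ → t ∈ acts W
      κ₂⊆     : ∀ {t} → t ∈ κ₂ → t ∈ acts W
      ⊆κ₂     : ∀ {t} → t ∈ acts W → t ∈ κ₂

  module _ (T : List Var) (isVar : ∀ {v} → v ∈ T → IsVar v) (isHigh : ∀ {v} → v ∈ T → n ≤ levelOf v)
           (forward : ∀ {t} → t ∈ acts T → ∀ l → Forward.Derivable T (src t l))
           (backward : ∀ {t} → t ∈ acts T → ∀ l → Backward.Derivable T (tgt t l))
           (W : List Var) (W⊆T : ∀ {v} → v ∈ W → v ∈ T) (T⊆W : ∀ {v} → v ∈ T → v ∈ W)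
           (circ : Circulation W) (j : ℕ) where
    private
      X = arrivals W
      Y = departures W

      balance : ∀ p → X p + postL (acts W) p ≡ Y p + preL (acts W) p
      balance p = trans (ℕ.+-comm (X p) _) (trans (sym (sumL-split (λ v → inflow v p) W))
        (trans (circ p) (trans (sumL-split (λ v → outflow v p) W) (ℕ.+-comm _ (Y p)))))

      acts⊆ : ∀ {t} → t ∈ acts W → t ∈ acts T
      acts⊆ t∈ = ∈-acts⁺ (W⊆T (∈-acts⁻ W t∈))

      ⊆acts : ∀ {t} → t ∈ acts T → t ∈ acts W
      ⊆acts t∈ = ∈-acts⁺ (T⊆W (∈-acts⁻ T t∈))

      Multiple : Vector → Vector → Set
      Multiple V u = ∃[ K ] u ≗ K ∙ V

      Multiple-⊕ : ∀ {V u v} → Multiple V u → Multiple V v → Multiple V (u ⊕ v)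
      Multiple-⊕ {V} (K , e) (L , f) = K + L , λ p → trans (cong₂ _+_ (e p) (f p)) (sym (ℕ.*-distribʳ-+ (V p) K L))

      populated : ∀ {f : Bc → Pl} {p} → p ∈ map f (bcs T) → 0 < sumL (λ b → δ (f b) p) (bcs W)
      populated {f} p∈ with ∈-map⁻ f p∈
      ... | b , b∈ , refl = ℕ.≤-trans (ℕ.≤-reflexive (sym (δ-refl (f b))))
                              (∈⇒≤sumL (λ b′ → δ (f b′) (f b)) (∈-bcs⁺ (T⊆W (∈-bcs⁻ T b∈))))

      module FK = Kick (Multiple X) ((λ _ → 0) , 0 , λ _ → refl) Multiple-⊕ (acts T)

      fwd-base : ∀ {p} → p ∈ map bcTgt (bcs T) → FK.Coverable (δ p)
      fwd-base p∈ = X , [] , X , (1 , λ q → sym (ℕ.*-identityˡ (X q))) , done (λ _ → refl) , δ≤ (populated p∈) , []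

      fwd-pre : ∀ {t} → t ∈ acts W → FK.Coverable (pre t)
      fwd-pre {t} t∈ = FK.coverable-# (src t) (λ l →
        FK.coverable-derivable (_∈ map bcTgt (bcs T)) (_∈? map bcTgt (bcs T)) fwd-base (forward (acts⊆ t∈) l))

      fwd : ∃[ K ] ∃[ κ ] ∃[ y ] (Fires (K ∙ X) κ y × preL (acts W) ≤̇ y × All (_∈ acts W) κ)
      fwd =
        let u , κ , v , (K , e) , fs , le , κ∈ = FK.coverable-sumL pre (acts W) fwd-pre
        in K , κ , v , Fires-respˡ e fs , le , All.map ⊆acts κ∈

      module R = Net _≟ᴾ_ tgt src
      module BK = R.Kick (Multiple Y) ((λ _ → 0) , 0 , λ _ → refl) Multiple-⊕ (acts T)

      bwd-base : ∀ {p} → p ∈ map bcSrc (bcs T) → BK.Coverable (δ p)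
      bwd-base p∈ = Y , [] , Y , (1 , λ q → sym (ℕ.*-identityˡ (Y q))) , R.done (λ _ → refl) , δ≤ (populated p∈) , []

      bwd-pre : ∀ {t} → t ∈ acts W → BK.Coverable (pre t)
      -- Backward derivability concerns the targets; one reversed firing of `t` turns them into its
      -- sources, where the reserve is wanted.
      bwd-pre {t} t∈ = BK.coverable-fire (acts⊆ t∈) (BK.coverable-# (tgt t) (λ l →
        BK.coverable-derivable (_∈ map bcSrc (bcs T)) (_∈? map bcSrc (bcs T)) bwd-base (backward (acts⊆ t∈) l)))

      bwd : ∃[ K ] ∃[ κ ] ∃[ y ] (Fires y κ (K ∙ Y) × preL (acts W) ≤̇ y × All (_∈ acts W) κ)
      bwd =
        let u , κ , v , (K , e) , fs , le , κ∈ = BK.coverable-sumL pre (acts W) bwd-pre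
        in K , reverse κ , v , Fires-reverse _≟ᴾ_ src tgt (R.Fires-respˡ e fs) , le ,
           All.map ⊆acts (All.tabulate (λ t∈ → All.lookup κ∈ (Any.reverse⁻ t∈)))

    plan : Plan T j
    plan =
      let G , κ₁ , Z , κ₂ , 0<G , f₁ , f₂ , rich , κ₁∈ , κ₂∈ , ∈κ₂ =
            Continuous.realise _≟ᴾ_ src tgt (acts W) balance fwd bwd j
      in record { W = W ; W⊆T = W⊆T ; T⊆W = T⊆W ; isVar = isVar ; isHigh = isHigh ; G = G ; κ₁ = κ₁ ; κ₂ = κ₂ ; Z = Z
                ; 0<G = 0<G ; fires₁ = f₁ ; fires₂ = f₂ ; rich = rich
                ; κ₁⊆ = All.lookup κ₁∈ ; κ₂⊆ = All.lookup κ₂∈ ; ⊆κ₂ = ∈κ₂ }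

  good⇒plan : ∀ {T} → Good T → ∀ j → Plan T j
  good⇒plan {T} good j =
    let W , W∈ , T∈ , circ = join-circuits T circuits
    in plan T (All.lookup vars) (All.lookup high) (All.lookup forward) (All.lookup backward)
         W (All.lookup W∈) (All.lookup T∈) circ j
    where open Good good

  -- Laps through the levels from `n` to `m`

  module Laps {T : List Var} {j : ℕ} (lapPlan : Plan T j) where
    open Plan lapPlan public

    private
      X = arrivals W
      Y = departures W

      enabledW : ∀ {t} → t ∈ acts W → Enabled t
      enabledW t∈ = isVar (W⊆T (∈-acts⁻ W t∈))

      movesW : ∀ {b} → b ∈ bcs W → Moves b
      movesW b∈ = isVar (W⊆T (∈-bcs⁻ W b∈))

      highW : ∀ {b} → b ∈ bcs W → n ≤ proj₁ b
      highW b∈ = isHigh (W⊆T (∈-bcs⁻ W b∈))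

    -- The same vector describes the moment of arrival on every level, since only its part on `ℓ` is
    -- read.
    Full : ∀ {N} → ℕ → Code N → Set
    Full ℓ c = Reached (ℓ ▸ c) × Covers (ℓ ▸ c) (G ∙ X)

    Mid : ∀ {N} → ℕ → Code N → Set
    Mid ℓ c = Reached (ℓ ▸ c) × Covers (ℓ ▸ c) Z

    ascend : ∀ {N} ℓ (c : Code N) → Full ℓ c → ∃[ d ] (Mid ℓ d × Path (ℓ ▸ c) (ℓ ▸ d))
    ascend ℓ c (r , cov) =
      let d , p , _ , r′ , cov′ , _ = lift ℓ c r cov fires₁ (All.tabulate (enabledW ∘ κ₁⊆)) in d , (r′ , cov′) , p

    -- After `κ₂` the current level holds `G` times the departures of `W`, and `G` copies of the
    -- moves of `W` on this level turn them into `G` times the arrivals on `next ℓ`. These are all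
    -- the arrivals there, because no other level of `W` leads to `next ℓ`.
    descend : ∀ {N} ℓ (c : Code N) → n ≤ ℓ → Mid ℓ c → ∃[ d ] (Full (next ℓ) d ×
      Σ (Path (ℓ ▸ c) (next ℓ ▸ d)) λ p → HasBc p ×
        (∀ {a} h → inj₁ (ℓ , a) ∈ T → ∃[ ρ ] Occurs ρ (rdzTriple ℓ a h) p) ×
        (∀ {s t} → inj₂ (ℓ , s , t) ∈ T → ∃[ ρ ] Occurs ρ (bcTriple (ℓ , s , t)) p))
    descend ℓ c n≤ℓ (r , cov) =
      let d₁ , p , _ , r₁ , cov₁ , occ = lift ℓ c r cov fires₂ (All.tabulate (enabledW ∘ κ₂⊆))
          d₂ , step , r₂ , isbc , cov₂ , observed = broadcast d₁ tasks r₁ tasks-ok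
            (λ s → ℕ.≤-trans (ℕ.≤-reflexive (sources s)) (cov₁ s))
      in d₂ , (r₂ , λ s → ℕ.≤-trans (ℕ.≤-reflexive (sym (targets s (proj₁ r)))) (cov₂ s)) ,
         p ++ᴾ step ∷ [] , hasBc-++ʳ p (here isbc) ,
         (λ h a∈ → let ρ , o = occ h (⊆κ₂ (∈-acts⁺ (T⊆W a∈))) in ρ , occurs-++ˡ o) ,
         (λ b∈ → let ρ , o = observed (task∈ (∈-bcs⁺ (T⊆W b∈))) in ρ , occurs-++ʳ p (here o))
      where
      here? : ∀ (b : Bc) → Dec (proj₁ b ≡ ℓ)
      here? b = proj₁ b ℕ.≟ ℓ
      V = filter here? (bcs W)
      tasks : List (Fin nSt × Fin nSt)
      tasks = copies G (map proj₂ V)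
      tasks-ok : All (λ (s , t) → edge s bc t ≡ true) tasks
      tasks-ok = All-copies G (All.map⁺ (All.tabulate (λ b∈ →
        proj₂ (proj₂ (movesW (proj₁ (∈-filter⁻ here? {xs = bcs W} b∈)))))))
      copies∈ : ∀ {Y : Set} {y : Y} {U g} → 0 < g → y ∈ U → y ∈ copies g U
      copies∈ {g = suc g} _ y∈ = ∈-++⁺ˡ y∈
      task∈ : ∀ {s t} → (ℓ , s , t) ∈ bcs W → (s , t) ∈ tasks
      task∈ b∈ = copies∈ 0<G (∈-map⁺ proj₂ (∈-filter⁺ here? b∈ refl))
      tally : ∀ (f : Fin nSt × Fin nSt → ℕ) (g : Bc → ℕ) → (∀ {b} → b ∈ bcs W → proj₁ b ≡ ℓ → f (proj₂ b) ≡ g b) →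
        (∀ {b} → b ∈ bcs W → proj₁ b ≢ ℓ → g b ≡ 0) → sumL f tasks ≡ G * sumL g (bcs W)
      tally f g same zero′ = trans (sumL-copies f G (map proj₂ V)) (cong (G *_)
        (trans (sumL-map f proj₂ V) (trans
          (sumL-cong V (λ b∈ → let b∈W , e = ∈-filter⁻ here? {xs = bcs W} b∈ in same b∈W e))
          (sym (sumL-filter here? g (bcs W) zero′)))))
      sources : ∀ s → sumL (λ (s′ , t′) → δ (s′ , ℓ) (s , ℓ)) tasks ≡ G * Y (s , ℓ)
      sources s = tally (λ (s′ , t′) → δ (s′ , ℓ) (s , ℓ)) (λ b → δ (bcSrc b) (s , ℓ)) (λ { _ refl → refl })
        (λ {b} _ ne → δ-≢ {bcSrc b} {s , ℓ} (λ e → ne (cong proj₂ e)))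
      targets : ∀ s → ℓ ≤ m → sumL (λ (s′ , t′) → δ (t′ , next ℓ) (s , next ℓ)) tasks ≡ G * X (s , next ℓ)
      targets s ℓ≤m = tally (λ (s′ , t′) → δ (t′ , next ℓ) (s , next ℓ)) (λ b → δ (bcTgt b) (s , next ℓ)) (λ { _ refl → refl })
        (λ {b} b∈ ne → δ-≢ {bcTgt b} {s , next ℓ} (λ e → ne (next-injective (highW b∈) (proj₁ (movesW b∈)) n≤ℓ ℓ≤m (cong proj₂ e))))

    pass : ∀ {N} ℓ (c : Code N) → n ≤ ℓ → Full ℓ c → ∃[ d ] (Full (next ℓ) d × Path (ℓ ▸ c) (next ℓ ▸ d))
    pass ℓ c n≤ℓ full =
      let d₁ , mid , p = ascend ℓ c full
          d₂ , full′ , q , _ = descend ℓ d₁ n≤ℓ mid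
      in d₂ , full′ , p ++ᴾ q

    travel : ∀ {N} d ℓ (c : Code N) → n ≤ ℓ → d + ℓ ≤ m → Full ℓ c →
      ∃[ c′ ] (Full (d + ℓ) c′ × Path (ℓ ▸ c) ((d + ℓ) ▸ c′))
    travel zero    ℓ c n≤ℓ le full = c , full , []
    travel (suc d) ℓ c n≤ℓ le full =
      let c₁ , full₁ , p = travel d ℓ c n≤ℓ (ℕ.<⇒≤ le) full
          c₂ , full₂ , q = pass (d + ℓ) c₁ (ℕ.≤-trans n≤ℓ (ℕ.m≤n+m ℓ d)) full₁
          e = sym (next-unique (inj₁ (le , refl)))
      in c₂ , subst (λ i → Full i c₂) e full₂ , p ++ᴾ subst (λ i → Path ((d + ℓ) ▸ c₁) (i ▸ c₂)) e q

    -- The ascent to `m` is followed by the wrap. Started on `n`, this makes a full additional lap,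
    -- which does no harm.
    home : ∀ {N} ℓ (c : Code N) → n ≤ ℓ → ℓ ≤ m → Full ℓ c → ∃[ d ] (Full n d × Path (ℓ ▸ c) (n ▸ d))
    home ℓ c n≤ℓ ℓ≤m full =
      let c₁ , full₁ , p = subst (λ i → ∃[ c′ ] (Full i c′ × Path (ℓ ▸ c) (i ▸ c′))) (ℕ.m∸n+n≡m ℓ≤m)
                             (travel (m ∸ ℓ) ℓ c n≤ℓ (ℕ.≤-reflexive (ℕ.m∸n+n≡m ℓ≤m)) full)
          c₂ , full₂ , q = pass m c₁ n≤m full₁
          e = sym (next-unique (inj₂ (refl , refl)))
      in c₂ , subst (λ i → Full i c₂) e full₂ , p ++ᴾ subst (λ i → Path (m ▸ c₁) (i ▸ c₂)) e q

    away : ∀ {N} ℓ (c : Code N) → n ≤ ℓ → ℓ ≤ m → Full n c → ∃[ d ] (Full ℓ d × Path (n ▸ c) (ℓ ▸ d))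
    away ℓ c n≤ℓ ℓ≤m full = subst (λ i → ∃[ c′ ] (Full i c′ × Path (n ▸ c) (i ▸ c′))) (ℕ.m∸n+n≡m n≤ℓ)
      (travel (ℓ ∸ n) n c ℕ.≤-refl (ℕ.≤-trans (ℕ.≤-reflexive (ℕ.m∸n+n≡m n≤ℓ)) ℓ≤m) full)

    n≤next : ∀ ℓ → n ≤ ℓ → ℓ ≤ m → n ≤ next ℓ
    n≤next ℓ n≤ℓ ℓ≤m with next-spec ℓ≤m
    ... | inj₁ (_ , e) = subst (n ≤_) (sym e) (ℕ.≤-trans n≤ℓ (ℕ.n≤1+n ℓ))
    ... | inj₂ (_ , e) = ℕ.≤-reflexive (sym e)

    start : Σ ℕ λ N → Σ (Code N) λ c → Reachable (n ▸ c) × Full n c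
    start =
      let N , c , reach , r , cov = flood n n≤m (copies G (map bcTgt (bcs W)))
            (All-copies G (All.map⁺ (All.tabulate (λ b∈ → next-InS (movesW b∈)))))
      in N , c , reach , r , λ s → ℕ.≤-trans (ℕ.≤-reflexive (sym (trans (sumL-copies (λ q → δ q (s , n)) G (map bcTgt (bcs W)))
           (cong (G *_) (sumL-map (λ q → δ q (s , n)) bcTgt (bcs W)))))) (cov s)

    -- `select` finds the edge in the part of a lap that leaves level `ℓ`, so rendezvous and
    -- broadcast edges share the argument. Laps preserve `Full n`, and pigeonhole on level `n`
    -- closes the path.
    lassoB : ∀ {ed ℓ} → n ≤ ℓ → ℓ ≤ m →
      (∀ {N} {c d : Code N} (p : Path (ℓ ▸ c) (next ℓ ▸ d)) →
        (∀ {a} h → inj₁ (ℓ , a) ∈ T → ∃[ ρ ] Occurs ρ (rdzTriple ℓ a h) p) →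
        (∀ {s t} → inj₂ (ℓ , s , t) ∈ T → ∃[ ρ ] Occurs ρ (bcTriple (ℓ , s , t)) p) → ∃[ ρ ] Occurs ρ ed p) →
      LassoB ed
    lassoB {ed} {ℓ} n≤ℓ ℓ≤m select =
      let N , c₀ , (ν₀ , l₀ , i₀ , q) , full₀ = start
          d , _ , q′ , ρ , p , bp , o = Pigeonhole.recur index index-injective (Full n) (λ c d → Path (n ▸ c) (n ▸ d)) (Lap N) [] _++ᴾ_
            (λ (ρ , p , _) → p) (λ (ρ , p , b , o) q → ρ , p ++ᴾ q , hasBc-++ˡ b , occurs-++ˡ o) advance c₀ full₀
      in N , ρ , n ▸ d , (ν₀ , l₀ , i₀ , q ++ᴾ q′) , p , bp , o
      where
      Lap : ∀ N → Code N → Code N → Set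
      Lap N c d = Σ (Fin (suc N)) λ ρ → Σ (Path (n ▸ c) (n ▸ d)) λ p → HasBc p × Occurs ρ ed p
      advance : ∀ {N} (c : Code N) → Full n c → ∃[ d ] (Full n d × Lap N c d)
      advance c full =
        let c₁ , full₁ , p₁ = away ℓ c n≤ℓ ℓ≤m full
            c₂ , mid , p₂ = ascend ℓ c₁ full₁
            c₃ , full₃ , p₃ , b₃ , occ , occ′ = descend ℓ c₂ n≤ℓ mid
            c₄ , full₄ , p₄ = home (next ℓ) c₃ (n≤next ℓ n≤ℓ ℓ≤m) (next≤m ℓ) full₃
            ρ , o = select p₃ occ occ′
        in c₄ , full₄ , ρ , p₁ ++ᴾ p₂ ++ᴾ p₃ ++ᴾ p₄ , hasBc-++ʳ p₁ (hasBc-++ʳ p₂ (hasBc-++ˡ b₃)) ,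
           occurs-++ʳ p₁ (occurs-++ʳ p₂ (occurs-++ˡ o))

    -- The quiet loop is inserted half-way through level `ℓ`, where `Z` has the reserve for `κ`; it
    -- preserves `Z`, so the lap can be completed afterwards.
    lassoG : ∀ {ℓ a h} → n ≤ ℓ → ℓ ≤ m → ∀ κ → All Enabled κ → (∀ p → postL κ p ≡ preL κ p) →
      (∀ p → length κ * preL κ p ≤ Z p) → (ℓ , a) ∈ κ → LassoG (rdzTriple ℓ a h)
    lassoG {ℓ} {a} {h} n≤ℓ ℓ≤m κ en bal le a∈ =
      let N , c₀ , (ν₀ , l₀ , i₀ , q) , full₀ = start
          d , _ , q′ , c₂ , p₁ , (ρ , p₂ , n₂ , o) , p₃ , b₃ = Pigeonhole.recur index index-injective (Full n) (λ c d → Path (n ▸ c) (n ▸ d)) (Lap N) [] _++ᴾ_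
            (λ (μ , p , (_ , p′ , _) , p″ , _) → p ++ᴾ p′ ++ᴾ p″)
            (λ (μ , p , l , p″ , b) q → μ , p , l , p″ ++ᴾ q , hasBc-++ˡ b) advance c₀ full₀
      in N , ρ , n ▸ d , (ν₀ , l₀ , i₀ , q ++ᴾ q′) , ℓ ▸ c₂ , p₁ , (p₂ , n₂ , o) , p₃ , b₃
      where
      Lap : ∀ N → Code N → Code N → Set
      Lap N c d = Σ (Code N) λ g → Path (n ▸ c) (ℓ ▸ g) × QuietLoop (rdzTriple ℓ a h) ℓ g g × Σ (Path (ℓ ▸ g) (n ▸ d)) HasBc
      advance : ∀ {N} (c : Code N) → Full n c → ∃[ d ] (Full n d × Lap N c d)
      advance c full =
        let c₁ , full₁ , p₁ = away ℓ c n≤ℓ ℓ≤m full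
            c₂ , mid , p₂ = ascend ℓ c₁ full₁
            c₃ , mid₃ , (p₃ , _) , loop = quiet-loop {h = h} κ Z en bal le a∈ c₂ (proj₁ mid) (proj₂ mid)
            c₄ , full₄ , p₄ , b₄ , _ = descend ℓ c₃ n≤ℓ mid₃
            c₅ , full₅ , p₅ = home (next ℓ) c₄ (n≤next ℓ n≤ℓ ℓ≤m) (next≤m ℓ) full₄
        in c₅ , full₅ , c₃ , p₁ ++ᴾ p₂ ++ᴾ p₃ , loop , p₄ ++ᴾ p₅ , hasBc-++ˡ b₄

  -- From closed paths to executions and back to times

  edge₁⇒obs : ∀ {N} {f g : Config N} (s : Trans f g) {x} → edge₁ s x → obs zero s ≡ just x
  edge₁⇒obs (bcast _) refl = refl
  edge₁⇒obs (rdzv a ι inj es os) (j , e , refl) with Fin.any? (λ j → ι j Fin.≟ zero)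
  ... | yes (j′ , e′) = cong (λ j → just (_ , rdz a j , _)) (inj j′ j (trans e′ (sym e)))
  ... | no none = ⊥-elim (none (j , e))

  obs⇒edge₁ : ∀ {N} {f g : Config N} (s : Trans f g) {x} → obs zero s ≡ just x → edge₁ s x
  obs⇒edge₁ (bcast _) refl = refl
  obs⇒edge₁ (rdzv a ι inj es os) e with Fin.any? (λ j → ι j Fin.≟ zero) | e
  ... | yes (j , e′) | refl = j , e′ , refl

  obs-bc : ∀ {N} {f g : Config N} ρ (s : Trans f g) → isBc s ≡ true → ∃[ x ] (obs ρ s ≡ just x × label x ≡ bc)
  obs-bc ρ (bcast _) e = _ , refl , refl

  obs-label : ∀ {N} {f g : Config N} ρ (s : Trans f g) {x} → obs ρ s ≡ just x → label x ≡ bc → isBc s ≡ true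
  obs-label ρ (bcast _) e l = refl
  obs-label ρ (rdzv a ι inj es os) e l with Fin.any? (λ j → ι j Fin.≟ ρ)
  obs-label ρ (rdzv a ι inj es os) refl () | yes (j , _)
  obs-label ρ (rdzv a ι inj es os) () l | no _

  module Trace {e : ℕ → Triple} (ex : IsExecution e) where
    run : Run
    run = proj₁ ex
    open Run run public using (N; step) renaming (conf to config; init to start-init)
    σ : ℕ → ℕ
    σ = proj₁ (proj₂ ex)

    O : ℕ → Maybe Triple
    O t = obs zero (step t)

    σ-suc : ∀ i → σ i < σ (suc i)
    σ-suc = proj₁ (proj₂ (proj₂ ex))

    O-σ : ∀ i → O (σ i) ≡ just (e i)
    O-σ i = edge₁⇒obs (step (σ i)) (proj₁ (proj₂ (proj₂ (proj₂ ex))) i)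

    σ-onto : ∀ {t x} → O t ≡ just x → ∃[ i ] (σ i ≡ t × e i ≡ x)
    σ-onto {t} {x} o =
      let i , e≡ = proj₂ (proj₂ (proj₂ (proj₂ ex))) t (x , obs⇒edge₁ (step t) o)
      in i , e≡ , just-injective (trans (sym (O-σ i)) (trans (cong O e≡) o))

    σ-mono : ∀ {i j} → i < j → σ i < σ j
    σ-mono {i} {suc j} (s≤s i≤j) with ℕ.m≤n⇒m<n∨m≡n i≤j
    ... | inj₁ i<j = ℕ.<-trans (σ-mono i<j) (σ-suc j)
    ... | inj₂ refl = σ-suc j

    σ-mono≤ : ∀ {i j} → i ≤ j → σ i ≤ σ j
    σ-mono≤ i≤j with ℕ.m≤n⇒m<n∨m≡n i≤j
    ... | inj₁ i<j = ℕ.<⇒≤ (σ-mono i<j)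
    ... | inj₂ refl = ℕ.≤-refl

    i≤σ : ∀ i → i ≤ σ i
    i≤σ zero    = z≤n
    i≤σ (suc i) = ℕ.≤-trans (s≤s (i≤σ i)) (σ-suc i)

    σ-cancel< : ∀ {i j} → σ i < σ j → i < j
    σ-cancel< {i} {j} lt with i ℕ.<? j
    ... | yes p = p
    ... | no ¬p = ⊥-elim (ℕ.<⇒≱ lt (σ-mono≤ (ℕ.≮⇒≥ ¬p)))

    σ-cancel≤ : ∀ {i j} → σ i ≤ σ j → i ≤ j
    σ-cancel≤ {i} {j} le with i ℕ.≤? j
    ... | yes p = p
    ... | no ¬p = ⊥-elim (ℕ.<⇒≱ (σ-mono (ℕ.≰⇒> ¬p)) le)

    OftenAt : (Triple → Set) → Set
    OftenAt Q = ∀ T → ∃[ t ] (T ≤ t × ∃[ x ] (O t ≡ just x × Q x))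

    often⇒ : ∀ {Q : Triple → Set} → InfOften Q e → OftenAt Q
    often⇒ inf T = let i , T≤i , q = inf T in σ i , ℕ.≤-trans T≤i (i≤σ i) , e i , O-σ i , q

    often⇐ : ∀ {Q : Triple → Set} → OftenAt Q → InfOften Q e
    often⇐ {Q} inf M =
      let t , le , x , o , q = inf (σ M)
          i , σi , ei = σ-onto o
      in i , σ-cancel≤ (subst (σ M ≤_) (sym σi) le) , subst Q (sym ei) q

    -- The number of observed steps before time `T`: it translates time intervals into index
    -- intervals.
    rank : ∀ T → ∃[ i ] ((∀ {j} → j < i → σ j < T) × T ≤ σ i)
    rank zero = 0 , (λ ()) , z≤n
    rank (suc T) =
      let i , below , le = rank T in case i below le (ℕ.m≤n⇒m<n∨m≡n le)
      where
      case : ∀ i → (∀ {j} → j < i → σ j < T) → T ≤ σ i → T < σ i ⊎ T ≡ σ i → ∃[ i ] ((∀ {j} → j < i → σ j < suc T) × suc T ≤ σ i)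
      case i below le (inj₁ lt) = i , (λ j<i → ℕ.≤-trans (below j<i) (ℕ.n≤1+n T)) , lt
      case i below le (inj₂ eq) = suc i , (λ j<1+i → s≤s (subst (σ _ ≤_) (sym eq) (σ-mono≤ (ℕ.≤-pred j<1+i)))) ,
        ℕ.≤-trans (s≤s (ℕ.≤-reflexive eq)) (σ-suc i)

    BurstAt : Triple → ℕ → Set
    BurstAt ed M = ∃[ t₁ ] ∃[ t₂ ] ((∀ t → t₁ ≤ t → t < t₂ → isBc (step t) ≡ false) ×
      Σ (Fin M → ℕ) λ τ → Injective τ × (∀ x → t₁ ≤ τ x × τ x < t₂ × O (τ x) ≡ just ed))

    burst⇐ : ∀ {ed M} → BurstAt ed M → ∃[ i ] ∃[ j ] ((∀ t → i ≤ t → t < j → label (e t) ≢ bc) ×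
         Σ (Fin M → ℕ) λ p → (∀ x y → p x ≡ p y → x ≡ y) × (∀ x → i ≤ p x × p x < j × e (p x) ≡ ed))
    burst⇐ {ed} {M} (t₁ , t₂ , quiet , τ , inj , at) = i , j , quiet′ , p , p-inj , p-at
      where
      i = proj₁ (rank t₁)
      j = proj₁ (rank t₂)
      above : ∀ {T x} → T ≤ σ x → proj₁ (rank T) ≤ x
      above {T} {x} le with proj₁ (rank T) ℕ.≤? x
      ... | yes q = q
      ... | no ¬q = ⊥-elim (ℕ.<⇒≱ (proj₁ (proj₂ (rank T)) (ℕ.≰⇒> ¬q)) le)
      below : ∀ {T x} → σ x < T → x < proj₁ (rank T)
      below {T} lt = σ-cancel< (ℕ.≤-trans lt (proj₂ (proj₂ (rank T))))
      quiet′ : ∀ t → i ≤ t → t < j → label (e t) ≢ bc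
      quiet′ t i≤t t<j l
        with trans (sym (quiet (σ t) (ℕ.≤-trans (proj₂ (proj₂ (rank t₁))) (σ-mono≤ i≤t)) (proj₁ (proj₂ (rank t₂)) t<j)))
                   (obs-label zero (step (σ t)) (O-σ t) l)
      ... | ()
      hit : ∀ x → ∃[ i ] (σ i ≡ τ x × e i ≡ ed)
      hit x = σ-onto (proj₂ (proj₂ (at x)))
      p : Fin M → ℕ
      p x = proj₁ (hit x)
      σp : ∀ x → σ (p x) ≡ τ x
      σp x = proj₁ (proj₂ (hit x))
      p-inj : ∀ x y → p x ≡ p y → x ≡ y
      p-inj x y eq = inj x y (trans (sym (σp x)) (trans (cong σ eq) (σp y)))
      p-at : ∀ x → i ≤ p x × p x < j × e (p x) ≡ ed
      p-at x = above (subst (t₁ ≤_) (sym (σp x)) (proj₁ (at x))) ,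
               below (subst (_< t₂) (sym (σp x)) (proj₁ (proj₂ (at x)))) , proj₂ (proj₂ (hit x))

  permute : ∀ {N} {f g : Config N} (π : Fin (suc N) → Fin (suc N)) → (∀ i → π (π i) ≡ i) →
    Trans f g → Trans (f ∘ π) (g ∘ π)
  permute π inv (bcast es) = bcast (es ∘ π)
  permute {f = f} {g} π inv (rdzv a ι inj es os) = rdzv a (π ∘ ι)
    (λ j j′ e → inj j j′ (trans (sym (inv (ι j))) (trans (cong π e) (inv (ι j′)))))
    (λ j → subst (λ i → UEdge m n (f i) (rdz a j) (g i)) (sym (inv (ι j))) (es j))
    (λ i ne → os (π i) (λ j e → ne j (trans (cong π e) (inv i))))

  obs-permute : ∀ {N} {f g : Config N} π inv (s : Trans f g) → obs zero (permute π inv s) ≡ obs (π zero) s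
  obs-permute π inv (bcast es) = refl
  obs-permute π inv (rdzv a ι inj es os)
    with Fin.any? (λ j → π (ι j) Fin.≟ zero) | Fin.any? (λ j → ι j Fin.≟ π zero)
  ... | yes (j , e) | yes (j′ , e′) = cong (λ j → just (_ , rdz a j , _))
        (inj j j′ (trans (trans (sym (inv (ι j))) (cong π e)) (sym e′)))
  ... | yes (j , e) | no none = ⊥-elim (none (j , trans (sym (inv (ι j))) (cong π e)))
  ... | no none | yes (j , e) = ⊥-elim (none (j , trans (cong π e) (inv zero)))
  ... | no _ | no _ = refl

  isBc-permute : ∀ {N} {f g : Config N} π inv (s : Trans f g) → isBc (permute π inv s) ≡ isBc s
  isBc-permute π inv (bcast es) = refl
  isBc-permute π inv (rdzv _ _ _ _ _) = refl

  data Nonempty {N : ℕ} : ∀ {ν μ : Node N} → Path ν μ → Set where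
    cons : ∀ {ν μ ξ} {s : Step ν μ} {p : Path μ ξ} → Nonempty (s ∷ p)

  uncons : ∀ {N} {ν μ : Node N} {p : Path ν μ} → Nonempty p → Σ (Node N) λ ξ → Step ν ξ × Path ξ μ
  uncons (cons {μ = ξ} {s = s} {p}) = ξ , s , p

  occurs⇒nonempty : ∀ {N ρ ed} {ν μ : Node N} {p : Path ν μ} → Occurs ρ ed p → Nonempty p
  occurs⇒nonempty (here _)  = cons
  occurs⇒nonempty (there _) = cons

  hasBc⇒nonempty : ∀ {N} {ν μ : Node N} {p : Path ν μ} → HasBc p → Nonempty p
  hasBc⇒nonempty (here _)  = cons
  hasBc⇒nonempty (there _) = cons

  len : ∀ {N} {ν μ : Node N} → Path ν μ → ℕ
  len []      = 0
  len (s ∷ p) = suc (len p)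

  -- Runs made of infinitely many closed segments

  module Concatenation {N : ℕ} {ν : Node N} (reach : Reachable ν) (seg : ℕ → Path ν ν)
                       (nonempty : ∀ j → Nonempty (seg j)) (ρ : Fin (suc N)) where
    private
      ν₀ = proj₁ reach
      prefix = proj₂ (proj₂ (proj₂ reach))

    -- Besides the current node: the unread part of the current segment and the index of the next
    -- one.
    State : Set
    State = Σ (Node N) λ h → Path h ν × ℕ

    nextState : State → State
    nextState (h , s ∷ p , j) = _ , p , j
    -- Every moment of a run must be a step, so an exhausted segment is left by taking the first
    -- step of the next one at once; hence segments must be nonempty.
    nextState (h , [] , j)    = let ξ , s , p = uncons (nonempty j) in ξ , p , suc j

    stepOf : ∀ S → Step (proj₁ S) (proj₁ (nextState S))
    stepOf (h , s ∷ p , j) = s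
    stepOf (h , [] , j)    = proj₁ (proj₂ (uncons (nonempty j)))

    AnyStep : Set
    AnyStep = Σ (Node N) λ h → Σ (Node N) λ g → Step h g

    anyStep : State → AnyStep
    anyStep S = proj₁ S , proj₁ (nextState S) , stepOf S

    st : ℕ → State
    st zero    = ν₀ , prefix , 0
    st (suc t) = nextState (st t)

    open Transposition ρ

    run : Run
    run = record
      { N    = N
      ; conf = λ t → conf (proj₁ (st t)) ∘ swap₀
      ; init = λ i → proj₁ (proj₂ (proj₂ reach)) (swap₀ i) , proj₁ (proj₂ reach)
      ; step = λ t → permute swap₀ swap₀-involutive (stepOf (st t))
      }

    obs-run : ∀ t → obs zero (Run.step run t) ≡ obs ρ (stepOf (st t))
    obs-run t = obs-permute swap₀ swap₀-involutive (stepOf (st t))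

    isBc-run : ∀ t → isBc (Run.step run t) ≡ isBc (stepOf (st t))
    isBc-run t = isBc-permute swap₀ swap₀-involutive (stepOf (st t))

    Reads : ∀ {h μ} → ℕ → Path h μ → Set
    Reads t []      = ⊤
    Reads t (s ∷ p) = anyStep (st t) ≡ (_ , _ , s) × Reads (suc t) p

    exhaust : ∀ {h j} (p : Path h ν) t → st t ≡ (h , p , j) → Reads t p × st (len p + t) ≡ (ν , [] , j)
    exhaust []      t e = tt , e
    exhaust {j = j} (s ∷ p) t e =
      let rs , e′ = exhaust p (suc t) (cong nextState e)
      in (cong anyStep e , rs) , trans (cong st (sym (ℕ.+-suc (len p) t))) e′

    segment : ∀ {j} t → st t ≡ (ν , [] , j) → Reads t (seg j) × st (len (seg j) + t) ≡ (ν , [] , suc j)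
    segment {j} t e = go (seg j) (nonempty j) refl
      where
      -- `nextState` inspects the given proof `nonempty j`; the equation links it to the one matched
      -- on here.
      go : (p : Path ν ν) (ne : Nonempty p) → uncons (nonempty j) ≡ uncons ne →
        Reads t p × st (len p + t) ≡ (ν , [] , suc j)
      go (s ∷ p) cons eq =
        let rs , e′ = exhaust p (suc t) (trans (cong nextState e) (cong (λ (ξ , s , p) → ξ , p , suc j) eq))
        in (trans (cong anyStep e) (cong (λ (ξ , s , p) → ν , ξ , s) eq) , rs) ,
           trans (cong st (sym (ℕ.+-suc (len p) t))) e′

    begin : ∀ j → ∃[ t ] (j ≤ t × st t ≡ (ν , [] , j))
    begin zero    = len prefix + 0 , z≤n , proj₂ (exhaust prefix 0 refl)
    begin (suc j) =
      let t , le , e = begin j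
      in len (seg j) + t , longer (nonempty j) le , proj₂ (segment t e)
      where
      longer : ∀ {p : Path ν ν} {t} → Nonempty p → j ≤ t → suc j ≤ len p + t
      longer {t = t} (cons {p = p}) le = s≤s (ℕ.≤-trans le (ℕ.m≤n+m t (len p)))

    reads : ∀ j → ∃[ t ] (j ≤ t × Reads t (seg j))
    reads j = let t , le , e = begin j in t , le , proj₁ (segment t e)

    private
      stepObs : AnyStep → Maybe Triple
      stepObs (_ , _ , s) = obs ρ s
      stepBc : AnyStep → Bool
      stepBc (_ , _ , s) = isBc s

    reads-++ : ∀ {h μ ξ} t (p : Path h μ) {q : Path μ ξ} → Reads t (p ++ᴾ q) → Reads t p × Reads (len p + t) q
    reads-++ t []      r        = tt , r
    reads-++ t (s ∷ p) {q} (e , r) =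
      let a , b = reads-++ (suc t) p r in (e , a) , subst (λ u → Reads u q) (ℕ.+-suc (len p) t) b

    reads-occurs : ∀ {h μ ed} t {p : Path h μ} → Reads t p → Occurs ρ ed p →
      ∃[ u ] (t ≤ u × u < len p + t × obs zero (Run.step run u) ≡ just ed)
    reads-occurs t {s ∷ p} (e , r) (here o) =
      t , ℕ.≤-refl , s≤s (ℕ.m≤n+m t (len p)) , trans (obs-run t) (trans (cong stepObs e) o)
    reads-occurs t {s ∷ p} (e , r) (there o) =
      let u , le , lt , eq = reads-occurs (suc t) r o
      in u , ℕ.<⇒≤ le , subst (u <_) (ℕ.+-suc (len p) t) lt , eq

    reads-hasBc : ∀ {h μ} t {p : Path h μ} → Reads t p → HasBc p → ∃[ u ] (t ≤ u × isBc (Run.step run u) ≡ true)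
    reads-hasBc t {s ∷ p} (e , r) (here o) = t , ℕ.≤-refl , trans (isBc-run t) (trans (cong stepBc e) o)
    reads-hasBc t {s ∷ p} (e , r) (there o) =
      let u , le , eq = reads-hasBc (suc t) r o in u , ℕ.<⇒≤ le , eq

    reads-noBc : ∀ {h μ} t {p : Path h μ} → Reads t p → NoBc p →
      ∀ u → t ≤ u → u < len p + t → isBc (Run.step run u) ≡ false
    reads-noBc t {p = []} _ [] u le lt = ⊥-elim (ℕ.<⇒≱ lt le)
    reads-noBc t {p = s ∷ p} (e , r) (b ∷ nb) u le lt with ℕ.m≤n⇒m<n∨m≡n le
    ... | inj₁ t<u = reads-noBc (suc t) r nb u t<u (subst (u <_) (sym (ℕ.+-suc (len p) t)) lt)
    ... | inj₂ refl = trans (isBc-run t) (trans (cong stepBc e) b)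

    quiet-after : (∀ j → NoBc (seg j)) → ∃[ T ] (∀ t → T ≤ t → isBc (Run.step run t) ≡ false)
    quiet-after quiet =
      let T , _ , e = begin 0 in T , λ t le →
        trans (isBc-run t) (quiet-step (st t) (subst (λ u → NoBc (proj₁ (proj₂ (st u)))) (ℕ.m∸n+n≡m le) (inv T e (t ∸ T))))
      where
      quiet-step : ∀ S → NoBc (proj₁ (proj₂ S)) → isBc (stepOf S) ≡ false
      quiet-step (h , s ∷ p , j) (b ∷ nb) = b
      quiet-step (h , [] , j)    []       = go (nonempty j) (quiet j)
        where
        go : {p : Path ν ν} (ne : Nonempty p) → NoBc p → isBc (proj₁ (proj₂ (uncons ne))) ≡ false
        go cons (b ∷ _) = b
      quiet-next : ∀ S → NoBc (proj₁ (proj₂ S)) → NoBc (proj₁ (proj₂ (nextState S)))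
      quiet-next (h , s ∷ p , j) (b ∷ nb) = nb
      quiet-next (h , [] , j)    []       = go (nonempty j) (quiet j)
        where
        go : {p : Path ν ν} (ne : Nonempty p) → NoBc p → NoBc (proj₂ (proj₂ (uncons ne)))
        go cons (_ ∷ nb) = nb
      inv : ∀ T → st T ≡ (ν , [] , 0) → ∀ d → NoBc (proj₁ (proj₂ (st (d + T))))
      inv T e zero    = subst (λ S → NoBc (proj₁ (proj₂ S))) (sym e) []
      inv T e (suc d) = quiet-next (st (d + T)) (inv T e d)

    often-occurs : ∀ {ed} → (∀ j → Occurs ρ ed (seg j)) → ∀ T → ∃[ t ] (T ≤ t × ∃[ x ] (obs zero (Run.step run t) ≡ just x × x ≡ ed))
    often-occurs o T =
      let t , le , r = reads T
          u , le′ , _ , e = reads-occurs t r (o T)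
      in u , ℕ.≤-trans le le′ , _ , e , refl

    often-bc : (∀ j → HasBc (seg j)) → ∀ T → ∃[ t ] (T ≤ t × ∃[ x ] (obs zero (Run.step run t) ≡ just x × label x ≡ bc))
    often-bc o T =
      let t , le , r = reads T
          u , le′ , e = reads-hasBc t r (o T)
      in u , ℕ.≤-trans le le′ , obs-bc zero (Run.step run u) e

  HasF HasB : Triple → Set
  HasF ed = ∃[ e ] (IsExecution e × ¬ InfBcast e × InfOften (_≡ ed) e)
  HasB ed = ∃[ e ] (IsExecution e × InfBcast e × InfOften (_≡ ed) e)

  observe : Run → ℕ → Maybe Triple
  observe r t = obs zero (Run.step r t)

  execution : ∀ r (en : Enumeration (observe r)) → IsExecution (Enumeration.value en)
  execution r en = r , σ , σ-suc , (λ i → obs⇒edge₁ (Run.step r (σ i)) (at i)) ,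
    λ t (x , ed) → onto (edge₁⇒obs (Run.step r t) ed)
    where open Enumeration en

  OftenIn : Run → (Triple → Set) → Set
  OftenIn r Q = ∀ T → ∃[ t ] (T ≤ t × ∃[ x ] (observe r t ≡ just x × Q x))

  often⇒enumeration : ∀ {Q} r → OftenIn r Q → Enumeration (observe r)
  often⇒enumeration r often = enumerate (observe r) λ T → let t , le , x , e , _ = often T in t , le , x , e

  infOften : ∀ {Q} r (en : Enumeration (observe r)) → OftenIn r Q → InfOften Q (Enumeration.value en)
  infOften r en = Trace.often⇐ (execution r en)

  runF : ∀ {ed} r → Enumeration (observe r) → OftenIn r (_≡ ed) →
    ∃[ T ] (∀ t → T ≤ t → isBc (Run.step r t) ≡ false) → HasF ed
  runF {ed} r en often (T , quiet) = Enumeration.value en , execution r en , finitely , infOften r en often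
    where
    absurd : (∃[ t ] (T ≤ t × ∃[ x ] (observe r t ≡ just x × label x ≡ bc))) → ⊥
    absurd (t , le , x , e , l) with trans (sym (quiet t le)) (obs-label zero (Run.step r t) e l)
    ... | ()
    finitely : ¬ InfBcast (Enumeration.value en)
    finitely inf = absurd (Trace.often⇒ (execution r en) {λ x → label x ≡ bc} inf T)

  runB : ∀ {ed} r → Enumeration (observe r) → OftenIn r (_≡ ed) → OftenIn r (λ x → label x ≡ bc) → HasB ed
  runB r en often often-bc = Enumeration.value en , execution r en , infOften r en often-bc , infOften r en often

  BurstIn : Run → Triple → ℕ → Set
  BurstIn r ed M = ∃[ t₁ ] ∃[ t₂ ] ((∀ t → t₁ ≤ t → t < t₂ → isBc (Run.step r t) ≡ false) ×
    Σ (Fin M → ℕ) λ τ → Injective τ × (∀ x → t₁ ≤ τ x × τ x < t₂ × observe r (τ x) ≡ just ed))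

  runG : ∀ {ed} r → Enumeration (observe r) → OftenIn r (λ x → label x ≡ bc) → (∀ M → BurstIn r ed M) → Green ed
  runG r en often-bc burst = Enumeration.value en , execution r en , infOften r en often-bc ,
    λ M → Trace.burst⇐ (execution r en) (burst M)

  lassoF⇒ : ∀ {ed} → LassoF ed → HasF ed
  lassoF⇒ (N , ρ , ν , reach , p , np , o) = runF run (often⇒enumeration run often) often (quiet-after (λ _ → np))
    where
    open Concatenation reach (λ _ → p) (λ _ → occurs⇒nonempty o) ρ
    often = often-occurs (λ _ → o)

  lassoB⇒ : ∀ {ed} → LassoB ed → HasB ed
  lassoB⇒ (N , ρ , ν , reach , p , bp , o) = runB run (often⇒enumeration run often) often (often-bc (λ _ → bp))
    where
    open Concatenation reach (λ _ → p) (λ _ → occurs⇒nonempty o) ρ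
    often = often-occurs (λ _ → o)

  iterate : ∀ {N} {μ ξ : Node N} → Path μ μ → ℕ → Path μ ξ → Path μ ξ
  iterate l zero    q = q
  iterate l (suc j) q = l ++ᴾ iterate l j q

  lassoG⇒ : ∀ {ed} → LassoG ed → Green ed
  lassoG⇒ {ed} (N , ρ , ν , reach , μ , p , (l , nl , o) , q , bq) =
    runG run (often⇒enumeration run (often-bc bcs′)) (often-bc bcs′) burst
    where
    -- Segment `j` runs the loop `j` times, so bursts of every size occur, while `q` still
    -- contributes a broadcast to each segment.
    seg : ℕ → Path ν ν
    seg j = p ++ᴾ iterate l j q
    bc-iterate : ∀ j → HasBc (iterate l j q)
    bc-iterate zero    = bq
    bc-iterate (suc j) = hasBc-++ʳ l (bc-iterate j)
    bcs′ : ∀ j → HasBc (seg j)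
    bcs′ j = hasBc-++ʳ p (bc-iterate j)
    open Concatenation reach seg (hasBc⇒nonempty ∘ bcs′) ρ
    loops : ∀ M t → Reads t (iterate l M q) → ∃[ t₂ ] (t ≤ t₂ × (∀ u → t ≤ u → u < t₂ → isBc (Run.step run u) ≡ false) ×
      Σ (Fin M → ℕ) λ τ → Injective τ × (∀ x → t ≤ τ x × τ x < t₂ × obs zero (Run.step run (τ x)) ≡ just ed))
    loops zero    t r = t , ℕ.≤-refl , (λ u le lt → ⊥-elim (ℕ.<⇒≱ lt le)) , (λ ()) , (λ ()) , λ ()
    loops (suc M) t r =
      let r₁ , r₂ = reads-++ t l r
          u₀ , le₀ , lt₀ , e₀ = reads-occurs t r₁ o
          t₂ , le₂ , quiet , τ , inj , at = loops M (len l + t) r₂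
      in extend u₀ le₀ lt₀ e₀ t₂ le₂ (reads-noBc t r₁ nl) quiet τ inj at
      where
      t′ = len l + t
      extend : ∀ u₀ → t ≤ u₀ → u₀ < t′ → obs zero (Run.step run u₀) ≡ just ed → ∀ t₂ → t′ ≤ t₂ →
        (∀ u → t ≤ u → u < t′ → isBc (Run.step run u) ≡ false) →
        (∀ u → t′ ≤ u → u < t₂ → isBc (Run.step run u) ≡ false) →
        (τ : Fin M → ℕ) → Injective τ → (∀ x → t′ ≤ τ x × τ x < t₂ × obs zero (Run.step run (τ x)) ≡ just ed) →
        ∃[ t₂ ] (t ≤ t₂ × (∀ u → t ≤ u → u < t₂ → isBc (Run.step run u) ≡ false) ×
          Σ (Fin (suc M) → ℕ) λ τ → Injective τ × (∀ x → t ≤ τ x × τ x < t₂ × obs zero (Run.step run (τ x)) ≡ just ed))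
      extend u₀ le₀ lt₀ e₀ t₂ le₂ q₁ q₂ τ inj at = t₂ , ℕ.≤-trans t≤t′ le₂ , quiet , τ′ , inj′ , at′
        where
        t≤t′ : t ≤ t′
        t≤t′ = ℕ.m≤n+m t (len l)
        quiet : ∀ u → t ≤ u → u < t₂ → isBc (Run.step run u) ≡ false
        quiet u le lt with u ℕ.<? t′
        ... | yes u<t′ = q₁ u le u<t′
        ... | no u≮t′ = q₂ u (ℕ.≮⇒≥ u≮t′) lt
        τ′ : Fin (suc M) → ℕ
        τ′ zero    = u₀
        τ′ (suc x) = τ x
        inj′ : Injective τ′
        inj′ zero    zero    _ = refl
        inj′ zero    (suc y) e = ⊥-elim (ℕ.<⇒≱ lt₀ (subst (t′ ≤_) (sym e) (proj₁ (at y))))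
        inj′ (suc x) zero    e = ⊥-elim (ℕ.<⇒≱ lt₀ (subst (t′ ≤_) e (proj₁ (at x))))
        inj′ (suc x) (suc y) e = cong suc (inj x y e)
        at′ : ∀ x → t ≤ τ′ x × τ′ x < t₂ × obs zero (Run.step run (τ′ x)) ≡ just ed
        at′ zero    = le₀ , ℕ.≤-trans lt₀ le₂ , e₀
        at′ (suc x) = ℕ.≤-trans t≤t′ (proj₁ (at x)) , proj₂ (at x)
    burst : ∀ M → BurstIn run ed M
    burst M =
      let t , _ , r = reads M
          r₁ , r₂ = reads-++ t p r
          t₂ , _ , quiet , τ , inj , at = loops M (len p + t) r₂
      in len p + t , t₂ , quiet , τ , inj , at

  -- Counting along a run

  edgeVar : Triple → Var
  edgeVar ((s , i) , rdz a h , _) = inj₁ (i , a)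
  edgeVar ((s , i) , bc , (t , _)) = inj₂ (i , s , t)

  -- Since `k` is positive, some process takes part in each rendezvous; its edge shows that the
  -- level is at most `m` and the action enabled.
  leg₀ : Fin k
  leg₀ = fromℕ< 1≤k

  module _ {N : ℕ} {f g : Config N} where

    after : Trans f g → ℕ → ℕ
    after (bcast _) ℓ = next ℓ
    after (rdzv _ _ _ _ _) ℓ = ℓ

    moves : ℕ → Fin (suc N) → Var
    moves ℓ i = inj₂ (ℓ , proj₁ (f i) , proj₁ (g i))

    varsOf : Trans f g → ℕ → List Var
    varsOf (bcast _) ℓ = tabulate (moves ℓ)
    varsOf (rdzv a _ _ _ _) ℓ = inj₁ (ℓ , a) ∷ []

    module _ {ℓ : ℕ} (uniform : ∀ i → proj₂ (f i) ≡ ℓ) where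

      step≤m : Trans f g → ℓ ≤ m
      step≤m (bcast es) = subst (_≤ m) (uniform zero) (proj₁ (es zero))
      step≤m (rdzv a ι inj es os) = subst (_≤ m) (uniform (ι leg₀)) (proj₁ (proj₂ (es leg₀)))

      after-level : (s : Trans f g) → ∀ i → proj₂ (g i) ≡ after s ℓ
      after-level (bcast es) i = trans (next-unique (proj₂ (proj₂ (proj₂ (es i))))) (cong next (uniform i))
      after-level (rdzv a ι inj es os) i with Fin.any? (λ j → ι j Fin.≟ i)
      ... | yes (j , refl) = trans (sym (proj₁ (es j))) (uniform i)
      ... | no none = trans (cong proj₂ (os i (λ j e → none (j , e)))) (uniform i)

      rdz-edge : ∀ {a} (x y : Pl) j → proj₂ x ≡ ℓ → UEdge m n x (rdz a j) y →
        Enabled (ℓ , a) × x ≡ src (ℓ , a) j × y ≡ tgt (ℓ , a) j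
      rdz-edge (s , .ℓ) (t , .ℓ) j refl (refl , ℓ≤m , inR) =
        let en , e₁ , e₂ = InR⇒enabled ℓ≤m inR in en , cong (_, ℓ) e₁ , cong (_, ℓ) e₂

      bc-edge : (x y : Pl) → proj₂ x ≡ ℓ → UEdge m n x bc y →
        Moves (ℓ , proj₁ x , proj₁ y) × x ≡ (proj₁ x , ℓ) × y ≡ (proj₁ y , next ℓ)
      bc-edge (s , .ℓ) (t , j) refl (ℓ≤m , s∈ , e , nx) = (ℓ≤m , s∈ , e) , refl , cong (t ,_) (next-unique nx)

      vars-ok : (s : Trans f g) → All (λ v → IsVar v × levelOf v ≡ ℓ) (varsOf s ℓ)
      vars-ok (bcast es) = All.tabulate⁺ {f = moves ℓ} (λ i → proj₁ (bc-edge (f i) (g i) (uniform i) (es i)) , refl)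
      vars-ok (rdzv a ι inj es os) =
        (proj₁ (rdz-edge (f (ι leg₀)) (g (ι leg₀)) leg₀ (uniform (ι leg₀)) (es leg₀)) , refl) ∷ []

      flow : (s : Trans f g) → ∀ p → # g p + sumL (λ v → outflow v p) (varsOf s ℓ) ≡ # f p + sumL (λ v → inflow v p) (varsOf s ℓ)
      flow (bcast es) p = trans (cong (# g p +_) (trans (sumL-tabulate (λ v → outflow v p) (moves ℓ)) (#-cong src≡ p)))
        (trans (ℕ.+-comm (# g p) (# f p)) (cong (# f p +_) (sym (trans (sumL-tabulate (λ v → inflow v p) (moves ℓ)) (#-cong tgt≡ p)))))
        where
        src≡ : ∀ i → (proj₁ (f i) , ℓ) ≡ f i
        src≡ i = sym (proj₁ (proj₂ (bc-edge (f i) (g i) (uniform i) (es i))))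
        tgt≡ : ∀ i → (proj₁ (g i) , next ℓ) ≡ g i
        tgt≡ i = sym (proj₂ (proj₂ (bc-edge (f i) (g i) (uniform i) (es i))))
        sumL-tabulate : ∀ {M} (h : Var → ℕ) (v : Fin M → Var) → sumL h (tabulate v) ≡ sum (h ∘ v)
        sumL-tabulate {zero}  h v = refl
        sumL-tabulate {suc M} h v = cong (h (v zero) +_) (sumL-tabulate h (v ∘ suc))
      flow (rdzv a ι inj es os) p = trans (cong (# g p +_) (ℕ.+-identityʳ _))
        (trans (cong (# g p +_) (#-cong (λ j → sym (proj₁ (proj₂ (legs j)))) p))
          (trans (#-exchange inj f g os p)
            (cong (# f p +_) (trans (#-cong (λ j → proj₂ (proj₂ (legs j))) p) (sym (ℕ.+-identityʳ _))))))
        where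
        legs : ∀ j → Enabled (ℓ , a) × f (ι j) ≡ src (ℓ , a) j × g (ι j) ≡ tgt (ℓ , a) j
        legs j = rdz-edge (f (ι j)) (g (ι j)) j (uniform (ι j)) (es j)

      obs⇒var : (s : Trans f g) → ∀ {ed} → obs zero s ≡ just ed → edgeVar ed ∈ varsOf s ℓ
      obs⇒var (bcast es) refl = subst (λ i → inj₂ (i , proj₁ (f zero) , proj₁ (g zero)) ∈ tabulate (moves ℓ)) (sym (uniform zero)) (here refl)
      obs⇒var (rdzv a ι inj es os) e with Fin.any? (λ j → ι j Fin.≟ zero) | e
      ... | yes _ | refl = here (cong (λ i → inj₁ (i , a)) (uniform zero))

      -- In a broadcast every process moves, so all states before it are left and all states after
      -- it are entered by moves in `T`. Derivability starts here in both directions.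
      bc-initial : ∀ {T} (s : Trans f g) → isBc s ≡ true → All (_∈ T) (varsOf s ℓ) →
        (∀ i → Forward.Derivable T (g i)) × (∀ i → Backward.Derivable T (f i))
      bc-initial {T} (bcast es) _ v∈ =
        (λ i → subst (Forward.Derivable T) (sym (proj₂ (proj₂ (bc-edge (f i) (g i) (uniform i) (es i)))))
          (Closure.base (∈-map⁺ bcTgt (∈-bcs⁺ (All.lookup v∈ (∈-tabulate⁺ {f = moves ℓ} i)))))) ,
        (λ i → subst (Backward.Derivable T) (sym (proj₁ (proj₂ (bc-edge (f i) (g i) (uniform i) (es i)))))
          (Closure.base (∈-map⁺ bcSrc (∈-bcs⁺ (All.lookup v∈ (∈-tabulate⁺ {f = moves ℓ} i))))))

      bc-acts : (s : Trans f g) → isBc s ≡ true → ∀ {t} → ¬ (inj₁ t ∈ varsOf s ℓ)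
      bc-acts (bcast es) _ t∈ with ∈-tabulate⁻ {f = moves ℓ} t∈
      ... | i , ()

      forward-step : ∀ {T} (s : Trans f g) → All (_∈ T) (varsOf s ℓ) → (∀ i → Forward.Derivable T (f i)) →
        (∀ i → Forward.Derivable T (g i)) × (∀ {t} → inj₁ t ∈ varsOf s ℓ → ∀ l → Forward.Derivable T (src t l))
      forward-step s@(bcast _) v∈ _ = proj₁ (bc-initial s refl v∈) , λ t∈ → ⊥-elim (bc-acts s refl t∈)
      forward-step {T} (rdzv a ι inj es os) (v∈ ∷ []) d = dg , λ { (here refl) l → sources l }
        where
        legs : ∀ j → Enabled (ℓ , a) × f (ι j) ≡ src (ℓ , a) j × g (ι j) ≡ tgt (ℓ , a) j
        legs j = rdz-edge (f (ι j)) (g (ι j)) j (uniform (ι j)) (es j)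
        sources : ∀ l → Forward.Derivable T (src (ℓ , a) l)
        sources l = subst (Forward.Derivable T) (proj₁ (proj₂ (legs l))) (d (ι l))
        dg : ∀ i → Forward.Derivable T (g i)
        dg i with Fin.any? (λ j → ι j Fin.≟ i)
        ... | yes (j , refl) = subst (Forward.Derivable T) (sym (proj₂ (proj₂ (legs j)))) (Closure.rule (∈-acts⁺ v∈) sources j)
        ... | no none = subst (Forward.Derivable T) (sym (os i (λ j e → none (j , e)))) (d i)

      backward-step : ∀ {T} (s : Trans f g) → All (_∈ T) (varsOf s ℓ) → (∀ i → Backward.Derivable T (g i)) →
        (∀ i → Backward.Derivable T (f i)) × (∀ {t} → inj₁ t ∈ varsOf s ℓ → ∀ l → Backward.Derivable T (tgt t l))
      backward-step s@(bcast _) v∈ _ = proj₂ (bc-initial s refl v∈) , λ t∈ → ⊥-elim (bc-acts s refl t∈)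
      backward-step {T} (rdzv a ι inj es os) (v∈ ∷ []) d = df , λ { (here refl) l → targets l }
        where
        legs : ∀ j → Enabled (ℓ , a) × f (ι j) ≡ src (ℓ , a) j × g (ι j) ≡ tgt (ℓ , a) j
        legs j = rdz-edge (f (ι j)) (g (ι j)) j (uniform (ι j)) (es j)
        targets : ∀ l → Backward.Derivable T (tgt (ℓ , a) l)
        targets l = subst (Backward.Derivable T) (proj₂ (proj₂ (legs l))) (d (ι l))
        df : ∀ i → Backward.Derivable T (f i)
        df i with Fin.any? (λ j → ι j Fin.≟ i)
        ... | yes (j , refl) = subst (Backward.Derivable T) (sym (proj₁ (proj₂ (legs j)))) (Closure.rule (∈-acts⁺ v∈) targets j)
        ... | no none = subst (Backward.Derivable T) (os i (λ j e → none (j , e))) (d i)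

      quiet-vars : (s : Trans f g) → isBc s ≡ false → ∀ {v} → v ∈ varsOf s ℓ → ∃[ t ] v ≡ inj₁ t
      quiet-vars (rdzv a ι inj es os) _ (here refl) = (ℓ , a) , refl

      after-bc : (s : Trans f g) → isBc s ≡ true → after s ℓ ≡ next ℓ
      after-bc (bcast _) _ = refl

      -- Levels rise by one until they wrap to `n`, so lying above `ℓ₀` is given up only in favour
      -- of the bound `n`, which then persists.
      after-high : (s : Trans f g) → ∀ {ℓ₀} → n ≤ ℓ ⊎ ℓ₀ < ℓ → n ≤ after s ℓ ⊎ ℓ₀ < after s ℓ
      after-high (rdzv _ _ _ _ _) h = h
      after-high s@(bcast _) h with next-spec (step≤m s) | h
      ... | inj₁ (_ , e) | inj₁ le = inj₁ (subst (n ≤_) (sym e) (ℕ.≤-trans le (ℕ.n≤1+n ℓ)))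
      ... | inj₁ (_ , e) | inj₂ lt = inj₂ (subst (_ <_) (sym e) (ℕ.<-trans lt (ℕ.n<1+n ℓ)))
      ... | inj₂ (_ , e) | _ = inj₁ (ℕ.≤-reflexive (sym e))

  -- Segments of a run and the circulations they induce

  module OnRun (r : Run) where
    open Run r renaming (conf to config; init to start)

    ℓ : ℕ → ℕ
    ℓ t = proj₂ (config t zero)

    uniform : ∀ t i → proj₂ (config t i) ≡ ℓ t
    uniform zero    i = trans (proj₂ (start i)) (sym (proj₂ (start zero)))
    uniform (suc t) i = trans (after-level (uniform t) (step t) i) (sym (after-level (uniform t) (step t) zero))

    ℓ-suc : ∀ t → ℓ (suc t) ≡ after (step t) (ℓ t)
    ℓ-suc t = after-level (uniform t) (step t) zero

    ℓ≤m : ∀ t → ℓ t ≤ m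
    ℓ≤m t = step≤m (uniform t) (step t)

    vars : ℕ → List Var
    vars t = varsOf (step t) (ℓ t)

    segVars : ℕ → ℕ → List Var
    segVars p zero    = []
    segVars p (suc d) = vars p ++ segVars (suc p) d

    ∈-segVars⁺ : ∀ {v} p d t → p ≤ t → t < d + p → v ∈ vars t → v ∈ segVars p d
    ∈-segVars⁺ p zero    t le lt v∈ = ⊥-elim (ℕ.<⇒≱ lt le)
    ∈-segVars⁺ p (suc d) t le lt v∈ with ℕ.m≤n⇒m<n∨m≡n le
    ... | inj₁ p<t  = ∈-++⁺ʳ (vars p) (∈-segVars⁺ (suc p) d t p<t (subst (t <_) (sym (ℕ.+-suc d p)) lt) v∈)
    ... | inj₂ refl = ∈-++⁺ˡ v∈

    ∈-segVars⁻ : ∀ {v} p d → v ∈ segVars p d → ∃[ t ] (p ≤ t × t < d + p × v ∈ vars t)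
    ∈-segVars⁻ p (suc d) v∈ with ∈-++⁻ (vars p) v∈
    ... | inj₁ v∈p = p , ℕ.≤-refl , s≤s (ℕ.m≤n+m p d) , v∈p
    ... | inj₂ v∈q = let t , le , lt , v∈t = ∈-segVars⁻ (suc p) d v∈q
                     in t , ℕ.<⇒≤ le , subst (t <_) (ℕ.+-suc d p) lt , v∈t

    segFlow : ∀ p d x → # (config (d + p)) x + sumL (λ v → outflow v x) (segVars p d)
      ≡ # (config p) x + sumL (λ v → inflow v x) (segVars p d)
    segFlow p zero    x = refl
    segFlow p (suc d) x = ℕ.+-cancelˡ-≡ (# (config (suc p)) x) _ _
      (trans (cong (# (config (suc p)) x +_) (cong₂ _+_ (cong (λ t → # (config t) x) (sym (ℕ.+-suc d p))) (sumL-++ (λ v → outflow v x) (vars p) _)))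
        (trans (shuffle₁ (# (config (suc p)) x) (# (config (d + suc p)) x) _ _)
          (trans (cong₂ _+_ (flow (uniform p) (step p) x) (segFlow (suc p) d x))
            (trans (shuffle₂ (# (config p) x) (sumL (λ v → inflow v x) (vars p)) (# (config (suc p)) x) _)
              (cong (λ z → # (config (suc p)) x + (# (config p) x + z)) (sym (sumL-++ (λ v → inflow v x) (vars p) _)))))))
      where
      shuffle₁ : ∀ a b c d → a + (b + (c + d)) ≡ (a + c) + (b + d)
      shuffle₁ = solve-∀
      shuffle₂ : ∀ a b c d → (a + b) + (c + d) ≡ c + (a + (b + d))
      shuffle₂ = solve-∀

    size : ℕ
    size = suc m * nSt ^ suc N

    key : ℕ → Fin size
    key t = combine (fromℕ< (s≤s (ℓ≤m t))) (funToFin (λ i → proj₁ (config t i)))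

    key-level : ∀ {p q} → key p ≡ key q → ℓ p ≡ ℓ q
    key-level {p} {q} e = trans (sym (Fin.toℕ-fromℕ< (s≤s (ℓ≤m p))))
      (trans (cong toℕ (proj₁ (Fin.combine-injective _ _ _ _ e))) (Fin.toℕ-fromℕ< (s≤s (ℓ≤m q))))

    key-config : ∀ {p q} → key p ≡ key q → config p ≗ config q
    key-config {p} {q} e i = cong₂ _,_
      (trans (sym (Fin.finToFun-funToFin (λ i → proj₁ (config p i)) i))
        (trans (cong (λ c → finToFun {nSt} {suc N} c i) (proj₂ (Fin.combine-injective (fromℕ< (s≤s (ℓ≤m p))) _ (fromℕ< (s≤s (ℓ≤m q))) _ e)))
          (Fin.finToFun-funToFin (λ i → proj₁ (config q i)) i)))
      (trans (uniform p i) (trans (key-level e) (sym (uniform q i))))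

    -- Equal configurations at both ends cancel in the state equation of the segment.
    segCirculation : ∀ p d → key p ≡ key (d + p) → Circulation (segVars p d)
    segCirculation p d e x = sym (ℕ.+-cancelˡ-≡ (# (config p) x) _ _
      (trans (cong (_+ sumL (λ v → outflow v x) (segVars p d)) (#-cong (key-config e) x)) (segFlow p d x)))

    Quiet∈ : ℕ → ℕ → Set
    Quiet∈ p q = ∀ t → p ≤ t → t < q → isBc (step t) ≡ false

    obs⇒∈vars : ∀ {t ed} → observe r t ≡ just ed → edgeVar ed ∈ vars t
    obs⇒∈vars {t} = obs⇒var (uniform t) (step t)

    forward-seg : ∀ {T} p d → All (_∈ T) (segVars p d) → (∀ i → Forward.Derivable T (config p i)) →
      ∀ {t} → inj₁ t ∈ segVars p d → ∀ l → Forward.Derivable T (src t l)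
    forward-seg p (suc d) v∈ der t∈ l with ∈-++⁻ (vars p) t∈
    ... | inj₁ t∈p = proj₂ (forward-step (uniform p) (step p) (All.++⁻ˡ (vars p) v∈) der) t∈p l
    ... | inj₂ t∈q = forward-seg (suc p) d (All.++⁻ʳ (vars p) v∈)
                       (proj₁ (forward-step (uniform p) (step p) (All.++⁻ˡ (vars p) v∈) der)) t∈q l

    backward-seg : ∀ {T} p d → All (_∈ T) (segVars p d) → (∀ i → Backward.Derivable T (config (d + p) i)) →
      (∀ i → Backward.Derivable T (config p i)) × (∀ {t} → inj₁ t ∈ segVars p d → ∀ l → Backward.Derivable T (tgt t l))
    backward-seg p zero    v∈ der = der , λ ()
    backward-seg {T} p (suc d) v∈ der =
      let later = backward-seg (suc p) d (All.++⁻ʳ (vars p) v∈)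
                    (λ i → subst (λ t → Backward.Derivable T (config t i)) (sym (ℕ.+-suc d p)) (der i))
          now = backward-step (uniform p) (step p) (All.++⁻ˡ (vars p) v∈) (proj₁ later)
      in proj₁ now , λ t∈ → both (proj₂ later) (proj₂ now) (∈-++⁻ (vars p) t∈)
      where
      both : ∀ {t} → (∀ {t} → inj₁ t ∈ segVars (suc p) d → ∀ l → Backward.Derivable T (tgt t l)) →
        (∀ {t} → inj₁ t ∈ vars p → ∀ l → Backward.Derivable T (tgt t l)) →
        inj₁ t ∈ vars p ⊎ inj₁ t ∈ segVars (suc p) d → ∀ l → Backward.Derivable T (tgt t l)
      both later now (inj₁ t∈) = now t∈
      both later now (inj₂ t∈) = later t∈

    segVars-isVar : ∀ p d {v} → v ∈ segVars p d → IsVar v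
    segVars-isVar p d v∈ =
      let t , _ , _ , v∈t = ∈-segVars⁻ p d v∈ in proj₁ (All.lookup (vars-ok (uniform t) (step t)) v∈t)

    climb : ∀ {p ℓ₀} d → n ≤ ℓ p ⊎ ℓ₀ < ℓ p → n ≤ ℓ (d + p) ⊎ ℓ₀ < ℓ (d + p)
    climb zero h = h
    climb {p} {ℓ₀} (suc d) h = subst (λ i → n ≤ i ⊎ ℓ₀ < i) (sym (ℓ-suc (d + p)))
      (after-high (uniform (d + p)) (step (d + p)) (climb d h))

    -- After the broadcast the level has risen above its start or is at least `n`, and this
    -- persists; a level that recurs is not above itself.
    high-start : ∀ p e → isBc (step p) ≡ true → key p ≡ key (suc e + p) → n ≤ ℓ p
    high-start p e b eq = decide (climb {suc p} {ℓ p} e first)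
      where
      first : n ≤ ℓ (suc p) ⊎ ℓ p < ℓ (suc p)
      first with next-spec (ℓ≤m p)
      ... | inj₁ (_ , e) = inj₂ (ℕ.≤-reflexive (sym (trans (ℓ-suc p) (trans (after-bc (uniform p) (step p) b) e))))
      ... | inj₂ (_ , e) = inj₁ (ℕ.≤-reflexive (sym (trans (ℓ-suc p) (trans (after-bc (uniform p) (step p) b) e))))
      back : ℓ (e + suc p) ≡ ℓ p
      back = trans (cong ℓ (ℕ.+-suc e p)) (sym (key-level {p} {suc e + p} eq))
      decide : n ≤ ℓ (e + suc p) ⊎ ℓ p < ℓ (e + suc p) → n ≤ ℓ p
      decide (inj₁ le) = subst (n ≤_) back le
      decide (inj₂ lt) = ⊥-elim (ℕ.<-irrefl (sym back) lt)

    segVars-high : ∀ p d → n ≤ ℓ p → ∀ {v} → v ∈ segVars p d → n ≤ levelOf v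
    segVars-high p d le {v} v∈ =
      let t , p≤t , _ , v∈t = ∈-segVars⁻ p d v∈
      in subst (n ≤_) (sym (proj₂ (All.lookup (vars-ok (uniform t) (step t)) v∈t)))
           (subst (λ t → n ≤ ℓ t) (ℕ.m∸n+n≡m p≤t) (collapse (climb (t ∸ p) (inj₁ le))))
      where
      collapse : ∀ {i} → n ≤ i ⊎ m < i → n ≤ i
      collapse (inj₁ le) = le
      collapse (inj₂ lt) = ℕ.≤-trans n≤m (ℕ.<⇒≤ lt)

    -- The segment begins with a broadcast, so after its first step all states are entered by
    -- broadcasts of `T`, and derivability spreads forwards. Its last configuration equals the
    -- first, all of whose states are left by that broadcast, so derivability also spreads backwards
    -- from the end. The whole segment is one circuit through all its members.
    good : ∀ {T} p e → isBc (step p) ≡ true → key p ≡ key (suc e + p) →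
      (∀ {v} → v ∈ T → v ∈ segVars p (suc e)) → (∀ {v} → v ∈ segVars p (suc e) → v ∈ T) → Good T
    good {T} p e b eq T⊆ ⊆T = record
      { vars     = All.tabulate (segVars-isVar p (suc e) ∘ T⊆)
      ; high     = All.tabulate (segVars-high p (suc e) (high-start p e b eq) ∘ T⊆)
      ; circuits = All.tabulate (λ v∈ → segVars p (suc e) , All.tabulate ⊆T , T⊆ v∈ , segCirculation p (suc e) eq)
      ; forward  = All.tabulate (λ {t} t∈ → fwd (∈-++⁻ (vars p) (T⊆ (∈-acts⁻ T t∈))))
      ; backward = All.tabulate (λ {t} t∈ → proj₂ (backward-seg p (suc e) all∈ end) (T⊆ (∈-acts⁻ T t∈)))
      }
      where
      all∈ : All (_∈ T) (segVars p (suc e))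
      all∈ = All.tabulate ⊆T
      initial : (∀ i → Forward.Derivable T (config (suc p) i)) × (∀ i → Backward.Derivable T (config p i))
      initial = bc-initial (uniform p) (step p) b (All.++⁻ˡ (vars p) all∈)
      end : ∀ i → Backward.Derivable T (config (suc e + p) i)
      end i = subst (Backward.Derivable T) (key-config {p} {suc e + p} eq i) (proj₂ initial i)
      fwd : ∀ {t} → inj₁ t ∈ vars p ⊎ inj₁ t ∈ segVars (suc p) e → ∀ l → Forward.Derivable T (src t l)
      fwd (inj₁ t∈) = ⊥-elim (bc-acts (uniform p) (step p) b t∈)
      fwd (inj₂ t∈) = forward-seg (suc p) e (All.++⁻ʳ (vars p) all∈) (proj₁ initial) t∈

    quietCircuit : ∀ {T ed} p d → key p ≡ key (d + p) → Quiet∈ p (d + p) →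
      (∀ {t} → inj₁ t ∈ segVars p d → inj₁ t ∈ T) → ∀ t → p ≤ t → t < d + p → observe r t ≡ just ed →
      Circuit (map inj₁ (acts T)) (edgeVar ed)
    quietCircuit {T} {ed} p d eq quiet ⊆T t p≤t t<q o =
      segVars p d , All.tabulate pure , ∈-segVars⁺ p d t p≤t t<q (obs⇒∈vars o) , segCirculation p d eq
      where
      pure : ∀ {v} → v ∈ segVars p d → v ∈ map inj₁ (acts T)
      pure v∈ with ∈-segVars⁻ p d v∈
      ... | u , le , lt , v∈u with quiet-vars (uniform u) (step u) (quiet u le lt) v∈u
      ...   | _ , refl = ∈-map⁺ inj₁ (∈-acts⁺ (⊆T v∈))

  -- Decision

  open DecMembership _≟ⱽ_ using () renaming (_∈?_ to _∈ⱽ?_)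

  isVar? : Decidable IsVar
  isVar? (inj₁ t) = enabled? t
  isVar? (inj₂ (i , s , t)) = (i ℕ.≤? m) ×-dec (InS? i s ×-dec (edge s bc t Bool.≟ true))

  candidates : List Var
  candidates = map inj₁ (cartesianProduct (upTo (suc m)) (allFin A)) ++
    map inj₂ (cartesianProduct (upTo (suc m)) (cartesianProduct (allFin nSt) (allFin nSt)))

  allVars highVars : List Var
  allVars  = filter isVar? candidates
  highVars = filter (λ v → n ℕ.≤? levelOf v) allVars

  ∈-allVars : ∀ {v} → IsVar v → v ∈ allVars
  ∈-allVars {inj₁ (i , a)} is = ∈-filter⁺ isVar?
    (∈-++⁺ˡ (∈-map⁺ inj₁ (∈-cartesianProduct⁺ (∈-upTo⁺ (s≤s (proj₁ is))) (∈-allFin a)))) is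
  ∈-allVars {inj₂ (i , s , t)} is = ∈-filter⁺ isVar?
    (∈-++⁺ʳ (map inj₁ (cartesianProduct (upTo (suc m)) (allFin A))) (∈-map⁺ inj₂ (∈-cartesianProduct⁺ (∈-upTo⁺ (s≤s (proj₁ is)))
      (∈-cartesianProduct⁺ (∈-allFin s) (∈-allFin t))))) is

  module _ (T : List Var) (isVar : All IsVar T) (v : Var) where
    open Elimination {Pl}
    open import Data.Integer using (+_)

    private
      column : Var → Col
      column u = does (u ≟ⱽ v) , λ p → + inflow u p ℤ.- + outflow u p

      total-column : ∀ W p → total (map column W) p ≡
        + sumL (λ u → inflow u p) W ℤ.- + sumL (λ u → outflow u p) W
      total-column []      p = refl
      total-column (u ∷ W) p = trans (cong (ℤ._+_ (+ inflow u p ℤ.- + outflow u p)) (total-column W p))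
        (minus-+ (+ inflow u p) (+ outflow u p) (+ sumL (λ u → inflow u p) W) (+ sumL (λ u → outflow u p) W))

      -- Equations up to level `m` suffice, because the variables of `T` carry no flow elsewhere.
      rows : List Pl
      rows = cartesianProduct (allFin nSt) (upTo (suc m))

      no-inflow : ∀ {u s i} → IsVar u → m < i → inflow u (s , i) ≡ 0
      no-inflow {inj₁ (j , a)} (j≤m , _) lt = #-other (tgt (j , a)) (λ { _ refl → ℕ.<⇒≱ lt j≤m })
      no-inflow {inj₂ b} {s} {i} _ lt = δ-≢ {bcTgt b} {s , i} (λ e → ℕ.<⇒≱ lt (subst (_≤ m) (cong proj₂ e) (next≤m (proj₁ b))))

      no-outflow : ∀ {u s i} → IsVar u → m < i → outflow u (s , i) ≡ 0
      no-outflow {inj₁ (j , a)} (j≤m , _) lt = #-other (src (j , a)) (λ { _ refl → ℕ.<⇒≱ lt j≤m })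
      no-outflow {inj₂ b} {s} {i} (j≤m , _) lt = δ-≢ {bcSrc b} {s , i} (λ e → ℕ.<⇒≱ lt (subst (_≤ m) (cong proj₂ e) j≤m))

      uncolumn : ∀ W → All (_∈ map column T) W → ∃[ V ] (All (_∈ T) V × map column V ≡ W)
      uncolumn [] [] = [] , [] , refl
      uncolumn (c ∷ W) (c∈ ∷ W∈) =
        let u , u∈ , e = ∈-map⁻ column c∈
            V , V∈ , e′ = uncolumn W W∈
        in u ∷ V , u∈ ∷ V∈ , cong₂ _∷_ (sym e) e′

      marked⇒∈ : ∀ V → Any marked (map column V) → v ∈ V
      marked⇒∈ (u ∷ V) (there a) = there (marked⇒∈ V a)
      marked⇒∈ (u ∷ V) (here e) with u ≟ⱽ v
      ... | yes u≡v = here (sym u≡v)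
      marked⇒∈ (u ∷ V) (here ()) | no _

      ∈⇒marked : ∀ {V} → v ∈ V → Any marked (map column V)
      ∈⇒marked (there v∈) = there (∈⇒marked v∈)
      ∈⇒marked (here refl) = here (dec-true (v ≟ⱽ v) refl)

      solution⇒circuit : Solution rows (map column T) → Circuit T v
      solution⇒circuit (W , W∈ , mk , z) =
        let V , V∈ , e = uncolumn W W∈
        in V , V∈ , marked⇒∈ V (subst (Any marked) (sym e) mk) , circulates V V∈ e
        where
        circulates : ∀ V → All (_∈ T) V → map column V ≡ W → Circulation V
        circulates V V∈ e (s , i) with i ℕ.≤? m
        ... | yes i≤m = ℤ.+-injective (ℤ.i-j≡0⇒i≡j _ _ (trans (sym (total-column V (s , i)))
                (trans (cong (λ U → total U (s , i)) e) (z (∈-cartesianProduct⁺ (∈-allFin s) (∈-upTo⁺ (s≤s i≤m)))))))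
        ... | no i≰m = trans (sumL≡0 _ V (λ {u} u∈ → no-inflow {u} (All.lookup isVar (All.lookup V∈ u∈)) (ℕ.≰⇒> i≰m)))
                (sym (sumL≡0 _ V (λ {u} u∈ → no-outflow {u} (All.lookup isVar (All.lookup V∈ u∈)) (ℕ.≰⇒> i≰m))))

      circuit⇒solution : Circuit T v → Solution rows (map column T)
      circuit⇒solution (V , V∈ , v∈ , circ) = map column V , All.map⁺ (All.map (∈-map⁺ column) V∈) , ∈⇒marked v∈ ,
        λ {p} _ → trans (total-column V p) (trans (cong (λ a → + a ℤ.- + sumL (λ u → outflow u p) V) (circ p))
          (ℤ.+-inverseʳ (+ sumL (λ u → outflow u p) V)))

    circuit? : Dec (Circuit T v)
    circuit? = map′ solution⇒circuit circuit⇒solution (solution? rows (map column T))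

  good? : ∀ T → Dec (Good T)
  good? T with All.all? isVar? T
  ... | no ¬vars = no (¬vars ∘ Good.vars)
  ... | yes vars = map′
    (λ (a , b , c , d) → record { vars = vars ; high = a ; circuits = b ; forward = c ; backward = d })
    (λ g → Good.high g , Good.circuits g , Good.forward g , Good.backward g)
    (All.all? (λ v → n ℕ.≤? levelOf v) T ×-dec
     (All.all? (λ v → circuit? T vars v) T ×-dec
     (All.all? (λ t → Fin.all? (λ l → Forward.derivable? T (src t l))) (acts T) ×-dec
      All.all? (λ t → Fin.all? (λ l → Backward.derivable? T (tgt t l))) (acts T))))

  pure : List Var → List Var
  pure T = map inj₁ (acts T)

  pure-isVar : ∀ {T} → All IsVar T → All IsVar (pure T)
  pure-isVar {T} vars = All.map⁺ (All.tabulate (λ t∈ → All.lookup vars (∈-acts⁻ T t∈)))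

  -- Being good depends on the set of variables only, so the sublists of `highVars` represent all
  -- candidates. For a burst, the circuit of rendezvous must lie inside the support of a lap, which
  -- then enables it on the way.
  QuietCycle BroadcastCycle BurstCycle : Var → Set
  QuietCycle v     = Circuit (pure allVars) v
  BroadcastCycle v = Any (λ T → Good T × v ∈ T) (sublists highVars)
  BurstCycle v     = Any (λ T → Good T × Circuit (pure T) v) (sublists highVars)

  quietCycle? : ∀ v → Dec (QuietCycle v)
  quietCycle? = circuit? (pure allVars) (pure-isVar (All.tabulate (λ v∈ → proj₂ (∈-filter⁻ isVar? {xs = candidates} v∈))))

  broadcastCycle? : ∀ v → Dec (BroadcastCycle v)
  broadcastCycle? v = Any.any? (λ T → good? T ×-dec (v ∈ⱽ? T)) (sublists highVars)

  burstCycle? : ∀ v → Dec (BurstCycle v)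
  burstCycle? v = Any.any? burst? (sublists highVars)
    where
    burst? : ∀ T → Dec (Good T × Circuit (pure T) v)
    burst? T with good? T
    ... | no ¬g = no (¬g ∘ proj₁)
    ... | yes g = map′ (g ,_) proj₂ (circuit? (pure T) (pure-isVar (Good.vars g)) v)

  module _ {T : List Var} (isVar : ∀ {v} → v ∈ T → IsVar v) where

    pure-acts : ∀ W → All (_∈ pure T) W → All Enabled (acts W) × bcs W ≡ [] × All (_∈ acts T) (acts W)
    pure-acts [] [] = [] , refl , []
    pure-acts (v ∷ W) (v∈ ∷ W∈) with ∈-map⁻ inj₁ v∈
    ... | t , t∈ , refl =
      let en , e , ⊆T = pure-acts W W∈ in isVar (∈-acts⁻ T t∈) ∷ en , e , t∈ ∷ ⊆T

    pure-balance : ∀ W → All (_∈ pure T) W → Circulation W → ∀ p → postL (acts W) p ≡ preL (acts W) p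
    pure-balance W W∈ circ p = ℕ.+-cancelʳ-≡ 0 _ _
      (trans (sym (split (λ v → inflow v p))) (trans (circ p) (split (λ v → outflow v p))))
      where
      split : ∀ (f : Var → ℕ) → sumL f W ≡ sumL (f ∘ inj₁) (acts W) + 0
      split f = trans (sumL-split f W)
        (cong (λ B → sumL (f ∘ inj₁) (acts W) + sumL (f ∘ inj₂) B) (proj₁ (proj₂ (pure-acts W W∈))))

  sumL-bound : ∀ {Y : Set} (f : Y → ℕ) d W → (∀ {y} → y ∈ W → f y ≤ d) → sumL f W ≤ length W * d
  sumL-bound f d []      le = z≤n
  sumL-bound f d (y ∷ W) le = ℕ.+-mono-≤ (le (here refl)) (sumL-bound f d W (le ∘ there))

  module _ {x y : Pl} {l : Label k A} (ue : UEdge m n x l y) where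

    private
      ed : Triple
      ed = x , l , y

    rdz-form : ∀ {a h} → l ≡ rdz a h → ed ≡ rdzTriple (proj₂ x) a h × proj₂ x ≤ m
    rdz-form refl = go ue
      where
      go : ∀ {x y a h} → UEdge m n x (rdz a h) y → (x , rdz a h , y) ≡ rdzTriple (proj₂ x) a h × proj₂ x ≤ m
      go {s , i} {t , .i} (refl , i≤m , inR) with InR⇒enabled i≤m inR
      ... | _ , refl , refl = refl , i≤m

    bc-form : l ≡ bc → ed ≡ bcTriple (proj₂ x , proj₁ x , proj₁ y) × proj₂ x ≤ m
    bc-form refl = go ue
      where
      go : ∀ {x y} → UEdge m n x bc y → (x , bc , y) ≡ bcTriple (proj₂ x , proj₁ x , proj₁ y) × proj₂ x ≤ m
      go {s , i} {t , j} (i≤m , _ , _ , nx) = cong (λ j → (s , i) , bc , (t , j)) (next-unique nx) , i≤m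

  quietCycle⇒ : ∀ {x l y} → UEdge m n x l y → QuietCycle (edgeVar (x , l , y)) → LassoF (x , l , y)
  quietCycle⇒ {x} {bc} ue (W , W∈ , v∈ , circ) with ∈-map⁻ inj₁ (All.lookup W∈ v∈)
  ... | _ , _ , ()
  quietCycle⇒ {x} {rdz a h} ue (W , W∈ , v∈ , circ) =
    subst LassoF (sym (proj₁ (rdz-form ue refl)))
      (lassoF (acts W) (proj₁ (pure-acts isVar W W∈)) (pure-balance isVar W W∈ circ) (∈-acts⁺ v∈))
    where
    isVar : ∀ {v} → v ∈ allVars → IsVar v
    isVar v∈ = proj₂ (∈-filter⁻ isVar? {xs = candidates} v∈)

  broadcastCycle⇒ : ∀ {x l y} → UEdge m n x l y → BroadcastCycle (edgeVar (x , l , y)) → LassoB (x , l , y)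
  broadcastCycle⇒ {x} {l} ue cyc =
    let T , _ , good , v∈ = find cyc in go l ue good v∈
    where
    go : ∀ {y T} l → (ue : UEdge m n x l y) → Good T → edgeVar (x , l , y) ∈ T → LassoB (x , l , y)
    go (rdz a h) ue good v∈ = subst LassoB (sym (proj₁ (rdz-form ue refl)))
      -- No reserve is asked for, as nothing is inserted into the laps.
      (Laps.lassoB (good⇒plan good 0) (All.lookup (Good.high good) v∈) (proj₂ (rdz-form ue refl)) (λ p f g → f h v∈))
    go bc ue good v∈ = subst LassoB (sym (proj₁ (bc-form ue refl)))
      (Laps.lassoB (good⇒plan good 0) (All.lookup (Good.high good) v∈) (proj₂ (bc-form ue refl)) (λ p f g → g v∈))

  burstCycle⇒ : ∀ {x l y} → UEdge m n x l y → BurstCycle (edgeVar (x , l , y)) → LassoG (x , l , y)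
  burstCycle⇒ {x} {l} ue cyc =
    let T , _ , good , W , W∈ , v∈ , circ = find cyc in go l ue good W W∈ v∈ circ
    where
    go : ∀ {y T} l → (ue : UEdge m n x l y) → Good T → ∀ W → All (_∈ pure T) W → edgeVar (x , l , y) ∈ W →
      Circulation W → LassoG (x , l , y)
    go bc ue good W W∈ v∈ circ with ∈-map⁻ inj₁ (All.lookup W∈ v∈)
    ... | _ , _ , ()
    go {T = T} (rdz a h) ue good W W∈ v∈ circ = subst LassoG (sym (proj₁ (rdz-form ue refl)))
      -- The loop needs the reserve `length κ * preL κ`, and `preL κ` is at most `length κ` times
      -- `preL (acts L.W)`; hence the square.
      (loop (good⇒plan good (length κ * length κ)))
      where
      κ = acts W
      κ⊆T : All (_∈ acts T) κ
      κ⊆T = proj₂ (proj₂ (pure-acts (All.lookup (Good.vars good)) W W∈))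
      i∈T : inj₁ (proj₂ x , a) ∈ T
      i∈T = ∈-acts⁻ T (All.lookup κ⊆T (∈-acts⁺ v∈))
      loop : Plan T (length κ * length κ) → LassoG (rdzTriple (proj₂ x) a h)
      loop pl = L.lassoG (All.lookup (Good.high good) i∈T) (proj₂ (rdz-form ue refl)) κ
        (proj₁ (pure-acts (All.lookup (Good.vars good)) W W∈)) (pure-balance (All.lookup (Good.vars good)) W W∈ circ)
        (λ p → ℕ.≤-trans (ℕ.*-monoʳ-≤ (length κ) (sumL-bound (λ t → pre t p) (preL (acts L.W) p) κ
                 (λ t∈ → ∈⇒≤sumL (λ t → pre t p) (∈-acts⁺ (L.T⊆W (∈-acts⁻ T (All.lookup κ⊆T t∈)))))))
               (ℕ.≤-trans (ℕ.≤-reflexive (sym (ℕ.*-assoc (length κ) (length κ) (preL (acts L.W) p)))) (L.rich p)))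
        (∈-acts⁺ v∈)
        where module L = Laps pl

  -- From recurrence on a run to cycles

  module OfRun (r : Run) {ed : Triple} (often : OftenIn r (_≡ ed)) where
    open OnRun r

    BcAt EdAt : ℕ → Set
    BcAt t = isBc (Run.step r t) ≡ true
    EdAt t = observe r t ≡ just ed

    scan : ∀ d p → (∃[ t ] (p ≤ t × BcAt t)) ⊎ Quiet∈ p (d + p)
    scan zero    p = inj₂ (λ t le lt → ⊥-elim (ℕ.<⇒≱ lt le))
    scan (suc d) p with isBc (Run.step r (d + p)) in eq | scan d p
    ... | true  | _ = inj₁ (d + p , ℕ.m≤n+m p d , eq)
    ... | false | inj₁ found = inj₁ found
    ... | false | inj₂ quiet = inj₂ quiet′
      where
      quiet′ : Quiet∈ p (suc (d + p))
      quiet′ t le lt with ℕ.m≤n⇒m<n∨m≡n (ℕ.≤-pred lt)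
      ... | inj₁ lt′ = quiet t le lt′
      ... | inj₂ refl = eq

    edAfter : ∀ T → ∃[ t ] (T ≤ t × EdAt t)
    edAfter T = let t , le , x , o , e = often T in t , le , subst (λ x → observe r t ≡ just x) e o

    -- Two occurrences of the edge in equal configurations bound a circulation; without a quiet
    -- cycle the segment contains a broadcast, which `scan` finds. This finite search replaces a
    -- case distinction on whether broadcasts go on for ever.
    bcsEventually : ¬ QuietCycle (edgeVar ed) → ∀ T → ∃[ t ] (T ≤ t × BcAt t)
    bcsEventually none T =
      let t₀ , le₀ , o₀ = edAfter T
          -- Only the repetition counts here, so the relation carried along is constant.
          p , q , le , p<q , o , _ , e = recurrence key EdAt (λ _ _ → EdAt t₀) (λ r _ → r)
            (λ t _ → let t′ , le , o = edAfter (suc t) in t′ , le , o , o₀) t₀ o₀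
      in case p q (ℕ.≤-trans le₀ le) p<q o e (scan (q ∸ p) p)
      where
      case : ∀ p q → T ≤ p → p < q → EdAt p → key p ≡ key q → (∃[ t ] (p ≤ t × BcAt t)) ⊎ Quiet∈ p (q ∸ p + p) →
        ∃[ t ] (T ≤ t × BcAt t)
      case p q T≤p p<q o e (inj₁ (t , le , b)) = t , ℕ.≤-trans T≤p le , b
      case p q T≤p p<q o e (inj₂ quiet) = ⊥-elim (none (quietCircuit p (q ∸ p) (trans e (cong key (sym q≡))) quiet
          (λ t∈ → ∈-allVars (segVars-isVar p (q ∸ p) t∈)) p ℕ.≤-refl (subst (p <_) (sym q≡) p<q) o))
        where
        q≡ : q ∸ p + p ≡ q
        q≡ = ℕ.m∸n+n≡m (ℕ.<⇒≤ p<q)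

    module _ (bcs∞ : ∀ T → ∃[ t ] (T ≤ t × BcAt t)) where

      -- Broadcasts are selected so far apart that consecutive ones enclose an event; hence two of
      -- them with equal configurations enclose one too.
      closed-segment : (R : ℕ → ℕ → Set) → (∀ T → ∃[ a ] ∃[ b ] (T ≤ a × R a b)) →
        ∃[ p ] ∃[ e ] (BcAt p × key p ≡ key (suc e + p) × ∃[ a ] ∃[ b ] (p ≤ a × b ≤ suc e + p × R a b))
      closed-segment R events =
        let t₀ , _ , b₀ = bcs∞ 0
            p , q , _ , p<q , b , (a , c , p≤a , c≤q , rac) , e = recurrence key BcAt Within
              (λ (a , b , le , le′ , rab) le″ → a , b , le , ℕ.≤-trans le′ le″ , rab) advance t₀ b₀
            q≡ = trans (sym (ℕ.+-suc (q ∸ suc p) p)) (ℕ.m∸n+n≡m p<q)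
        in p , q ∸ suc p , b , trans e (cong key (sym q≡)) , a , c , p≤a , subst (c ≤_) (sym q≡) c≤q , rac
        where
        Within : ℕ → ℕ → Set
        Within t t′ = ∃[ a ] ∃[ b ] (t ≤ a × b ≤ t′ × R a b)
        advance : ∀ t → BcAt t → ∃[ t′ ] (t < t′ × BcAt t′ × Within t t′)
        advance t _ =
          let a , b , le , rab = events t
              t′ , le′ , bc′ = bcs∞ (suc t + b)
          in t′ , ℕ.≤-trans (ℕ.m≤m+n (suc t) b) le′ , bc′ , a , b , le , ℕ.≤-trans (ℕ.m≤n+m b (suc t)) le′ , rab

      -- The variables of the segment in the order of `highVars`, so that the list occurs among its
      -- sublists.
      used : ℕ → ℕ → List Var
      used p e = filter (_∈ⱽ? segVars p (suc e)) highVars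

      used-good : ∀ p e → BcAt p → key p ≡ key (suc e + p) →
        Good (used p e) × (∀ {v} → v ∈ segVars p (suc e) → v ∈ used p e)
      used-good p e b eq = good p e b eq (λ v∈ → proj₂ (∈-filter⁻ (_∈ⱽ? segVars p (suc e)) {xs = highVars} v∈)) ⊆used , ⊆used
        where
        ⊆used : ∀ {v} → v ∈ segVars p (suc e) → v ∈ used p e
        ⊆used v∈ = ∈-filter⁺ (_∈ⱽ? segVars p (suc e))
          (∈-filter⁺ (λ v → n ℕ.≤? levelOf v) (∈-allVars (segVars-isVar p (suc e) v∈))
            (segVars-high p (suc e) (high-start p e b eq) v∈)) v∈

      broadcastCycle : BroadcastCycle (edgeVar ed)
      broadcastCycle =
        let p , e , b , eq , a , c , p≤a , c≤q , o , a<c = closed-segment (λ a c → EdAt a × a < c)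
              (λ T → let t , le , o = edAfter T in t , suc t , le , o , ℕ.n<1+n t)
            g , ⊆T = used-good p e b eq
        in lose (filter∈sublists (_∈ⱽ? segVars p (suc e)) highVars)
             (g , ⊆T (∈-segVars⁺ p (suc e) a p≤a (ℕ.≤-trans a<c c≤q) (obs⇒∈vars o)))

      QuietLoopAt : ℕ → ℕ → Set
      QuietLoopAt a b = a < b × key a ≡ key b × Quiet∈ a b × EdAt a

      -- A closed segment around a quiet loop uses all rendezvous of the loop, so the loop is a
      -- circuit inside the good support of the segment.
      burstCycle : (∀ T → ∃[ a ] ∃[ b ] (T ≤ a × QuietLoopAt a b)) → BurstCycle (edgeVar ed)
      burstCycle loops =
        let p , e , b , eq , a , c , p≤a , c≤q , a<c , eq′ , quiet , o = closed-segment QuietLoopAt loops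
            g , ⊆T = used-good p e b eq
            c≡ = ℕ.m∸n+n≡m (ℕ.<⇒≤ a<c)
        in lose (filter∈sublists (_∈ⱽ? segVars p (suc e)) highVars)
             (g , quietCircuit a (c ∸ a) (trans eq′ (cong key (sym c≡))) (subst (Quiet∈ a) (sym c≡) quiet)
               (λ t∈ → let u , le , lt , t∈u = ∈-segVars⁻ a (c ∸ a) t∈
                       in ⊆T (∈-segVars⁺ p (suc e) u (ℕ.≤-trans p≤a le) (ℕ.≤-trans (subst (u <_) c≡ lt) c≤q) t∈u))
               a ℕ.≤-refl (subst (a <_) (sym c≡) a<c) o)

  module _ {e : ℕ → Triple} (ex : IsExecution e) {ed : Triple} where
    private
      module T = Trace ex
    open OnRun T.run

    infBcast : ¬ QuietCycle (edgeVar ed) → InfOften (_≡ ed) e → InfBcast e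
    infBcast none inf = T.often⇐ λ T →
      let t , le , b = OfRun.bcsEventually T.run (T.often⇒ {_≡ ed} inf) none T in t , le , obs-bc zero (Run.step T.run t) b

    bcTimes : InfBcast e → ∀ T → ∃[ t ] (T ≤ t × isBc (Run.step T.run t) ≡ true)
    bcTimes inf T = let t , le , x , o , l = T.often⇒ {λ x → label x ≡ bc} inf T in t , le , obs-label zero (Run.step T.run t) o l

    hasB⇒ : InfBcast e → InfOften (_≡ ed) e → BroadcastCycle (edgeVar ed)
    hasB⇒ bcs inf = OfRun.broadcastCycle T.run (T.often⇒ {_≡ ed} inf) (bcTimes bcs)

    module _ (bursts : ∀ M → ∃[ i ] ∃[ j ] ((∀ t → i ≤ t → t < j → label (e t) ≢ bc) ×
         Σ (Fin M → ℕ) λ p → (∀ x y → p x ≡ p y → x ≡ y) × (∀ x → i ≤ p x × p x < j × e (p x) ≡ ed))) where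

      Loop : ℕ → Set
      Loop T = ∃[ a ] ∃[ b ] (T ≤ a × a < b × key a ≡ key b × Quiet∈ a b × observe T.run a ≡ just ed)

      -- Among T + size + 1 occurrences in one burst, at most T happen before time T, and two of the
      -- others happen in the same configuration.
      burst-loop : ∀ T → Loop T
      burst-loop T =
        let i , j , quiet , p , inj , at = bursts (suc (T + size))
            x , y , x<y , e≡ = Fin.pigeonhole (ℕ.n<1+n (T + size)) (λ x → join T size (slot (p x)))
        in found i j quiet (p x) (p y) (at x) (at y) (λ e → Fin.<⇒≢ x<y (inj x y e))
             (trans (sym (Fin.splitAt-join T size (slot (p x)))) (trans (cong (splitAt T) e≡) (Fin.splitAt-join T size (slot (p y)))))
        where
        slot : ℕ → Fin T ⊎ Fin size
        slot q with T.σ q ℕ.<? T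
        ... | yes lt = inj₁ (fromℕ< lt)
        ... | no _   = inj₂ (key (T.σ q))

        same-slot : ∀ q q′ → q ≢ q′ → slot q ≡ slot q′ → T ≤ T.σ q × T ≤ T.σ q′ × key (T.σ q) ≡ key (T.σ q′)
        same-slot q q′ ne e with T.σ q ℕ.<? T | T.σ q′ ℕ.<? T | e
        ... | yes lt | yes lt′ | e = ⊥-elim (ne (σ-injective (trans (sym (Fin.toℕ-fromℕ< lt))
                (trans (cong toℕ (Sum.inj₁-injective e)) (Fin.toℕ-fromℕ< lt′)))))
          where
          σ-injective : ∀ {a b} → T.σ a ≡ T.σ b → a ≡ b
          σ-injective s = ℕ.≤-antisym (T.σ-cancel≤ (ℕ.≤-reflexive s)) (T.σ-cancel≤ (ℕ.≤-reflexive (sym s)))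
        ... | yes _ | no _ | ()
        ... | no _ | yes _ | ()
        ... | no a | no b | e = ℕ.≮⇒≥ a , ℕ.≮⇒≥ b , Sum.inj₂-injective e

        found : ∀ i j → (∀ t → i ≤ t → t < j → label (e t) ≢ bc) → ∀ q q′ →
          i ≤ q × q < j × e q ≡ ed → i ≤ q′ × q′ < j × e q′ ≡ ed → q ≢ q′ → slot q ≡ slot q′ → Loop T
        found i j quiet q q′ at at′ ne e≡ = order (ℕ.<-cmp q q′) (same-slot q q′ ne e≡)
          where
          loop : ∀ {q q′} → q < q′ → i ≤ q × q < j × e q ≡ ed → q′ < j → T ≤ T.σ q → key (T.σ q) ≡ key (T.σ q′) → Loop T
          loop {q} {q′} q<q′ (i≤q , _ , eq) q′<j T≤ k≡ =
            T.σ q , T.σ q′ , T≤ , T.σ-mono q<q′ , k≡ , quiet′ , trans (T.O-σ q) (cong just eq)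
            where
            quiet′ : Quiet∈ (T.σ q) (T.σ q′)
            quiet′ t le lt with isBc (Run.step T.run t) in b
            ... | false = refl
            ... | true  =
              let x , o , lab = obs-bc zero (Run.step T.run t) b
                  u , σu , eu = T.σ-onto o
              in ⊥-elim (quiet u (ℕ.≤-trans i≤q (T.σ-cancel≤ (subst (T.σ q ≤_) (sym σu) le)))
                   (ℕ.<-trans (T.σ-cancel< (subst (_< T.σ q′) (sym σu) lt)) q′<j) (trans (cong label eu) lab))
          order : Tri (q < q′) (q ≡ q′) (q′ < q) → T ≤ T.σ q × T ≤ T.σ q′ × key (T.σ q) ≡ key (T.σ q′) → Loop T
          order (tri< lt _ _) (T≤ , _ , k≡) = loop lt at (proj₁ (proj₂ at′)) T≤ k≡
          order (tri≈ _ eq _) _ = ⊥-elim (ne eq)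
          order (tri> _ _ gt) (_ , T≤ , k≡) = loop gt at′ (proj₁ (proj₂ at)) T≤ (sym k≡)

      green⇒ : InfBcast e → BurstCycle (edgeVar ed)
      green⇒ inf = OfRun.burstCycle T.run often (bcTimes inf)
        (λ T → let a , b , le , rest = burst-loop T in a , b , le , rest)
        where
        often : OftenIn T.run (_≡ ed)
        often T = let a , _ , le , _ , _ , _ , o = burst-loop T in a , le , ed , o , refl

  -- Deciding the four types

  module _ {x y : Pl} {l : Label k A} (ue : UEdge m n x l y) where
    private
      ed : Triple
      ed = x , l , y
      v : Var
      v = edgeVar ed

    quietDec : Dec (QuietCycle v)
    quietDec = quietCycle? v

    hasF? : Dec (HasF ed)
    hasF? = map′ (lassoF⇒ ∘ quietCycle⇒ ue) back quietDec
      where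
      back : HasF ed → QuietCycle v
      back (e , ex , fin , inf) = decide quietDec
        where
        decide : Dec (QuietCycle v) → QuietCycle v
        decide (yes c) = c
        decide (no ¬c) = ⊥-elim (fin (infBcast ex ¬c inf))

    hasB? : Dec (HasB ed)
    hasB? = map′ (lassoB⇒ ∘ broadcastCycle⇒ ue) (λ (e , ex , bcs , inf) → hasB⇒ ex bcs inf) (broadcastCycle? v)

    green? : Dec (Green ed)
    green? = map′ (lassoG⇒ ∘ burstCycle⇒ ue) (λ (e , ex , bcs , bursts) → green⇒ ex bursts bcs) (burstCycle? v)

    -- No execution has to be classified by its number of broadcasts: if there is no quiet cycle,
    -- every execution on which the edge recurs has infinitely many and falls under `hasB?`.
    red? : Dec (Red ed)
    red? = decide quietDec hasB?
      where
      decide : Dec (QuietCycle v) → Dec (HasB ed) → Dec (Red ed)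
      decide (yes c) _ = let e , ex , _ , inf = lassoF⇒ (quietCycle⇒ ue c) in no λ red → red e ex inf
      decide (no _) (yes (e , ex , _ , inf)) = no λ red → red e ex inf
      decide (no ¬c) (no ¬b) = yes λ e ex inf → ¬b (e , ex , infBcast ex ¬c inf , inf)

    blue? : Dec (Blue ed)
    blue? = hasF? ×-dec map′ (λ ¬b e ex bcs inf → ¬b (e , ex , bcs , inf)) (λ f (e , ex , bcs , inf) → f e ex bcs inf) (¬? hasB?)

    types : Dec (Red ed) × Dec (Blue ed) × Dec (Green ed) × Dec (Orange ed)
    types = red? , blue? , green? , (¬? red? ×-dec (¬? blue? ×-dec ¬? green?))

module _ {k A : ℕ} (P : Template k A) where
  open Template P
  open Unwind P

  -- Every derivation of membership goes back to an initial state, so the given edge itself provides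
  -- the default state.
  initial-state : ∀ {i s} → InS i s → ∃[ s₀ ] init s₀ ≡ true
  initial-state (init0 e)          = _ , e
  initial-state (bstep s∈ _)       = initial-state s∈
  initial-state (rtgt (sat {h = h} _ srcs)) = initial-state (proj₂ (proj₂ (proj₂ (srcs h))))

  -- For a rendezvous edge, saturation supplies some edge with the same symbol, which by uniqueness
  -- starts in the same state.
  source∈ : ∀ {m n} x l y → UEdge m n x l y → InS (proj₂ x) (proj₁ x)
  source∈ (s , i) bc (t , j) (_ , s∈ , _) = s∈
  source∈ (s , i) (rdz a h) (t , j) (_ , _ , sat {h = h} e srcs) =
    let s′ , t′ , e′ , s∈ = srcs h in subst (InS i) (proj₁ (rdzUnique a h _ _ _ _ e′ e)) s∈

theorem4 : ∀ {k A : ℕ} → 1 ≤ k → (P : Template k A) →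
    (m n : ℕ) → Unwind.IsPeriod P m n →
    (x y : Fin (Template.nSt P) × ℕ) (l : Label k A) →
    Unwind.UEdge P m n x l y →
    Dec (RB.Red (Unwind.unwind P m n) (x , l , y)) ×
    Dec (RB.Blue (Unwind.unwind P m n) (x , l , y)) ×
    Dec (RB.Green (Unwind.unwind P m n) (x , l , y)) ×
    Dec (RB.Orange (Unwind.unwind P m n) (x , l , y))
theorem4 1≤k P m n (n≤m , (same , _) , _) x y l ue =
  let s₀ , init₀ = initial-state P (source∈ P x l y ue)
  in Unwinding.types 1≤k P m n n≤m (Equivalence.to (same _)) s₀ init₀ ue
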